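{- Let $n$ be a positive integer with $n\notin\{2,3,5,7\}$. Then there exists an AP-Destroying permutation $\pi:\mathbb{Z}/n\mathbb{Z}\to\mathbb{Z}/n\mathbb{Z}$.
   Context: Given a permutation $\pi$ (bijection) of $\mathbb{Z}/n\mathbb{Z}$, a three-term arithmetic progression $(a,a+r,a+2r)$ in $\mathbb{Z}/n\mathbb{Z}$ with not all terms equal (i.e. $r\neq 0$) is called preserved by $\pi$ if $\pi(a+2r)-2\pi(a+r)+\pi(a)=0$ in $\mathbb{Z}/n\mathbb{Z}$. (Progressions with $a+2r=a$ but $a+r\ne a$ are allowed.) The permutation $\pi$ is AP-Destroying if no such progression is preserved by $\pi$. -}

module Defs where

open import Data.Fin.Base using (Fin; toℕ)
open import Data.Fin.Permutation using (Permutation′; _⟨$⟩ʳ_)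
import Data.Nat.Base as ℕ
open import Data.Nat.Base using (ℕ; NonZero)
open import Data.Nat.DivMod using (_mod_)
open import Relation.Binary.PropositionalEquality.Core using (_≡_; _≢_)
open import Relation.Nullary.Negation.Core using (¬_)

-- ℤ/nℤ is represented by Fin n, with arithmetic on the least non-negative
-- residues.

module _ {n : ℕ} .{{_ : NonZero n}} where

  infixl 6 _+_ _-_
  infix  8 -_ 2·_

  0# : Fin n
  0# = 0 mod n

  _+_ : Fin n → Fin n → Fin n
  x + y = (toℕ x ℕ.+ toℕ y) mod n

  -- The truncated subtraction is exact, as toℕ x < n.
  -_ : Fin n → Fin n
  - x = (n ℕ.∸ toℕ x) mod n

  _-_ : Fin n → Fin n → Fin n
  x - y = x + (- y)

  2·_ : Fin n → Fin n
  2· x = x + x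

  -- π preserves the progression (a, a + r, a + 2r).
  Preserves : Permutation′ n → (a r : Fin n) → Set
  Preserves π a r =
    (π ⟨$⟩ʳ (a + 2· r)) - 2· (π ⟨$⟩ʳ (a + r)) + (π ⟨$⟩ʳ a) ≡ 0#

  AP-Destroying : Permutation′ n → Set
  AP-Destroying π = ∀ a r → r ≢ 0# → ¬ Preserves π a r

{-# OPTIONS --safe #-}

-- If m and k admit AP-destroying permutations, so does m k, as a progression is
-- destroyed either by its residues modulo k or, these being equal, by its
-- quotients. It remains to treat the products of two or three of 2, 3, 5, 7, by
-- explicit permutations, and the numbers p and q p with p ≥ 11 prime and q one of
-- 2, 3, 5, 7.
--
-- On ℤ/q × ℤ/p take (i , x) ↦ (σ i , S i / x) with each S i either 1 or a parameter
-- e, after permuting finitely many exceptional points around 0. A preserved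
-- progression with at most one exceptional point gives a quadratic equation, whose
-- discriminant is a nonresidue for a suitable e; one with more exceptional points
-- makes e a root of one of finitely many polynomials. For e = -x / y it suffices
-- that x, y, 9 x + y and x + 9 y are residues modulo p and x + y is not, apart
-- from these roots. If some number up to 42 is a nonresidue, a case distinction on
-- the characters of -1 and of the small primes leads to explicit choices of e, or
-- to explicit configurations. Otherwise let N be the least nonresidue and take
-- x + y = N: if 9 x + y and x + 9 y are products of numbers below N, they are
-- residues, and for large N there are more such pairs than roots.

module Submission where

open import Defs using (AP-Destroying)
import Defs
open import Data.Bool.Base using (Bool; true; false; T; if_then_else_; _∧_; _∨_; not)
open import Data.Empty using (⊥; ⊥-elim)
open import Data.Fin.Base as Fin using (Fin; toℕ; fromℕ<; punchOut; remQuot; zero; suc)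
import Data.Fin.Properties as Fin
open import Data.Fin.Permutation using (Permutation′; permutation)
open import Data.Integer.Base as ℤ using (ℤ; +_; -[1+_]; ∣_∣; _+_; _*_; _-_; -_; 0ℤ; 1ℤ; -1ℤ)
import Data.Integer.Properties as ℤ
open import Data.Integer.DivMod using (_%ℕ_; _/ℕ_; n%ℕd<d; a≡a%ℕn+[a/ℕn]*n)
open import Data.Integer.Divisibility.Signed using (_∣_; divides; _∣?_; ∣ᵤ⇒∣; ∣⇒∣ᵤ; ∣m∣n⇒∣m+n; ∣m⇒∣-m; ∣n⇒∣m*n)
open import Data.Integer.Tactic.RingSolver using (solve-∀)
open import Data.Nat.Base as ℕ using (ℕ; zero; suc; NonZero; _≡ᵇ_; _<ᵇ_)
import Data.Nat.Properties as ℕ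
import Data.Nat.Divisibility as ℕ using (_∣_; divides; ∣⇒≤; n∣m⇒m%n≡0; m%n≡0⇒n∣m; >⇒∤; %-presˡ-∣; _∣0)
import Data.Nat.DivMod as ℕ using (_%_; _/_; _mod_; m≡m%n+[m/n]*n; m%n<n; m<n⇒m%n≡m; [m+n]%n≡m%n; m/n<m)
open import Data.Nat.Coprimality as Cop using (Coprime; coprime-Bézout)
open import Data.Nat.GCD using (module Bézout)
open import Data.Product.Base using (∃-syntax; Σ-syntax; _×_; _,_; proj₁; proj₂)
open import Data.Sum.Base using (_⊎_; inj₁; inj₂; [_,_]′)
open import Function.Base using (_∘_)
open import Relation.Nullary using (¬_; Dec; yes; no; contradiction)
open import Relation.Binary.PropositionalEquality using (_≡_; refl; sym; trans; cong; cong₂; subst)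
open import Data.Nat.Primality using (Prime; euclidsLemma; prime⇒nonZero; prime⇒irreducible; prime?; productOfPrimes≢0)
import Data.Sum.Base as Sum
open import Relation.Nullary.Decidable using (map′; ¬?; from-no)
open import Data.Bool.Properties using (T-∧; T-∨)
open import Data.Unit.Base using (tt)
open import Data.Bool.ListAction using (any; all)
open import Data.List.Base as List using (List; []; _∷_; _++_; map; concatMap; upTo; length; foldr; filterᵇ; take; filter; applyUpTo)
open import Data.List.Membership.Propositional using (_∈_; find; _∉_)
open import Data.List.Membership.Propositional.Properties using (∈-upTo⁺; ∈-filter⁻; ∈-applyUpTo⁻; ∈-map⁻)
open import Data.List.Relation.Unary.All as All using (All; []; _∷_)
import Data.List.Relation.Unary.All.Properties as All
open import Data.List.Relation.Unary.Any as Any using (here; there)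
import Data.List.Relation.Unary.Any.Properties as Any
open import Function.Bundles using (Equivalence)
open import Data.Maybe.Base as Maybe using (Maybe; just; nothing)
import Data.Nat.Tactic.RingSolver as ℕ using (solve-∀)
import Data.List.Properties as List
open import Data.List.Relation.Unary.AllPairs as AllPairs using (AllPairs; []; _∷_)
import Data.List.Relation.Unary.AllPairs.Properties as AllPairs
import Data.Nat.ListAction as ℕ using (sum; product)
open import Data.Nat.Primality.Factorisation using (PrimeFactorisation; factorise)

-- Inversion destroys every progression of nonzero terms, since a + c = 2 b and 1 / a + 1 / c = 2 /
-- b force (a - c)² = 0. The obstacle is 0, which inversion fixes: -a, 0, a is preserved. If 0 is
-- moved to z, then, with equal weights, a progression starting in 0 is preserved when it ends in 3
-- z; for a point z moved to 0 the bad end is z / 3. These roots are rational and present for every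
-- p, so the ends must become exceptional too; hence the ratios 3 among the constants of the
-- configurations.
--
-- A point z moved to e z has the value (1 / e) / z, as if it carried the weight 1 / e. The factors
-- S i are weights as well, needed because the permutations σ used here still preserve some
-- progressions of classes. Weights s, t, u on three terms lead to the discriminant (s + u - 4 t)² -
-- 4 s u. For weights 1 and e, not all equal, it is up to squares (e - 1) times e, -1, e - 9 or 9 e
-- - 1, and e = -x / y turns these into (x + y) times x, y, x + 9 y and 9 x + y.

Z : ℕ → ℤ → Set
Z n x = + n ∣ x

module _ {n : ℕ} where

  infixl 6 _+ᶻ_ _-ᶻ_
  infixl 7 _*ᶻ_

  _+ᶻ_ : ∀ {x y} → Z n x → Z n y → Z n (x + y)
  _+ᶻ_ = ∣m∣n⇒∣m+n

  _-ᶻ_ : ∀ {x y} → Z n x → Z n y → Z n (x - y)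
  a -ᶻ b = ∣m∣n⇒∣m+n a (∣m⇒∣-m b)

  _*ᶻ_ : ∀ u {x} → Z n x → Z n (u * x)
  u *ᶻ a = ∣n⇒∣m*n u a

  negᶻ : ∀ {x} → Z n x → Z n (- x)
  negᶻ = ∣m⇒∣-m

  by : ∀ {x y} → x ≡ y → Z n x → Z n y
  by = subst (Z n)

  Z0 : Z n 0ℤ
  Z0 = divides 0ℤ refl

  ≡⇒Z : ∀ {x y} → x ≡ y → Z n (x - y)
  ≡⇒Z {x} refl = by (sym (ℤ.+-inverseʳ x)) Z0

  Z-self : ∀ k → Z n (k * + n)
  Z-self k = divides k refl

  Z-sym : ∀ x y → Z n (x - y) → Z n (y - x)
  Z-sym x y p = by (lem x y) (negᶻ p)
    where
    lem : ∀ x y → - (x - y) ≡ y - x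
    lem = solve-∀

  Z-trans : ∀ x y z → Z n (x - y) → Z n (y - z) → Z n (x - z)
  Z-trans x y z p q = by (lem x y z) (p +ᶻ q)
    where
    lem : ∀ x y z → x - y + (y - z) ≡ x - z
    lem = solve-∀

  Z-resp : ∀ x y → Z n (x - y) → Z n y → Z n x
  Z-resp x y p q = by (lem x y) (p +ᶻ q)
    where
    lem : ∀ x y → x - y + y ≡ x
    lem = solve-∀

Z? : ∀ n x → Dec (Z n x)
Z? n x = + n ∣? x

AP : ℕ → (a b c : ℤ) → Set
AP n a b c = Z n (a + c - + 2 * b)

-- The image is a function on all integers that respects congruence, so that computations are
-- identities of integers for the ring solver. Triples with a ≡ c are included; for even n they
-- cover the difference n / 2. A progression is constant as soon as a ≡ b.
record Destroying (n : ℕ) : Set where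
  field
    image : ℤ → ℤ
    image-resp : ∀ a b → Z n (a - b) → Z n (image a - image b)
    image-inj : ∀ a b → Z n (image a - image b) → Z n (a - b)
    destroys : ∀ a b c → AP n a b c → AP n (image a) (image b) (image c) → Z n (a - b)

<⇒Z⇒≡ : ∀ {n i j} → i ℕ.< n → j ℕ.< n → Z n (+ i - + j) → i ≡ j
<⇒Z⇒≡ {n} {i} {j} i<n j<n z with ∣ + i - + j ∣ in eq | ∣⇒∣ᵤ z
... | zero | _ = ℤ.+-injective (ℤ.i-j≡0⇒i≡j (+ i) (+ j) (ℤ.∣i∣≡0⇒i≡0 eq))
... | suc d | n∣d = contradiction (ℕ.∣⇒≤ n∣d)
  (ℕ.<⇒≱ (ℕ.≤-<-trans (ℕ.≤-reflexive (sym eq)) (ℕ.≤-<-trans bound (ℕ.⊔-pres-<m i<n j<n))))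
  where
  bound : ∣ + i - + j ∣ ℕ.≤ i ℕ.⊔ j
  bound = subst (λ x → ∣ x ∣ ℕ.≤ i ℕ.⊔ j) (sym (ℤ.m-n≡m⊖n i j)) (ℤ.∣m⊝n∣≤m⊔n i j)

%ℕ-Z : ∀ n .{{_ : NonZero n}} x → Z n (x - + (x %ℕ n))
%ℕ-Z n x = divides (x /ℕ n) (trans (cong (_- + (x %ℕ n)) (a≡a%ℕn+[a/ℕn]*n x n)) (lem (+ (x %ℕ n)) _))
  where
  lem : ∀ r m → r + m - r ≡ m
  lem = solve-∀

%ℕ-cong : ∀ {n} .{{_ : NonZero n}} x y → Z n (x - y) → x %ℕ n ≡ y %ℕ n
%ℕ-cong {n} x y z = <⇒Z⇒≡ (n%ℕd<d x n) (n%ℕd<d y n)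
  (Z-trans (+ (x %ℕ n)) y (+ (y %ℕ n)) (Z-trans (+ (x %ℕ n)) x y (Z-sym x (+ (x %ℕ n)) (%ℕ-Z n x)) z) (%ℕ-Z n y))

-- Residues as elements of `Fin n`, and the passage to permutations

module _ {n : ℕ} .{{_ : NonZero n}} where

  ⟦_⟧ : Fin n → ℤ
  ⟦ x ⟧ = + toℕ x

  [_] : ℤ → Fin n
  [ x ] = fromℕ< (n%ℕd<d x n)

  ⟦[]⟧ : ∀ x → Z n (x - ⟦ [ x ] ⟧)
  ⟦[]⟧ x = subst (λ k → Z n (x - + k)) (sym (Fin.toℕ-fromℕ< (n%ℕd<d x n))) (%ℕ-Z n x)

  mod-Z : ∀ m → Z n (⟦ m ℕ.mod n ⟧ - + m)
  mod-Z m = subst (λ k → Z n (+ k - + m)) (sym (Fin.toℕ-fromℕ< (ℕ.m%n<n m n)))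
    (Z-sym (+ m) (+ (m ℕ.% n)) (divides (+ (m ℕ./ n)) (trans (cong (λ k → + k - + (m ℕ.% n)) (ℕ.m≡m%n+[m/n]*n m n))
      (trans (cong (_- + (m ℕ.% n)) (trans (ℤ.pos-+ (m ℕ.% n) _) (cong (λ z → + (m ℕ.% n) + z) (ℤ.pos-* (m ℕ./ n) n)))) (lem (+ (m ℕ.% n)) _)))))
    where
    lem : ∀ r m → r + m - r ≡ m
    lem = solve-∀

  ⟦⟧-inj : ∀ x y → Z n (⟦ x ⟧ - ⟦ y ⟧) → x ≡ y
  ⟦⟧-inj x y z = Fin.toℕ-injective (<⇒Z⇒≡ (Fin.toℕ<n x) (Fin.toℕ<n y) z)

  ⟦+⟧ : ∀ x y → Z n (⟦ x Defs.+ y ⟧ - (⟦ x ⟧ + ⟦ y ⟧))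
  ⟦+⟧ x y = mod-Z (toℕ x ℕ.+ toℕ y)

  ⟦-⟧ : ∀ x → Z n (⟦ Defs.- x ⟧ - (- ⟦ x ⟧))
  ⟦-⟧ x = by (lem ⟦ Defs.- x ⟧ (+ (n ℕ.∸ toℕ x)) ⟦ x ⟧)
      (mod-Z (n ℕ.∸ toℕ x) +ᶻ
       by (trans (sym (cong +_ (ℕ.m∸n+n≡m (ℕ.<⇒≤ (Fin.toℕ<n x))))) (ℤ.pos-+ (n ℕ.∸ toℕ x) (toℕ x))) (by (ℤ.*-identityˡ (+ n)) (Z-self 1ℤ)))
    where
    lem : ∀ u d x → (u - d) + (d + x) ≡ u - - x
    lem = solve-∀

  ⟦2·⟧ : ∀ x → Z n (⟦ Defs.2· x ⟧ - + 2 * ⟦ x ⟧)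
  ⟦2·⟧ x = by (lem ⟦ Defs.2· x ⟧ ⟦ x ⟧) (⟦+⟧ x x)
    where
    lem : ∀ u x → u - (x + x) ≡ u - + 2 * x
    lem = solve-∀

injective⇒surjective : ∀ {n} (f : Fin n → Fin n) → (∀ {x y} → f x ≡ f y → x ≡ y) → ∀ y → ∃[ x ] f x ≡ y
injective⇒surjective {suc n} f inj y with Fin.any? (λ x → f x Fin.≟ y)
... | yes p = p
... | no ¬p = contradiction (Fin.injective⇒≤ {f = λ x → punchOut (λ e → ¬p (x , sym e))}
    (λ eq → inj (Fin.punchOut-injective (λ e → ¬p (_ , sym e)) (λ e → ¬p (_ , sym e)) eq))) ℕ.1+n≰n

destroying⇒permutation : ∀ n .{{_ : NonZero n}} → Destroying n → Σ[ π ∈ Permutation′ n ] AP-Destroying π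
destroying⇒permutation n d = π , ap
  where
  open Destroying d
  f : Fin n → Fin n
  f x = [ image ⟦ x ⟧ ]
  f-Z : ∀ x → Z n (image ⟦ x ⟧ - ⟦ f x ⟧)
  f-Z x = ⟦[]⟧ (image ⟦ x ⟧)
  f-inj : ∀ {x y} → f x ≡ f y → x ≡ y
  f-inj {x} {y} eq = ⟦⟧-inj x y (image-inj ⟦ x ⟧ ⟦ y ⟧ (Z-trans (image ⟦ x ⟧) ⟦ f x ⟧ (image ⟦ y ⟧) (f-Z x)
    (subst (λ u → Z n (⟦ u ⟧ - image ⟦ y ⟧)) (sym eq) (Z-sym (image ⟦ y ⟧) ⟦ f y ⟧ (f-Z y)))))
  surj = injective⇒surjective f f-inj
  π : Permutation′ n
  π = permutation f (proj₁ ∘ surj) (λ y → proj₂ (surj y)) (λ x → f-inj (proj₂ (surj (f x))))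
  ap : AP-Destroying π
  ap a r r≢0 pres = r≢0 (⟦⟧-inj r Defs.0# (Z-trans ⟦ r ⟧ 0ℤ ⟦ Defs.0# {n} ⟧ r≈0 (Z-sym ⟦ Defs.0# {n} ⟧ 0ℤ (mod-Z 0))))
    where
    b c : Fin n
    b = a Defs.+ r
    c = a Defs.+ Defs.2· r
    c≈ : Z n (⟦ c ⟧ - (⟦ a ⟧ + + 2 * ⟦ r ⟧))
    c≈ = by (lem ⟦ c ⟧ ⟦ a ⟧ ⟦ Defs.2· r ⟧ ⟦ r ⟧) (⟦+⟧ a (Defs.2· r) +ᶻ ⟦2·⟧ r)
      where
      lem : ∀ c a s r → (c - (a + s)) + (s - + 2 * r) ≡ c - (a + + 2 * r)
      lem = solve-∀
    dom : AP n ⟦ a ⟧ ⟦ b ⟧ ⟦ c ⟧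
    dom = by (lem ⟦ a ⟧ ⟦ b ⟧ ⟦ c ⟧ ⟦ r ⟧) (c≈ -ᶻ (+ 2 *ᶻ ⟦+⟧ a r))
      where
      lem : ∀ a b c r → (c - (a + + 2 * r)) - + 2 * (b - (a + r)) ≡ a + c - + 2 * b
      lem = solve-∀
    X Y W : Fin n
    X = f c
    Y = f b
    W = f a
    sum : Z n (⟦ X ⟧ - + 2 * ⟦ Y ⟧ + ⟦ W ⟧)
    sum = by (lem ⟦ X ⟧ ⟦ Y ⟧ ⟦ W ⟧ ⟦ Defs.2· Y ⟧ ⟦ Defs.- (Defs.2· Y) ⟧ ⟦ X Defs.- Defs.2· Y ⟧ ⟦ X Defs.- Defs.2· Y Defs.+ W ⟧)
      (negᶻ (⟦+⟧ (X Defs.- Defs.2· Y) W) +ᶻ negᶻ (⟦+⟧ X (Defs.- (Defs.2· Y))) +ᶻ negᶻ (⟦-⟧ (Defs.2· Y)) +ᶻ ⟦2·⟧ Y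
       +ᶻ subst (λ u → Z n ⟦ u ⟧) (sym pres) (by (lem₀ ⟦ Defs.0# {n} ⟧) (mod-Z 0)))
      where
      lem : ∀ x y w t m s u → - (u - (s + w)) + - (s - (x + m)) + - (m - - t) + (t - + 2 * y) + u ≡ x - + 2 * y + w
      lem = solve-∀
      lem₀ : ∀ u → u - 0ℤ ≡ u
      lem₀ = solve-∀
    img : AP n (image ⟦ a ⟧) (image ⟦ b ⟧) (image ⟦ c ⟧)
    img = by (lem ⟦ X ⟧ ⟦ Y ⟧ ⟦ W ⟧ (image ⟦ c ⟧) (image ⟦ b ⟧) (image ⟦ a ⟧)) (f-Z c -ᶻ (+ 2 *ᶻ f-Z b) +ᶻ f-Z a +ᶻ sum)
      where
      lem : ∀ x y w x' y' w' → (x' - x) - + 2 * (y' - y) + (w' - w) + (x - + 2 * y + w) ≡ w' + x' - + 2 * y'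
      lem = solve-∀
    r≈0 : Z n (⟦ r ⟧ - 0ℤ)
    r≈0 = by (lem ⟦ a ⟧ ⟦ b ⟧ ⟦ r ⟧) (negᶻ (⟦+⟧ a r) -ᶻ destroys ⟦ a ⟧ ⟦ b ⟧ ⟦ c ⟧ dom img)
      where
      lem : ∀ a b r → - (b - (a + r)) - (a - b) ≡ r - 0ℤ
      lem = solve-∀

-- Products of moduli

Z-* : ∀ m k {x} → Z (m ℕ.* k) x → Z k x
Z-* m k (divides q eq) = divides (q * + m) (trans eq (trans (cong (q *_) (ℤ.pos-* m k)) (sym (ℤ.*-assoc q (+ m) (+ k)))))

Z-*⁺ : ∀ m k {x} → Z m x → Z (m ℕ.* k) (x * + k)
Z-*⁺ m k (divides q eq) = divides q (trans (cong (_* + k) eq) (trans (ℤ.*-assoc q (+ m) (+ k)) (cong (q *_) (sym (ℤ.pos-* m k)))))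

Z-*⁻ : ∀ m k .{{_ : NonZero k}} {x} → Z (m ℕ.* k) (x * + k) → Z m x
Z-*⁻ m (suc k) {x} (divides q eq) = divides q (ℤ.*-cancelʳ-≡ x (q * + m) (+ suc k)
  (trans eq (trans (cong (q *_) (ℤ.pos-* m (suc k))) (sym (ℤ.*-assoc q (+ m) (+ suc k))))))

-- x ↦ (x mod k, x div k): the progression is destroyed by the first coordinate
-- unless it lies in one class modulo k, and then by the second one.
destroying-* : ∀ {m k} .{{_ : NonZero k}} → Destroying m → Destroying k → Destroying (m ℕ.* k)
destroying-* {m} {k} dm dk = record { image = F ; image-resp = F-resp ; image-inj = F-inj ; destroys = F-ap }
  where
  module M = Destroying dm
  module K = Destroying dk
  rem quo low : ℤ → ℤ
  rem x = + (x %ℕ k)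
  quo x = x /ℕ k
  low x = + (K.image (rem x) %ℕ k)
  F : ℤ → ℤ
  F x = low x + M.image (quo x) * + k
  split : ∀ x → x ≡ rem x + quo x * + k
  split x = a≡a%ℕn+[a/ℕn]*n x k
  low-Z : ∀ x → Z k (F x - K.image x)
  low-Z x = by (lem (low x) (M.image (quo x)) (+ k) (K.image (rem x)) (K.image x))
    (Z-sym (K.image (rem x)) (low x) (%ℕ-Z k (K.image (rem x))) +ᶻ Z-self (M.image (quo x)) +ᶻ K.image-resp (rem x) x (Z-sym x (rem x) (%ℕ-Z k x)))
    where
    lem : ∀ l q k r x → (l - r) + q * k + (r - x) ≡ l + q * k - x
    lem = solve-∀
  rem-eq : ∀ x y → Z k (x - y) → rem x ≡ rem y
  rem-eq x y z = cong +_ (%ℕ-cong x y z)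
  quo-Z : ∀ x y → Z (m ℕ.* k) (x - y) → Z m (quo x - quo y)
  quo-Z x y z = Z-*⁻ m k (by eq z)
    where
    lem : ∀ r q q' k → (r + q * k) - (r + q' * k) ≡ (q - q') * k
    lem = solve-∀
    eq : x - y ≡ (quo x - quo y) * + k
    eq = trans (cong₂ _-_ (split x) (split y)) (trans (cong (λ r → rem x + quo x * + k - (r + quo y * + k)) (sym (rem-eq x y (Z-* m k z)))) (lem (rem x) (quo x) (quo y) (+ k)))
  join : ∀ x y → rem x ≡ rem y → Z m (quo x - quo y) → Z (m ℕ.* k) (x - y)
  join x y r z = by (sym eq) (Z-*⁺ m k z)
    where
    lem : ∀ r q q' k → (r + q * k) - (r + q' * k) ≡ (q - q') * k
    lem = solve-∀
    eq : x - y ≡ (quo x - quo y) * + k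
    eq = trans (cong₂ _-_ (split x) (split y)) (trans (cong (λ u → rem x + quo x * + k - (u + quo y * + k)) (sym r)) (lem (rem x) (quo x) (quo y) (+ k)))
  F-resp : ∀ a b → Z (m ℕ.* k) (a - b) → Z (m ℕ.* k) (F a - F b)
  F-resp a b z = by (sym eq) (Z-*⁺ m k (M.image-resp (quo a) (quo b) (quo-Z a b z)))
    where
    lem : ∀ r q q' k → (r + q * k) - (r + q' * k) ≡ (q - q') * k
    lem = solve-∀
    eq : F a - F b ≡ (M.image (quo a) - M.image (quo b)) * + k
    eq = trans (cong (λ u → F a - (+ (K.image u %ℕ k) + M.image (quo b) * + k)) (sym (rem-eq a b (Z-* m k z)))) (lem (low a) (M.image (quo a)) (M.image (quo b)) (+ k))
  F-inj : ∀ a b → Z (m ℕ.* k) (F a - F b) → Z (m ℕ.* k) (a - b)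
  F-inj a b z = join a b req (M.image-inj (quo a) (quo b) (Z-*⁻ m k (by eq z)))
    where
    zk : Z k (a - b)
    zk = K.image-inj a b (Z-trans (K.image a) (F b) (K.image b) (Z-trans (K.image a) (F a) (F b) (Z-sym (F a) (K.image a) (low-Z a)) (Z-* m k z)) (low-Z b))
    req : rem a ≡ rem b
    req = rem-eq a b zk
    lem : ∀ r q q' k → (r + q * k) - (r + q' * k) ≡ (q - q') * k
    lem = solve-∀
    eq : F a - F b ≡ (M.image (quo a) - M.image (quo b)) * + k
    eq = trans (cong (λ u → F a - (+ (K.image u %ℕ k) + M.image (quo b) * + k)) (sym req)) (lem (low a) (M.image (quo a)) (M.image (quo b)) (+ k))
  F-ap : ∀ a b c → AP (m ℕ.* k) a b c → AP (m ℕ.* k) (F a) (F b) (F c) → Z (m ℕ.* k) (a - b)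
  F-ap a b c d i = join a b ra (M.destroys (quo a) (quo b) (quo c) (Z-*⁻ m k (by eqd d)) (Z-*⁻ m k (by eqi i)))
    where
    iK : AP k (K.image a) (K.image b) (K.image c)
    iK = by (lem (F a) (F b) (F c) (K.image a) (K.image b) (K.image c)) (Z-* m k i -ᶻ low-Z a -ᶻ low-Z c +ᶻ (+ 2 *ᶻ low-Z b))
      where
      lem : ∀ x y z x' y' z' → x + z - + 2 * y - (x - x') - (z - z') + + 2 * (y - y') ≡ x' + z' - + 2 * y'
      lem = solve-∀
    zab : Z k (a - b)
    zab = K.destroys a b c (Z-* m k d) iK
    zcb : Z k (c - b)
    zcb = by (lem a b c) (Z-* m k d -ᶻ zab)
      where
      lem : ∀ a b c → a + c - + 2 * b - (a - b) ≡ c - b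
      lem = solve-∀
    ra : rem a ≡ rem b
    ra = rem-eq a b zab
    rc : rem c ≡ rem b
    rc = rem-eq c b zcb
    lem : ∀ r x y z k → (r + x * k) + (r + z * k) - + 2 * (r + y * k) ≡ (x + z - + 2 * y) * k
    lem = solve-∀
    eqd : a + c - + 2 * b ≡ (quo a + quo c - + 2 * quo b) * + k
    eqd = trans (cong₂ (λ s t → s - + 2 * t) (cong₂ _+_ (trans (split a) (cong (λ r → r + quo a * + k) ra)) (trans (split c) (cong (λ r → r + quo c * + k) rc))) (split b))
      (lem (rem b) (quo a) (quo b) (quo c) (+ k))
    eqi : F a + F c - + 2 * F b ≡ (M.image (quo a) + M.image (quo c) - + 2 * M.image (quo b)) * + k
    eqi = trans (cong₂ (λ s t → (+ (K.image s %ℕ k) + M.image (quo a) * + k) + (+ (K.image t %ℕ k) + M.image (quo c) * + k) - + 2 * F b) ra rc)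
      (lem (low b) (M.image (quo a)) (M.image (quo b)) (M.image (quo c)) (+ k))

-- The Chinese remainder theorem

bézout : ∀ m n → Coprime m n → ∃[ u ] Z n (+ m * u - 1ℤ)
bézout m n c with coprime-Bézout c
... | Bézout.+- x y eq = + x , divides (+ y) (trans (cong₂ (λ a b → a - b) (trans (sym (ℤ.pos-* m x)) (cong +_ (trans (ℕ.*-comm m x) (sym eq)))) refl)
  (trans (cong (_- 1ℤ) (ℤ.pos-+ 1 (y ℕ.* n))) (trans (lem (+ (y ℕ.* n))) (ℤ.pos-* y n))))
  where
  lem : ∀ t → 1ℤ + t - 1ℤ ≡ t
  lem = solve-∀
... | Bézout.-+ x y eq = - + x , divides (- + y) (trans (lem₁ (+ m) (+ x)) (trans (cong -_ (trans (cong (λ t → 1ℤ + t) (sym (ℤ.pos-* x m))) (trans (sym (ℤ.pos-+ 1 (x ℕ.* m))) (trans (cong +_ eq) (ℤ.pos-* y n))))) (lem₂ (+ y) (+ n))))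
  where
  lem₁ : ∀ m x → m * - x - 1ℤ ≡ - (1ℤ + x * m)
  lem₁ = solve-∀
  lem₂ : ∀ y n → - (y * n) ≡ - y * n
  lem₂ = solve-∀

module _ {q p : ℕ} (c : Coprime q p) (c′ : Coprime p q) where

  crt : ℤ → ℤ → ℤ
  crt t v = t * (+ p * proj₁ (bézout p q c′)) + v * (+ q * proj₁ (bézout q p c))

  crt-q : ∀ t v → Z q (crt t v - t)
  crt-q t v = by (lem t v (+ p * proj₁ (bézout p q c′)) (proj₁ (bézout q p c)) (+ q))
    ((t *ᶻ proj₂ (bézout p q c′)) +ᶻ Z-self (v * proj₁ (bézout q p c)))
    where
    lem : ∀ t v a u q → t * (a - 1ℤ) + v * u * q ≡ t * a + v * (q * u) - t
    lem = solve-∀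

  crt-p : ∀ t v → Z p (crt t v - v)
  crt-p t v = by (lem t v (proj₁ (bézout p q c′)) (+ q * proj₁ (bézout q p c)) (+ p))
    (Z-self (t * proj₁ (bézout p q c′)) +ᶻ (v *ᶻ proj₂ (bézout q p c)))
    where
    lem : ∀ t v u a p → t * u * p + v * (a - 1ℤ) ≡ t * (p * u) + v * a - v
    lem = solve-∀

  Z-coprime : ∀ {x} → Z q x → Z p x → Z (q ℕ.* p) x
  Z-coprime {x} (divides k eq) zp = by (sym (trans eq (ℤ.*-comm k (+ q)))) (by (ℤ.*-comm k (+ q)) (subst (λ n → Z n (k * + q)) (ℕ.*-comm p q) (Z-*⁺ p q zk)))
    where
    u = proj₁ (bézout q p c)
    lem : ∀ k q u → k * q * u - k * (q * u - 1ℤ) ≡ k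
    lem = solve-∀
    zk : Z p k
    zk = by (lem k (+ q) u) (by (ℤ.*-comm u (k * + q)) (u *ᶻ by eq zp) -ᶻ (k *ᶻ proj₂ (bézout q p c)))

  split-q : ∀ {x} → Z (q ℕ.* p) x → Z q x
  split-q {x} z = Z-* p q (subst (λ n → Z n x) (ℕ.*-comm q p) z)

  split-p : ∀ {x} → Z (q ℕ.* p) x → Z p x
  split-p = Z-* q p

  -- Each component of the image may depend on both residues of the argument, and a progression may
  -- survive in one component. Therefore the three conditions are assumed for both components
  -- jointly.
  glue : (τ v : ℤ → ℤ) →
    (∀ a b → Z q (a - b) → Z p (a - b) → Z q (τ a - τ b) × Z p (v a - v b)) →
    (∀ a b → Z q (τ a - τ b) → Z p (v a - v b) → Z q (a - b) × Z p (a - b)) →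
    (∀ a b c → AP q a b c → AP p a b c → AP q (τ a) (τ b) (τ c) → AP p (v a) (v b) (v c) → Z q (a - b) × Z p (a - b)) →
    Destroying (q ℕ.* p)
  glue τ v resp inj ap = record
    { image = F
    ; image-resp = λ a b z → let zτ , zv = resp a b (split-q z) (split-p z) in Z-coprime
        (by (lem₂ (F a) (F b) (τ a) (τ b)) (Fq a -ᶻ Fq b +ᶻ zτ)) (by (lem₂ (F a) (F b) (v a) (v b)) (Fp a -ᶻ Fp b +ᶻ zv))
    ; image-inj = λ a b z → let zq , zp = inj a b (by (lem₁ (F a) (F b) (τ a) (τ b)) (split-q z -ᶻ (Fq a -ᶻ Fq b)))
                                                (by (lem₁ (F a) (F b) (v a) (v b)) (split-p z -ᶻ (Fp a -ᶻ Fp b))) in Z-coprime zq zp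
    ; destroys = λ a b c d i → let zq , zp = ap a b c (split-q d) (split-p d)
                                               (by (lem₃ (F a) (F b) (F c) (τ a) (τ b) (τ c)) (split-q i -ᶻ Fq a -ᶻ Fq c +ᶻ (+ 2 *ᶻ Fq b)))
                                               (by (lem₃ (F a) (F b) (F c) (v a) (v b) (v c)) (split-p i -ᶻ Fp a -ᶻ Fp c +ᶻ (+ 2 *ᶻ Fp b))) in Z-coprime zq zp
    }
    where
    F : ℤ → ℤ
    F x = crt (τ x) (v x)
    Fq : ∀ x → Z q (F x - τ x)
    Fq x = crt-q (τ x) (v x)
    Fp : ∀ x → Z p (F x - v x)
    Fp x = crt-p (τ x) (v x)
    lem₁ : ∀ x y s t → x - y - ((x - s) - (y - t)) ≡ s - t
    lem₁ = solve-∀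
    lem₂ : ∀ x y s t → (x - s) - (y - t) + (s - t) ≡ x - y
    lem₂ = solve-∀
    lem₃ : ∀ a b c x y z → (a + c - + 2 * b) - (a - x) - (c - z) + + 2 * (b - y) ≡ x + z - + 2 * y
    lem₃ = solve-∀

-- Residues modulo a prime

module PrimeField (p : ℕ) (pr : Prime p) (2<p : 2 ℕ.< p) where

  private instance
    nz : NonZero p
    nz = prime⇒nonZero pr

  Z-prime : ∀ a b → Z p (a * b) → Z p a ⊎ Z p b
  Z-prime a b z = Sum.map ∣ᵤ⇒∣ ∣ᵤ⇒∣ (euclidsLemma ∣ a ∣ ∣ b ∣ pr (subst (p ℕ.∣_) (ℤ.abs-* a b) (∣⇒∣ᵤ z)))

  ¬Z-* : ∀ {a b} → ¬ Z p a → ¬ Z p b → ¬ Z p (a * b)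
  ¬Z-* {a} {b} na nb z = [ na , nb ]′ (Z-prime a b z)

  cancel : ∀ a b → ¬ Z p a → Z p (a * b) → Z p b
  cancel a b na z = [ (λ za → contradiction za na) , (λ zb → zb) ]′ (Z-prime a b z)

  small : ∀ k .{{_ : NonZero k}} → k ℕ.< p → ¬ Z p (+ k)
  small k k<p z = ℕ.>⇒∤ k<p (∣⇒∣ᵤ z)

  ¬Z-1 : ¬ Z p 1ℤ
  ¬Z-1 = small 1 (ℕ.<-trans (ℕ.s≤s (ℕ.s≤s ℕ.z≤n)) 2<p)

  ¬Z-2 : ¬ Z p (+ 2)
  ¬Z-2 = small 2 2<p

  ¬Z⇒coprime : ∀ x → ¬ Z p x → Coprime ∣ x ∣ p
  ¬Z⇒coprime x nz {d} (d∣x , d∣p) = [ (λ e → e) , (λ d≡p → contradiction (∣ᵤ⇒∣ (subst (ℕ._∣ ∣ x ∣) d≡p d∣x)) nz) ]′ (prime⇒irreducible pr d∣p)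

  inverse : ∀ x → ¬ Z p x → ∃[ y ] Z p (x * y - 1ℤ)
  inverse x nz with bézout ∣ x ∣ p (¬Z⇒coprime x nz)
  inverse (+ n) nz | u , z = u , z
  inverse -[1+ n ] nz | u , z = - u , by (lem (+ suc n) u) z
    where
    lem : ∀ m u → m * u - 1ℤ ≡ - m * - u - 1ℤ
    lem = solve-∀

  -- Inversion extended by 0 ↦ 0. The case distinction makes the value at a multiple of p literally
  -- `0ℤ`, so that one can rewrite with `J-zero`.
  J : ℤ → ℤ
  J x with Z? p x
  ... | yes _ = 0ℤ
  ... | no nz = proj₁ (inverse x nz)

  J-zero : ∀ x → Z p x → J x ≡ 0ℤ
  J-zero x z with Z? p x
  ... | yes _ = refl
  ... | no nz = contradiction z nz

  J-inv : ∀ x → ¬ Z p x → Z p (x * J x - 1ℤ)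
  J-inv x nz with Z? p x
  ... | yes z = contradiction z nz
  ... | no nz′ = proj₂ (inverse x nz′)

  ¬Z-J : ∀ x → ¬ Z p x → ¬ Z p (J x)
  ¬Z-J x nz z = ¬Z-1 (by (lem (x * J x)) ((x *ᶻ z) -ᶻ J-inv x nz))
    where
    lem : ∀ t → t - (t - 1ℤ) ≡ 1ℤ
    lem = solve-∀

  J-resp : ∀ x y → Z p (x - y) → Z p (J x - J y)
  J-resp x y z = go (Z? p x) (Z? p y)
    where
    lem : ∀ x y a b → (a * (y * b - 1ℤ)) * - 1ℤ + b * (x * a - 1ℤ) - a * b * (x - y) ≡ a - b
    lem = solve-∀
    go : Dec (Z p x) → Dec (Z p y) → Z p (J x - J y)
    go (yes zx) (yes zy) rewrite J-zero x zx | J-zero y zy = Z0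
    go (yes zx) (no ny) = contradiction (Z-resp y x (Z-sym x y z) zx) ny
    go (no nx) (yes zy) = contradiction (Z-resp x y z zy) nx
    go (no nx) (no ny) = by (lem x y (J x) (J y))
      (by (ℤ.*-comm (- 1ℤ) (J x * (y * J y - 1ℤ))) (- 1ℤ *ᶻ (J x *ᶻ J-inv y ny)) +ᶻ (J y *ᶻ J-inv x nx) -ᶻ (J x * J y *ᶻ z))

  J-inj : ∀ x y → Z p (J x - J y) → Z p (x - y)
  J-inj x y z = go (Z? p x) (Z? p y)
    where
    lem : ∀ x y a b → y * (x * a - 1ℤ) - x * (y * b - 1ℤ) - x * y * (a - b) ≡ x - y
    lem = solve-∀
    go : Dec (Z p x) → Dec (Z p y) → Z p (x - y)
    go (yes zx) (yes zy) = zx -ᶻ zy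
    go (yes zx) (no ny) = contradiction (Z-resp (J y) (J x) (Z-sym (J x) (J y) z) (subst (Z p) (sym (J-zero x zx)) Z0)) (¬Z-J y ny)
    go (no nx) (yes zy) = contradiction (Z-resp (J x) (J y) z (subst (Z p) (sym (J-zero y zy)) Z0)) (¬Z-J x nx)
    go (no nx) (no ny) = by (lem x y (J x) (J y)) ((y *ᶻ J-inv x nx) -ᶻ (x *ᶻ J-inv y ny) -ᶻ (x * y *ᶻ z))

  -- Residue includes 0.
  Res : ℤ → Set
  Res x = ∃[ t ] Z p (t * t - x)

  NonRes : ℤ → Set
  NonRes x = ∀ t → ¬ Z p (t * t - x)

  NonRes-square : ∀ h x → ¬ Z p h → NonRes x → NonRes (h * h * x)
  NonRes-square h x nh nr t z = nr (t * J h) (by (lem t h (J h) x) ((J h * J h *ᶻ z) +ᶻ ((x * (h * J h + 1ℤ)) *ᶻ J-inv h nh)))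
    where
    lem : ∀ t h j x → j * j * (t * t - h * h * x) + x * (h * j + 1ℤ) * (h * j - 1ℤ) ≡ t * j * (t * j) - x
    lem = solve-∀

  NonRes-square⁻ : ∀ h x → NonRes (h * h * x) → NonRes x
  NonRes-square⁻ h x nr t z = nr (h * t) (by (lem h t x) ((h * h) *ᶻ z))
    where
    lem : ∀ h t x → h * h * (t * t - x) ≡ h * t * (h * t) - h * h * x
    lem = solve-∀

  NonRes-resp : ∀ x y → Z p (x - y) → NonRes x → NonRes y
  NonRes-resp x y z nr t zt = nr t (by (lem t x y) (zt -ᶻ z))
    where
    lem : ∀ t x y → t * t - y - (x - y) ≡ t * t - x
    lem = solve-∀

-- Multiplication of signs, with `true` for 1 and `false` for -1.
xnor : Bool → Bool → Bool
xnor true b = b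
xnor false b = not b

module Residues (p : ℕ) (pr : Prime p) (10<p : 10 ℕ.< p) where

  2<p : 2 ℕ.< p
  2<p = ℕ.≤-trans (ℕ.s≤s (ℕ.s≤s (ℕ.s≤s ℕ.z≤n))) 10<p

  open PrimeField p pr 2<p public

  private instance
    p≢0 : NonZero p
    p≢0 = prime⇒nonZero pr

  square-resp : ∀ s t x → Z p (s - t) → Z p (s * s - x) → Z p (t * t - x)
  square-resp s t x z z′ = by (lem s t x) (z′ -ᶻ ((s + t) *ᶻ z))
    where
    lem : ∀ s t x → s * s - x - (s + t) * (s - t) ≡ t * t - x
    lem = solve-∀

  Res? : ∀ x → Dec (Res x)
  Res? x = map′ (λ { (n , _ , z) → + n , z }) (λ { (t , z) → t %ℕ p , n%ℕd<d t p , square-resp t (+ (t %ℕ p)) x (%ℕ-Z p t) z })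
    (ℕ.anyUpTo? (λ n → Z? p (+ n * + n - x)) p)

  res⊎nonRes : ∀ x → Res x ⊎ NonRes x
  res⊎nonRes x with Res? x
  ... | yes r = inj₁ r
  ... | no n = inj₂ (λ t z → n (t , z))

  nonRes⇒¬Z : ∀ x → NonRes x → ¬ Z p x
  nonRes⇒¬Z x n z = n 0ℤ (by (sym (ℤ.+-identityˡ (- x))) (negᶻ z))

  Res-* : ∀ x y → Res x → Res y → Res (x * y)
  Res-* x y (s , zs) (t , zt) = s * t , by (lem s t x y) ((t * t *ᶻ zs) +ᶻ (x *ᶻ zt))
    where
    lem : ∀ s t x y → t * t * (s * s - x) + x * (t * t - y) ≡ s * t * (s * t) - x * y
    lem = solve-∀

  Res-NonRes : ∀ x y → ¬ Z p x → Res x → NonRes y → NonRes (x * y)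
  Res-NonRes x y nx (s , zs) ny = NonRes-resp (s * s * y) (x * y) (by (lem s x y) (y *ᶻ zs))
    (NonRes-square s y (λ z → nx (by (lem′ s x) ((s *ᶻ z) -ᶻ zs))) ny)
    where
    lem : ∀ s x y → y * (s * s - x) ≡ s * s * y - x * y
    lem = solve-∀
    lem′ : ∀ s x → s * s - (s * s - x) ≡ x
    lem′ = solve-∀

  private
    half : ℕ
    half = (p ℕ.∸ 1) ℕ./ 2

    p-1 : suc (p ℕ.∸ 1) ≡ p
    p-1 = ℕ.suc-pred p

    2half<p : half ℕ.+ half ℕ.< p
    2half<p = subst (half ℕ.+ half ℕ.<_) p-1 (ℕ.s≤s (ℕ.≤-trans (ℕ.≤-reflexive (trans (cong (half ℕ.+_) (sym (ℕ.+-identityʳ half))) (ℕ.*-comm 2 half)))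
      (ℕ.≤-trans (ℕ.m≤n+m (half ℕ.* 2) ((p ℕ.∸ 1) ℕ.% 2)) (ℕ.≤-reflexive (sym (ℕ.m≡m%n+[m/n]*n (p ℕ.∸ 1) 2))))))

    p≤2half+2 : p ℕ.≤ 2 ℕ.+ half ℕ.* 2
    p≤2half+2 = subst (ℕ._≤ 2 ℕ.+ half ℕ.* 2) p-1 (ℕ.s≤s (ℕ.≤-trans (ℕ.≤-reflexive (ℕ.m≡m%n+[m/n]*n (p ℕ.∸ 1) 2))
      (ℕ.+-monoˡ-≤ (half ℕ.* 2) (ℕ.≤-pred (ℕ.m%n<n (p ℕ.∸ 1) 2)))))

    2<half : 2 ℕ.< half
    2<half with 3 ℕ.≤? half
    ... | yes h = h
    ... | no ¬h = contradiction 10<p (ℕ.≤⇒≯ (ℕ.≤-trans p≤2half+2 (ℕ.≤-trans (ℕ.+-monoʳ-≤ 2 (ℕ.*-monoˡ-≤ 2 (ℕ.≤-pred (ℕ.≰⇒> ¬h)))) (ℕ.m≤n+m 6 4))))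

    p<3half : p ℕ.< 3 ℕ.* half
    p<3half = ℕ.≤-trans (ℕ.s≤s p≤2half+2) (ℕ.≤-trans (ℕ.+-monoˡ-≤ (half ℕ.* 2) 2<half)
      (ℕ.≤-reflexive (cong (half ℕ.+_) (ℕ.*-comm half 2))))

    point : Fin half → ℤ
    point k = + suc (toℕ k)

    point≢0 : ∀ k → ¬ Z p (point k)
    point≢0 k = small (suc (toℕ k)) (ℕ.≤-<-trans (Fin.toℕ<n k) (ℕ.≤-<-trans (ℕ.m≤m+n half half) 2half<p))

    point-inj : ∀ k l → Z p (point k * point k - point l * point l) → k ≡ l
    point-inj k l z = [ (λ d → Fin.toℕ-injective (ℕ.suc-injective (<⇒Z⇒≡ (bound k) (bound l) d)))
                      , (λ s → contradiction (by (sym (ℤ.pos-+ (suc (toℕ k)) (suc (toℕ l)))) s)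
                          (small (suc (toℕ k) ℕ.+ suc (toℕ l)) (ℕ.≤-<-trans (ℕ.+-mono-≤ (Fin.toℕ<n k) (Fin.toℕ<n l)) 2half<p))) ]′
                      (Z-prime (point k - point l) (point k + point l) (by (lem (point k) (point l)) z))
      where
      lem : ∀ k l → k * k - l * l ≡ (k - l) * (k + l)
      lem = solve-∀
      bound : ∀ k → suc (toℕ k) ℕ.< p
      bound k = ℕ.≤-<-trans (Fin.toℕ<n k) (ℕ.≤-<-trans (ℕ.m≤m+n half half) 2half<p)

    -- If a, b and ab were all nonresidues, the classes of k², ak² and abk²
    -- for 1 ≤ k ≤ (p - 1)/2 would be 3(p - 1)/2 distinct elements.
    module _ (a b : ℤ) (na : NonRes a) (nb : NonRes b) (nab : NonRes (a * b)) where

      coef : Fin 3 → ℤ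
      coef zero = 1ℤ
      coef (suc zero) = a
      coef (suc (suc zero)) = a * b

      coef≢0 : ∀ c → ¬ Z p (coef c)
      coef≢0 zero = ¬Z-1
      coef≢0 (suc zero) = nonRes⇒¬Z a na
      coef≢0 (suc (suc zero)) = nonRes⇒¬Z (a * b) nab

      elem : Fin 3 × Fin half → ℤ
      elem (c , k) = coef c * (point k * point k)

      apart : ∀ u k l → NonRes u → ¬ Z p (point k * point k - u * (point l * point l))
      apart u k l nu z = NonRes-square (point l) u (point≢0 l) nu (point k) (by (lem (point k) (point l) u) z)
        where
        lem : ∀ k l u → k * k - u * (l * l) ≡ k * k - l * l * u
        lem = solve-∀

      apart′ : ∀ k l → ¬ Z p (a * (point k * point k) - a * b * (point l * point l))
      apart′ k l z = apart b k l nb (cancel a _ (nonRes⇒¬Z a na) (by (lem a b (point k * point k) (point l * point l)) z))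
        where
        lem : ∀ a b x y → a * x - a * b * y ≡ a * (x - b * y)
        lem = solve-∀

      distinct : ∀ x y → Z p (elem x - elem y) → x ≡ y
      distinct (c , k) (d , l) z with c Fin.≟ d
      ... | yes refl = cong (c ,_) (point-inj k l (cancel (coef c) _ (coef≢0 c) (by (lem (coef c) (point k * point k) (point l * point l)) z)))
        where
        lem : ∀ c x y → c * x - c * y ≡ c * (x - y)
        lem = solve-∀
      distinct (zero , k) (zero , l) z | no n = contradiction refl n
      distinct (zero , k) (suc zero , l) z | no n = ⊥-elim (apart a k l na (by (cong (_- a * (point l * point l)) (ℤ.*-identityˡ (point k * point k))) z))
      distinct (zero , k) (suc (suc zero) , l) z | no n = ⊥-elim (apart (a * b) k l nab (by (cong (_- a * b * (point l * point l)) (ℤ.*-identityˡ (point k * point k))) z))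
      distinct (suc zero , k) (zero , l) z | no n = ⊥-elim (apart a l k na (by (cong (_- a * (point k * point k)) (ℤ.*-identityˡ (point l * point l))) (Z-sym (elem (suc zero , k)) (elem (zero , l)) z)))
      distinct (suc zero , k) (suc zero , l) z | no n = contradiction refl n
      distinct (suc zero , k) (suc (suc zero) , l) z | no n = ⊥-elim (apart′ k l z)
      distinct (suc (suc zero) , k) (zero , l) z | no n = ⊥-elim (apart (a * b) l k nab (by (cong (_- a * b * (point k * point k)) (ℤ.*-identityˡ (point l * point l))) (Z-sym (elem (suc (suc zero) , k)) (elem (zero , l)) z)))
      distinct (suc (suc zero) , k) (suc zero , l) z | no n = ⊥-elim (apart′ l k (Z-sym (elem (suc (suc zero) , k)) (elem (suc zero , l)) z))
      distinct (suc (suc zero) , k) (suc (suc zero) , l) z | no n = contradiction refl n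

      too-many : ⊥
      too-many with Fin.pigeonhole p<3half (λ i → [ elem (remQuot {3} half i) ])
      ... | i , j , i<j , eq = Fin.<-irrefl (trans (sym (Fin.combine-remQuot {3} half i)) (trans (cong (λ x → Fin.combine (proj₁ x) (proj₂ x))
            (distinct (remQuot {3} half i) (remQuot {3} half j)
              (Z-trans (elem (remQuot {3} half i)) ⟦ [ elem (remQuot {3} half i) ] ⟧ (elem (remQuot {3} half j)) (⟦[]⟧ (elem (remQuot {3} half i)))
                (subst (λ u → Z p (⟦ u ⟧ - elem (remQuot {3} half j))) (sym eq) (Z-sym (elem (remQuot {3} half j)) ⟦ [ elem (remQuot {3} half j) ] ⟧ (⟦[]⟧ (elem (remQuot {3} half j))))))))
          (Fin.combine-remQuot {3} half j))) i<j

  -- Obtained by counting classes, without Euler's criterion or a primitive root.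
  NonRes-* : ∀ a b → NonRes a → NonRes b → Res (a * b)
  NonRes-* a b na nb with res⊎nonRes (a * b)
  ... | inj₁ r = r
  ... | inj₂ n = ⊥-elim (too-many a b na nb n)

  -- The quadratic character. Multiples of p get no sign, so that a known sign always entails
  -- invertibility.
  Sg : Bool → ℤ → Set
  Sg true x = ¬ Z p x × Res x
  Sg false x = NonRes x

  Sg-1 : Sg true 1ℤ
  Sg-1 = ¬Z-1 , 1ℤ , Z0

  Sg-* : ∀ a b x y → Sg a x → Sg b y → Sg (xnor a b) (x * y)
  Sg-* true true x y (nx , rx) (ny , ry) = ¬Z-* nx ny , Res-* x y rx ry
  Sg-* true false x y (nx , rx) ny = Res-NonRes x y nx rx ny
  Sg-* false true x y nx (ny , ry) = NonRes-resp (y * x) (x * y) (≡⇒Z (ℤ.*-comm y x)) (Res-NonRes y x ny ry nx)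
  Sg-* false false x y nx ny = ¬Z-* (nonRes⇒¬Z x nx) (nonRes⇒¬Z y ny) , NonRes-* x y nx ny

-- Configurations of exceptional points

-- Coefficients by increasing degree. Nothing is normalised, so differences may end in zeros and are
-- compared with zero by `isZero`.
Poly : Set
Poly = List ℤ

infixl 6 _⊕_ _⊖_
infixl 7 _⊗_ _·_

_⊕_ : Poly → Poly → Poly
[] ⊕ g = g
(a ∷ f) ⊕ [] = a ∷ f
(a ∷ f) ⊕ (b ∷ g) = (a + b) ∷ (f ⊕ g)

_·_ : ℤ → Poly → Poly
k · f = map (k *_) f

_⊖_ : Poly → Poly → Poly
f ⊖ g = f ⊕ (- 1ℤ) · g

_⊗_ : Poly → Poly → Poly
[] ⊗ g = []
(a ∷ f) ⊗ g = a · g ⊕ (0ℤ ∷ f ⊗ g)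

isZero : Poly → Bool
isZero = all (λ { (+ 0) → true ; _ → false })

ev : ℤ → Poly → ℤ
ev e [] = 0ℤ
ev e (c ∷ f) = c + e * ev e f

module _ (e : ℤ) where

  ev-⊕ : ∀ f g → ev e (f ⊕ g) ≡ ev e f + ev e g
  ev-⊕ [] g = sym (ℤ.+-identityˡ _)
  ev-⊕ (a ∷ f) [] = sym (ℤ.+-identityʳ _)
  ev-⊕ (a ∷ f) (b ∷ g) = trans (cong (λ t → a + b + e * t) (ev-⊕ f g)) (lem a b e (ev e f) (ev e g))
    where
    lem : ∀ a b e x y → a + b + e * (x + y) ≡ a + e * x + (b + e * y)
    lem = solve-∀

  ev-· : ∀ k f → ev e (k · f) ≡ k * ev e f
  ev-· k [] = sym (ℤ.*-zeroʳ k)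
  ev-· k (a ∷ f) = trans (cong (λ t → k * a + e * t) (ev-· k f)) (lem k a e (ev e f))
    where
    lem : ∀ k a e x → k * a + e * (k * x) ≡ k * (a + e * x)
    lem = solve-∀

  ev-⊖ : ∀ f g → ev e (f ⊖ g) ≡ ev e f - ev e g
  ev-⊖ f g = trans (ev-⊕ f (- 1ℤ · g)) (trans (cong (λ t → ev e f + t) (ev-· (- 1ℤ) g)) (lem (ev e f) (ev e g)))
    where
    lem : ∀ x y → x + - 1ℤ * y ≡ x - y
    lem = solve-∀

  ev-⊗ : ∀ f g → ev e (f ⊗ g) ≡ ev e f * ev e g
  ev-⊗ [] g = sym (ℤ.*-zeroˡ (ev e g))
  ev-⊗ (a ∷ f) g = trans (ev-⊕ (a · g) (0ℤ ∷ f ⊗ g)) (trans (cong₂ (λ s t → s + (0ℤ + e * t)) (ev-· a g) (ev-⊗ f g)) (lem a e (ev e f) (ev e g)))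
    where
    lem : ∀ a e x y → a * y + (0ℤ + e * (x * y)) ≡ (a + e * x) * y
    lem = solve-∀

  ev-isZero : ∀ f → T (isZero f) → ev e f ≡ 0ℤ
  ev-isZero [] _ = refl
  ev-isZero (+ 0 ∷ f) z = trans (cong (λ t → 0ℤ + e * t) (ev-isZero f z)) (lem e)
    where
    lem : ∀ e → 0ℤ + e * 0ℤ ≡ 0ℤ
    lem = solve-∀

  ev-isZero-⊖ : ∀ f g → T (isZero (f ⊖ g)) → ev e f ≡ ev e g
  ev-isZero-⊖ f g z = ℤ.i-j≡0⇒i≡j (ev e f) (ev e g) (trans (sym (ev-⊖ f g)) (ev-isZero (f ⊖ g) z))

-- nz f: f(e) ≠ 0 modulo p; nr f: f(e) is a nonresidue modulo p.
data Req : Set where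
  nz nr : Poly → Req

when : Bool → List Req → List Req
when b rs = if b then rs else []

-- The requirement nz [] cannot be met.
guard : Bool → List Req
guard b = if b then [] else nz [] ∷ []

-- Coordinates in ℤ/p are polynomials in the parameter e.
record Entry : Set where
  constructor _at_↦_at_
  field
    si : ℕ
    sp : Poly
    ti : ℕ
    tp : Poly

open Entry

-- The map on ℤ/q × ℤ/p is (i , x) ↦ (σ i , S i / x) with 1 / 0 = 0, precomposed
-- with the permutation given by the exceptional points.
record Config : Set where
  field
    σ : ℕ → ℕ
    S : ℕ → Poly
    exc : List Entry

module Requirements (q : ℕ) .{{_ : NonZero q}} (C : Config) where

  open Config C public

  ap : ℕ → ℕ → ℕ → Bool
  ap i j k = (i ℕ.+ k) ℕ.% q ≡ᵇ (2 ℕ.* j) ℕ.% q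

  same : Entry → Entry → Bool
  same s t = (si s ≡ᵇ si t) ∧ isZero (sp s ⊖ sp t)

  -- The value at an exceptional point as a fraction. A target with coordinate 0 has the value 0,
  -- written 0 / 1.
  num den : Entry → Poly
  num s = if isZero (tp s) then [] else S (ti s)
  den s = if isZero (tp s) then 1ℤ ∷ [] else tp s

  -- The numerator of n₁ / d₁ - 2 n₂ / d₂ + n₃ / d₃.
  harm : (n₁ d₁ n₂ d₂ n₃ d₃ : Poly) → Poly
  harm n₁ d₁ n₂ d₂ n₃ d₃ = n₁ ⊗ d₂ ⊗ d₃ ⊕ n₃ ⊗ d₁ ⊗ d₂ ⊖ + 2 · (n₂ ⊗ d₁ ⊗ d₃)

  -- With one exceptional term s, a preserved progression makes the third term c
  -- a root of a polynomial of degree at most 2. A rational root is harmless if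
  -- one of the two generic terms is then exceptional as well: c itself, of class
  -- k, or the other one, of class j, where c = w t if that term is t.
  root : ℕ → ℕ → (Poly → Poly) → Poly → Poly → Bool
  root k j w L₁ L₀ = any (λ t → ((si t ≡ᵇ k) ∧ isZero (L₁ ⊗ sp t ⊕ L₀)) ∨ ((si t ≡ᵇ j) ∧ isZero (L₁ ⊗ w (sp t) ⊕ L₀))) exc

  lin : ℕ → ℕ → (Poly → Poly) → Poly → Poly → List Req
  lin k j w L₁ L₀ = nz L₁ ∷ guard (root k j w L₁ L₀)

  -- A generic c is nonzero, so if A₀ is the zero polynomial one may divide by c; if A₂ is zero, the
  -- equation is linear from the start. Otherwise the discriminant has to be a nonresidue, and this
  -- also excludes that A₂ vanishes at e, as the discriminant would then be the square of A₁.
  quad : ℕ → ℕ → (Poly → Poly) → Poly → Poly → Poly → List Req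
  quad k j w A₂ A₁ A₀ =
    if isZero A₀ then (if isZero A₁ then nz A₂ ∷ [] else lin k j w A₂ A₁)
    else (if isZero A₂ then (if isZero A₁ then nz A₀ ∷ [] else lin k j w A₁ A₀)
    else nr (A₁ ⊗ A₁ ⊖ + 4 · (A₂ ⊗ A₀)) ∷ [])

  -- With (k , 0) exceptional in each class k, generic points have invertible coordinates.
  rZero : ℕ → List Req
  rZero k = guard (any (λ s → (si s ≡ᵇ k) ∧ isZero (sp s)) exc)

  rσ : ℕ → ℕ → List Req
  rσ i j = guard ((σ i <ᵇ q) ∧ (not (σ i ≡ᵇ σ j) ∨ (i ≡ᵇ j)))

  -- Every target is itself an exceptional point. Together with `rInj` this makes the entries
  -- permute the exceptional points, so that no generic point collides with a target.
  rImage : Entry → List Req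
  rImage s = guard (any (λ t → (si t ≡ᵇ ti s) ∧ isZero (sp t ⊖ tp s)) exc)
    ++ guard (ti s <ᵇ q) ++ when (not (isZero (tp s))) (nz (tp s) ∷ [])

  rInj : Entry → Entry → List Req
  rInj s t = when ((ti s ≡ᵇ ti t) ∧ not (same s t)) (nz (tp s ⊖ tp t) ∷ [])

  -- Eliminating b from S i / a + S k / c = 2 S j / b gives the binary form S i c² + (S i + S k - 4
  -- S j) a c + S k a², whose discriminant this is. For i = j = k the form is S i (a - c)², which
  -- does no harm.
  rNone : ℕ → ℕ → ℕ → List Req
  rNone i j k = when (ap i j k ∧ (ap (σ i) (σ j) (σ k) ∧ not ((i ≡ᵇ j) ∧ (j ≡ᵇ k))))
    (nr ((S i ⊕ S k ⊖ + 4 · S j) ⊗ (S i ⊕ S k ⊖ + 4 · S j) ⊖ + 4 · (S i ⊗ S k)) ∷ [])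

  -- The middle term b = (a + c) / 2 is eliminated, which leaves a quadratic in c. An exceptional
  -- last term is the same case read backwards.
  rEnd : Entry → ℕ → ℕ → List Req
  rEnd s j k = when (ap (si s) j k ∧ ap (σ (ti s)) (σ j) (σ k))
    (quad k j (λ x → + 2 · x ⊖ sp s) (num s) (num s ⊗ sp s ⊕ S k ⊗ den s ⊖ + 4 · (S j ⊗ den s)) (S k ⊗ den s ⊗ sp s))

  -- Here a = 2 b - c is eliminated.
  rMid : Entry → ℕ → ℕ → List Req
  rMid s i k = when (ap i (si s) k ∧ ap (σ i) (σ (ti s)) (σ k))
    (quad k i (λ x → + 2 · sp s ⊖ x) (+ 2 · num s) (S i ⊗ den s ⊖ S k ⊗ den s ⊖ + 4 · (num s ⊗ sp s)) (+ 2 · (S k ⊗ den s ⊗ sp s)))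

  rEndMid : Entry → Entry → ℕ → List Req
  rEndMid s t k = when (ap (si s) (si t) k ∧ (ap (σ (ti s)) (σ (ti t)) (σ k) ∧ not (same s t)))
    (nz (harm (num s) (den s) (num t) (den t) (S k) (+ 2 · sp t ⊖ sp s)) ∷ [])

  -- Equal ends are harmless only if the middle lies in their class: for q = 2 the middle may have
  -- the same coordinate in the other class. The middle value is written 2 S j / (a + c) to avoid
  -- halving.
  rEnds : Entry → Entry → ℕ → List Req
  rEnds s u j = when (ap (si s) j (si u) ∧ (ap (σ (ti s)) (σ j) (σ (ti u)) ∧ not (same s u ∧ (si s ≡ᵇ j))))
    (nz (harm (num s) (den s) (+ 2 · S j) (sp s ⊕ sp u) (num u) (den u)) ∷ [])

  -- Three exceptional points that form a progression for every e must have images that do not; for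
  -- all others e is kept off the values at which they would form one.
  rAll : Entry → Entry → Entry → List Req
  rAll s t u = when (ap (si s) (si t) (si u) ∧ (ap (σ (ti s)) (σ (ti t)) (σ (ti u)) ∧ not (same s t)))
    (if isZero (sp s ⊕ sp u ⊖ + 2 · sp t) then nz (harm (num s) (den s) (num t) (den t) (num u) (den u)) ∷ []
     else nz (sp s ⊕ sp u ⊖ + 2 · sp t) ∷ [])

  private
    for : {A : Set} → List A → (A → List Req) → List Req
    for xs f = concatMap f xs

  reqs : List Req
  reqs = for (upTo q) (λ i → nz (S i) ∷ rZero i ++ for (upTo q) (λ j → rσ i j ++ for (upTo q) (λ k → rNone i j k)))
    ++ for exc (λ s → rImage s
      ++ for exc (λ t → rInj s t ++ for (upTo q) (λ k → rEndMid s t k ++ rEnds s t k) ++ for exc (λ u → rAll s t u))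
      ++ for (upTo q) (λ j → for (upTo q) (λ k → rEnd s j k ++ rMid s j k)))

-- Configurations that meet their requirements destroy all progressions

HoldsAt : (p : ℕ) (pr : Prime p) → 2 ℕ.< p → ℤ → Req → Set
HoldsAt p pr 2<p e (nz f) = ¬ Z p (ev e f)
HoldsAt p pr 2<p e (nr f) = PrimeField.NonRes p pr 2<p (ev e f)

module Soundness
  (p : ℕ) (pr : Prime p) (2<p : 2 ℕ.< p)
  (q : ℕ) .{{_ : NonZero q}} (cqp : Coprime q p) (cpq : Coprime p q)
  (C : Config) (e : ℤ)
  where

  open PrimeField p pr 2<p
  open Requirements q C

  Holds : Req → Set
  Holds = HoldsAt p pr 2<p e

  private
    variable
      X : Set
      L : List Req

  guard⁻ : ∀ b → All Holds (guard b) → T b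
  guard⁻ true _ = tt
  guard⁻ false (h ∷ []) = ⊥-elim (h Z0)

  when⁻ : ∀ b → T b → All Holds (when b L) → All Holds L
  when⁻ true _ h = h

  T-∧⁺ : ∀ {x y} → T x → T y → T (x ∧ y)
  T-∧⁺ {true} {true} _ _ = tt

  T-∧⁻ : ∀ {x y} → T (x ∧ y) → T x × T y
  T-∧⁻ {true} {true} _ = tt , tt

  when-not : ∀ x y z → T x → T y → All Holds (when (x ∧ (y ∧ not z)) L) → T z ⊎ All Holds L
  when-not true true true _ _ _ = inj₁ tt
  when-not true true false _ _ h = inj₂ h

  any⁻ : ∀ (f : X → Bool) xs → T (any f xs) → ∃[ x ] x ∈ xs × T (f x)
  any⁻ f xs t = find (Any.any⁻ f xs t)

  concatMap⁻ : ∀ (f : X → List Req) {xs x} → All Holds (concatMap f xs) → x ∈ xs → All Holds (f x)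
  concatMap⁻ f {x ∷ xs} h (here refl) = All.++⁻ˡ (f x) h
  concatMap⁻ f {x ∷ xs} h (there m) = concatMap⁻ f (All.++⁻ʳ (f x) h) m

  ev-harm : ∀ n₁ d₁ n₂ d₂ n₃ d₃ → ev e (harm n₁ d₁ n₂ d₂ n₃ d₃) ≡
    ev e n₁ * ev e d₂ * ev e d₃ + ev e n₃ * ev e d₁ * ev e d₂ - + 2 * (ev e n₂ * ev e d₁ * ev e d₃)
  ev-harm n₁ d₁ n₂ d₂ n₃ d₃ = trans (ev-⊖ e (n₁ ⊗ d₂ ⊗ d₃ ⊕ n₃ ⊗ d₁ ⊗ d₂) (+ 2 · (n₂ ⊗ d₁ ⊗ d₃)))
    (cong₂ _-_ (trans (ev-⊕ e (n₁ ⊗ d₂ ⊗ d₃) (n₃ ⊗ d₁ ⊗ d₂)) (cong₂ _+_ (triple n₁ d₂ d₃) (triple n₃ d₁ d₂)))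
      (trans (ev-· e (+ 2) (n₂ ⊗ d₁ ⊗ d₃)) (cong (+ 2 *_) (triple n₂ d₁ d₃))))
    where
    triple : ∀ f g h → ev e (f ⊗ g ⊗ h) ≡ ev e f * ev e g * ev e h
    triple f g h = trans (ev-⊗ e (f ⊗ g) h) (cong (_* ev e h) (ev-⊗ e f g))

  -- Multiply the relation between the values by d₁ d₂ d₃ and replace each product of a denominator
  -- and its value by the numerator.
  harmonic : ∀ d₁ d₂ d₃ n₁ n₂ n₃ v₁ v₂ v₃ → Z p (d₁ * v₁ - n₁) → Z p (d₂ * v₂ - n₂) → Z p (d₃ * v₃ - n₃) →
    Z p (v₁ + v₃ - + 2 * v₂) → Z p (n₁ * d₂ * d₃ + n₃ * d₁ * d₂ - + 2 * (n₂ * d₁ * d₃))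
  harmonic d₁ d₂ d₃ n₁ n₂ n₃ v₁ v₂ v₃ z₁ z₂ z₃ z = by (lem d₁ d₂ d₃ n₁ n₂ n₃ v₁ v₂ v₃)
    ((d₁ * d₂ * d₃ *ᶻ z) -ᶻ (d₂ * d₃ *ᶻ z₁) -ᶻ (d₁ * d₂ *ᶻ z₃) +ᶻ (+ 2 * (d₁ * d₃) *ᶻ z₂))
    where
    lem : ∀ d₁ d₂ d₃ n₁ n₂ n₃ v₁ v₂ v₃ →
      d₁ * d₂ * d₃ * (v₁ + v₃ - + 2 * v₂) - d₂ * d₃ * (d₁ * v₁ - n₁) - d₁ * d₂ * (d₃ * v₃ - n₃) + + 2 * (d₁ * d₃) * (d₂ * v₂ - n₂)
      ≡ n₁ * d₂ * d₃ + n₃ * d₁ * d₂ - + 2 * (n₂ * d₁ * d₃)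
    lem = solve-∀

  value-resp : ∀ c d v n → Z p (d - c) → Z p (c * v - n) → Z p (d * v - n)
  value-resp c d v n z zv = by (lem c d v n) (zv +ᶻ (v *ᶻ z))
    where
    lem : ∀ c d v n → c * v - n + v * (d - c) ≡ d * v - n
    lem = solve-∀

  -- A value v enters only through a congruence of the form denominator times v ≡ numerator, for
  -- both kinds of points; no inverse occurs in the case analysis below.
  data View : (i : ℕ) (x : ℤ) (τ : ℕ) (v : ℤ) → Set where
    special : ∀ {x v} s → s ∈ exc → Z p (ev e (sp s) - x) → Z p (ev e (den s) * v - ev e (num s)) → View (si s) x (σ (ti s)) v
    generic : ∀ {x v} i → i ℕ.< q → (∀ {s} → s ∈ exc → si s ≡ i → ¬ Z p (ev e (sp s) - x)) → ¬ Z p x →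
      Z p (x * v - ev e (S i)) → View i x (σ i) v

  lin⁻ : ∀ k j w L₁ L₀ c → All Holds (lin k j w L₁ L₀) →
    (∀ {t} → t ∈ exc → si t ≡ k → ¬ Z p (ev e (sp t) - c)) →
    (∀ {t} → t ∈ exc → si t ≡ j → ¬ Z p (ev e (w (sp t)) - c)) →
    ¬ Z p (ev e L₁ * c + ev e L₀)
  lin⁻ k j w L₁ L₀ c (h₁ ∷ h) noK noJ z with any⁻ _ exc (guard⁻ (root k j w L₁ L₀) h)
  ... | t , t∈ , T-root = [ (λ r → noK t∈ (ℕ.≡ᵇ⇒≡ _ _ (proj₁ (T-∧⁻ r))) (solution (sp t) (proj₂ (T-∧⁻ {si t ≡ᵇ k} r))))
                          , (λ r → noJ t∈ (ℕ.≡ᵇ⇒≡ _ _ (proj₁ (T-∧⁻ r))) (solution (w (sp t)) (proj₂ (T-∧⁻ {si t ≡ᵇ j} r)))) ]′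
                          (Equivalence.to T-∨ T-root)
    where
    lem : ∀ l m x c → (l * x + m) - (l * c + m) ≡ l * (x - c)
    lem = solve-∀
    solution : ∀ f → T (isZero (L₁ ⊗ f ⊕ L₀)) → Z p (ev e f - c)
    solution f r = cancel (ev e L₁) (ev e f - c) h₁ (by (lem (ev e L₁) (ev e L₀) (ev e f) c)
      (by (trans (sym (ev-isZero e (L₁ ⊗ f ⊕ L₀) r)) (trans (ev-⊕ e (L₁ ⊗ f) L₀) (cong (_+ ev e L₀) (ev-⊗ e L₁ f)))) Z0 -ᶻ z))

  quad⁻ : ∀ k j w A₂ A₁ A₀ c → All Holds (quad k j w A₂ A₁ A₀) → ¬ Z p c →
    (∀ {t} → t ∈ exc → si t ≡ k → ¬ Z p (ev e (sp t) - c)) →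
    (∀ {t} → t ∈ exc → si t ≡ j → ¬ Z p (ev e (w (sp t)) - c)) →
    ¬ Z p (ev e A₂ * c * c + ev e A₁ * c + ev e A₀)
  quad⁻ k j w A₂ A₁ A₀ c h c≢0 noK noJ z with isZero A₀ in eq₀ | isZero A₁ in eq₁ | isZero A₂ in eq₂
  ... | true | true | _ = [ (λ z′ → [ (λ a → All.head h a) , c≢0 ]′ (Z-prime (ev e A₂) c z′)) , c≢0 ]′ (Z-prime (ev e A₂ * c) c
        (by (trans (cong₂ (λ s t → ev e A₂ * c * c + s * c + t) (ev-isZero e A₁ (subst T (sym eq₁) tt)) (ev-isZero e A₀ (subst T (sym eq₀) tt))) (lem (ev e A₂) c)) z))
    where
    lem : ∀ a c → a * c * c + 0ℤ * c + 0ℤ ≡ a * c * c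
    lem = solve-∀
  ... | true | false | _ = lin⁻ k j w A₂ A₁ c h noK noJ (cancel c (ev e A₂ * c + ev e A₁) c≢0
        (by (trans (cong (λ t → ev e A₂ * c * c + ev e A₁ * c + t) (ev-isZero e A₀ (subst T (sym eq₀) tt))) (lem (ev e A₂) (ev e A₁) c)) z))
    where
    lem : ∀ a b c → a * c * c + b * c + 0ℤ ≡ c * (a * c + b)
    lem = solve-∀
  ... | false | true | true = All.head h (by (trans (cong₂ (λ s t → s * c * c + t * c + ev e A₀) (ev-isZero e A₂ (subst T (sym eq₂) tt)) (ev-isZero e A₁ (subst T (sym eq₁) tt))) (lem (ev e A₀) c)) z)
    where
    lem : ∀ a c → 0ℤ * c * c + 0ℤ * c + a ≡ a
    lem = solve-∀
  ... | false | false | true = lin⁻ k j w A₁ A₀ c h noK noJ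
        (by (trans (cong (λ t → t * c * c + ev e A₁ * c + ev e A₀) (ev-isZero e A₂ (subst T (sym eq₂) tt))) (lem (ev e A₁) (ev e A₀) c)) z)
    where
    lem : ∀ a b c → 0ℤ * c * c + a * c + b ≡ a * c + b
    lem = solve-∀
  -- Completing the square: 4 A₂ times the quadratic is (2 A₂ c + A₁)² minus the discriminant.
  ... | false | _ | false = All.head h (+ 2 * ev e A₂ * c + ev e A₁)
        (by (trans (lem (ev e A₂) (ev e A₁) (ev e A₀) c) (cong (λ t → square - t) (sym disc))) (+ 4 * ev e A₂ *ᶻ z))
    where
    square : ℤ
    square = (+ 2 * ev e A₂ * c + ev e A₁) * (+ 2 * ev e A₂ * c + ev e A₁)
    lem : ∀ a b d c → + 4 * a * (a * c * c + b * c + d) ≡ (+ 2 * a * c + b) * (+ 2 * a * c + b) - (b * b - + 4 * (a * d))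
    lem = solve-∀
    disc : ev e (A₁ ⊗ A₁ ⊖ + 4 · (A₂ ⊗ A₀)) ≡ ev e A₁ * ev e A₁ - + 4 * (ev e A₂ * ev e A₀)
    disc = trans (ev-⊖ e (A₁ ⊗ A₁) (+ 4 · (A₂ ⊗ A₀))) (cong₂ _-_ (ev-⊗ e A₁ A₁) (trans (ev-· e (+ 4) (A₂ ⊗ A₀)) (cong (+ 4 *_) (ev-⊗ e A₂ A₀))))

  module _ (hyp : All Holds reqs) where

    private
      hypIndex : All Holds (concatMap (λ i → nz (S i) ∷ rZero i ++ concatMap (λ j → rσ i j ++ concatMap (λ k → rNone i j k) (upTo q)) (upTo q)) (upTo q))
      hypIndex = All.++⁻ˡ (concatMap (λ i → nz (S i) ∷ rZero i ++ concatMap (λ j → rσ i j ++ concatMap (λ k → rNone i j k) (upTo q)) (upTo q)) (upTo q)) hyp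

      hyp₁ : ∀ {i} → i ℕ.< q → All Holds (nz (S i) ∷ rZero i ++ concatMap (λ j → rσ i j ++ concatMap (λ k → rNone i j k) (upTo q)) (upTo q))
      hyp₁ i<q = concatMap⁻ _ hypIndex (∈-upTo⁺ i<q)

      hyp₂ : ∀ {i j} → i ℕ.< q → j ℕ.< q → All Holds (rσ i j ++ concatMap (λ k → rNone i j k) (upTo q))
      hyp₂ {i} i<q j<q = concatMap⁻ (λ j → rσ i j ++ concatMap (λ k → rNone i j k) (upTo q)) (All.++⁻ʳ (rZero i) (All.tail (hyp₁ i<q))) (∈-upTo⁺ j<q)

      block : Entry → List Req
      block s = rImage s ++ concatMap (λ t → rInj s t ++ concatMap (λ k → rEndMid s t k ++ rEnds s t k) (upTo q) ++ concatMap (λ u → rAll s t u) exc) exc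
        ++ concatMap (λ j → concatMap (λ k → rEnd s j k ++ rMid s j k) (upTo q)) (upTo q)

      hyp₃ : ∀ {s} → s ∈ exc → All Holds (block s)
      hyp₃ s∈ = concatMap⁻ block (All.++⁻ʳ (concatMap (λ i → nz (S i) ∷ rZero i ++ concatMap (λ j → rσ i j ++ concatMap (λ k → rNone i j k) (upTo q)) (upTo q)) (upTo q)) hyp) s∈

      hyp₄ : ∀ {s t} → s ∈ exc → t ∈ exc → All Holds (rInj s t ++ concatMap (λ k → rEndMid s t k ++ rEnds s t k) (upTo q) ++ concatMap (λ u → rAll s t u) exc)
      hyp₄ {s} s∈ t∈ = concatMap⁻ (λ t → rInj s t ++ concatMap (λ k → rEndMid s t k ++ rEnds s t k) (upTo q) ++ concatMap (λ u → rAll s t u) exc)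
        (All.++⁻ˡ _ (All.++⁻ʳ (rImage s) (hyp₃ s∈))) t∈

      hyp₅ : ∀ {s t k} → s ∈ exc → t ∈ exc → k ℕ.< q → All Holds (rEndMid s t k ++ rEnds s t k)
      hyp₅ {s} {t} s∈ t∈ k<q = concatMap⁻ (λ k → rEndMid s t k ++ rEnds s t k) (All.++⁻ˡ _ (All.++⁻ʳ (rInj s t) (hyp₄ s∈ t∈))) (∈-upTo⁺ k<q)

      hyp₆ : ∀ {s j k} → s ∈ exc → j ℕ.< q → k ℕ.< q → All Holds (rEnd s j k ++ rMid s j k)
      hyp₆ {s} {j} s∈ j<q k<q = concatMap⁻ (λ k → rEnd s j k ++ rMid s j k)
        (concatMap⁻ (λ j → concatMap (λ k → rEnd s j k ++ rMid s j k) (upTo q))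
          (All.++⁻ʳ (concatMap (λ t → rInj s t ++ concatMap (λ k → rEndMid s t k ++ rEnds s t k) (upTo q) ++ concatMap (λ u → rAll s t u) exc) exc) (All.++⁻ʳ (rImage s) (hyp₃ s∈))) (∈-upTo⁺ j<q)) (∈-upTo⁺ k<q)

    hNone : ∀ {i j k} → i ℕ.< q → j ℕ.< q → k ℕ.< q → All Holds (rNone i j k)
    hNone {i} {j} i<q j<q k<q = concatMap⁻ (λ k → rNone i j k) (All.++⁻ʳ (rσ i j) (hyp₂ i<q j<q)) (∈-upTo⁺ k<q)

    hS : ∀ {i} → i ℕ.< q → ¬ Z p (ev e (S i))
    hS i<q = All.head (hyp₁ i<q)

    hZero : ∀ {k} → k ℕ.< q → ∃[ s ] s ∈ exc × si s ≡ k × ev e (sp s) ≡ 0ℤ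
    hZero {k} k<q with any⁻ _ exc (guard⁻ _ (All.++⁻ˡ (rZero k) (All.tail (hyp₁ k<q))))
    ... | s , s∈ , r = s , s∈ , ℕ.≡ᵇ⇒≡ _ _ (proj₁ (T-∧⁻ {si s ≡ᵇ k} r)) , ev-isZero e (sp s) (proj₂ (T-∧⁻ {si s ≡ᵇ k} r))

    hσ : ∀ {i j} → i ℕ.< q → j ℕ.< q → T ((σ i <ᵇ q) ∧ (not (σ i ≡ᵇ σ j) ∨ (i ≡ᵇ j)))
    hσ {i} {j} i<q j<q = guard⁻ _ (All.++⁻ˡ (rσ i j) (hyp₂ i<q j<q))

    σ<q : ∀ {i} → i ℕ.< q → σ i ℕ.< q
    σ<q {i} i<q = ℕ.<ᵇ⇒< _ _ (proj₁ (T-∧⁻ {σ i <ᵇ q} (hσ i<q i<q)))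

    σ-inj : ∀ {i j} → i ℕ.< q → j ℕ.< q → σ i ≡ σ j → i ≡ j
    σ-inj {i} {j} i<q j<q eq = ℕ.≡ᵇ⇒≡ i j (resolve (ℕ.≡⇒≡ᵇ _ _ eq) (proj₂ (T-∧⁻ {σ i <ᵇ q} (hσ i<q j<q))))
      where
      resolve : ∀ {x y} → T x → T (not x ∨ y) → T y
      resolve {true} _ y = y

    hImage : ∀ {s} → s ∈ exc → ∃[ t ] t ∈ exc × si t ≡ ti s × ev e (sp t) ≡ ev e (tp s)
    hImage {s} s∈ with any⁻ _ exc (guard⁻ _ (All.++⁻ˡ (guard _) (All.++⁻ˡ (rImage s) (hyp₃ s∈))))
    ... | t , t∈ , r = t , t∈ , ℕ.≡ᵇ⇒≡ _ _ (proj₁ (T-∧⁻ {si t ≡ᵇ ti s} r)) , ev-isZero-⊖ e (sp t) (tp s) (proj₂ (T-∧⁻ {si t ≡ᵇ ti s} r))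

    ti<q : ∀ {s} → s ∈ exc → ti s ℕ.< q
    ti<q {s} s∈ = ℕ.<ᵇ⇒< _ _ (guard⁻ _ (All.++⁻ˡ (guard (ti s <ᵇ q))
      (All.++⁻ʳ (guard (any (λ t → (si t ≡ᵇ ti s) ∧ isZero (sp t ⊖ tp s)) exc)) (All.++⁻ˡ (rImage s) (hyp₃ s∈)))))

    htp : ∀ {s} → s ∈ exc → All Holds (when (not (isZero (tp s))) (nz (tp s) ∷ []))
    htp {s} s∈ = All.++⁻ʳ (guard (ti s <ᵇ q))
      (All.++⁻ʳ (guard (any (λ t → (si t ≡ᵇ ti s) ∧ isZero (sp t ⊖ tp s)) exc)) (All.++⁻ˡ (rImage s) (hyp₃ s∈)))

    same⁻ : ∀ s t → T (same s t) → si s ≡ si t × ev e (sp s) ≡ ev e (sp t)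
    same⁻ s t r = ℕ.≡ᵇ⇒≡ _ _ (proj₁ (T-∧⁻ {si s ≡ᵇ si t} r)) , ev-isZero-⊖ e (sp s) (sp t) (proj₂ (T-∧⁻ {si s ≡ᵇ si t} r))

    ap-sym : ∀ {i j k} → T (ap i j k) → T (ap k j i)
    ap-sym {i} {j} {k} t = subst (λ m → T (m ℕ.% q ≡ᵇ (2 ℕ.* j) ℕ.% q)) (ℕ.+-comm i k) t

    double-cancel : ∀ a b c → Z p (a + c - + 2 * b) → Z p (a - c) → Z p (a - b)
    double-cancel a b c d z = cancel (+ 2) (a - b) ¬Z-2 (by (lem a b c) (d +ᶻ z))
      where
      lem : ∀ a b c → a + c - + 2 * b + (a - c) ≡ + 2 * (a - b)
      lem = solve-∀

    endMid : ∀ {k a b c va vb vc} s t → s ∈ exc → t ∈ exc → Z p (ev e (sp s) - a) → Z p (ev e (den s) * va - ev e (num s)) →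
      Z p (ev e (sp t) - b) → Z p (ev e (den t) * vb - ev e (num t)) → k ℕ.< q → Z p (c * vc - ev e (S k)) →
      T (ap (si s) (si t) k) → T (ap (σ (ti s)) (σ (ti t)) (σ k)) → Z p (a + c - + 2 * b) → Z p (va + vc - + 2 * vb) → T (same s t)
    endMid {k} {a} {b} {c} {va} {vb} {vc} s t s∈ t∈ zs zvs zt zvt k<q zc d₁ d₂ dom img
      with when-not _ _ (same s t) d₁ d₂ (All.++⁻ˡ (rEndMid s t k) (hyp₅ s∈ t∈ k<q))
    ... | inj₁ same-st = same-st
    ... | inj₂ (h ∷ []) = contradiction (by (sym (ev-harm (num s) (den s) (num t) (den t) (S k) (+ 2 · sp t ⊖ sp s)))
        (harmonic (ev e (den s)) (ev e (den t)) (ev e (+ 2 · sp t ⊖ sp s)) (ev e (num s)) (ev e (num t)) (ev e (S k)) va vb vc zvs zvt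
          (value-resp c (ev e (+ 2 · sp t ⊖ sp s)) vc (ev e (S k))
            (by (trans (lem a b c (ev e (sp s)) (ev e (sp t))) (cong (_- c) (sym (trans (ev-⊖ e (+ 2 · sp t) (sp s)) (cong (_- ev e (sp s)) (ev-· e (+ 2) (sp t)))))))
              ((+ 2 *ᶻ zt) -ᶻ zs -ᶻ dom)) zc) img)) h
      where
      lem : ∀ a b c x y → + 2 * (y - b) - (x - a) - (a + c - + 2 * b) ≡ + 2 * y - x - c
      lem = solve-∀

    ends : ∀ {j a b c va vb vc} s u → s ∈ exc → u ∈ exc → Z p (ev e (sp s) - a) → Z p (ev e (den s) * va - ev e (num s)) →
      Z p (ev e (sp u) - c) → Z p (ev e (den u) * vc - ev e (num u)) → j ℕ.< q → Z p (b * vb - ev e (S j)) →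
      T (ap (si s) j (si u)) → T (ap (σ (ti s)) (σ j) (σ (ti u))) → Z p (a + c - + 2 * b) → Z p (va + vc - + 2 * vb) → T (same s u ∧ (si s ≡ᵇ j))
    ends {j} {a} {b} {c} {va} {vb} {vc} s u s∈ u∈ zs zvs zu zvu j<q zb d₁ d₂ dom img
      with when-not _ _ (same s u ∧ (si s ≡ᵇ j)) d₁ d₂ (All.++⁻ʳ (rEndMid s u j) (hyp₅ s∈ u∈ j<q))
    ... | inj₁ r = r
    ... | inj₂ (h ∷ []) = contradiction (by (sym (ev-harm (num s) (den s) (+ 2 · S j) (sp s ⊕ sp u) (num u) (den u)))
        (harmonic (ev e (den s)) (ev e (sp s ⊕ sp u)) (ev e (den u)) (ev e (num s)) (ev e (+ 2 · S j)) (ev e (num u)) va vb vc zvs mid zvu img)) h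
      where
      lem : ∀ a b c x y v n → + 2 * (b * v - n) + v * ((x - a) + (y - c) + (a + c - + 2 * b)) ≡ (x + y) * v - + 2 * n
      lem = solve-∀
      mid : Z p (ev e (sp s ⊕ sp u) * vb - ev e (+ 2 · S j))
      mid = by (trans (lem a b c (ev e (sp s)) (ev e (sp u)) vb (ev e (S j))) (cong₂ (λ x n → x * vb - n) (sym (ev-⊕ e (sp s) (sp u))) (sym (ev-· e (+ 2) (S j)))))
        ((+ 2 *ᶻ zb) +ᶻ (vb *ᶻ (zs +ᶻ zu +ᶻ dom)))

    allThree : ∀ {a b c va vb vc} s t u → s ∈ exc → t ∈ exc → u ∈ exc → Z p (ev e (sp s) - a) → Z p (ev e (den s) * va - ev e (num s)) →
      Z p (ev e (sp t) - b) → Z p (ev e (den t) * vb - ev e (num t)) → Z p (ev e (sp u) - c) → Z p (ev e (den u) * vc - ev e (num u)) →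
      T (ap (si s) (si t) (si u)) → T (ap (σ (ti s)) (σ (ti t)) (σ (ti u))) → Z p (a + c - + 2 * b) → Z p (va + vc - + 2 * vb) → T (same s t)
    allThree {a} {b} {c} {va} {vb} {vc} s t u s∈ t∈ u∈ zs zvs zt zvt zu zvu d₁ d₂ dom img
      with when-not _ _ (same s t) d₁ d₂ (concatMap⁻ (λ u → rAll s t u) (All.++⁻ʳ (concatMap (λ k → rEndMid s t k ++ rEnds s t k) (upTo q)) (All.++⁻ʳ (rInj s t) (hyp₄ s∈ t∈))) u∈)
    ... | inj₁ same-st = same-st
    ... | inj₂ h with isZero (sp s ⊕ sp u ⊖ + 2 · sp t)
    ...   | true = contradiction (by (sym (ev-harm (num s) (den s) (num t) (den t) (num u) (den u)))
              (harmonic (ev e (den s)) (ev e (den t)) (ev e (den u)) (ev e (num s)) (ev e (num t)) (ev e (num u)) va vb vc zvs zvt zvu img)) (All.head h)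
    ...   | false = contradiction (by (trans (lem a b c (ev e (sp s)) (ev e (sp t)) (ev e (sp u))) (sym (trans (ev-⊖ e (sp s ⊕ sp u) (+ 2 · sp t)) (cong₂ _-_ (ev-⊕ e (sp s) (sp u)) (ev-· e (+ 2) (sp t))))))
              (zs +ᶻ zu -ᶻ (+ 2 *ᶻ zt) +ᶻ dom)) (All.head h)
      where
      lem : ∀ a b c x y z → (x - a) + (z - c) - + 2 * (y - b) + (a + c - + 2 * b) ≡ x + z - + 2 * y
      lem = solve-∀

    end : ∀ {j k a b c va vb vc} s → s ∈ exc → Z p (ev e (sp s) - a) → Z p (ev e (den s) * va - ev e (num s)) →
      j ℕ.< q → (∀ {t} → t ∈ exc → si t ≡ j → ¬ Z p (ev e (sp t) - b)) → Z p (b * vb - ev e (S j)) →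
      k ℕ.< q → (∀ {t} → t ∈ exc → si t ≡ k → ¬ Z p (ev e (sp t) - c)) → ¬ Z p c → Z p (c * vc - ev e (S k)) →
      T (ap (si s) j k) → T (ap (σ (ti s)) (σ j) (σ k)) → Z p (a + c - + 2 * b) → ¬ Z p (va + vc - + 2 * vb)
    end {j} {k} {a} {b} {c} {va} {vb} {vc} s s∈ zs zvs j<q noB zb k<q noC c≢0 zc d₁ d₂ dom img =
      quad⁻ k j (λ x → + 2 · x ⊖ sp s) (num s) (num s ⊗ sp s ⊕ S k ⊗ den s ⊖ + 4 · (S j ⊗ den s)) (S k ⊗ den s ⊗ sp s) c
        (when⁻ _ (T-∧⁺ d₁ d₂) (All.++⁻ˡ (rEnd s j k) (hyp₆ s∈ j<q k<q))) c≢0 noC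
        (λ {t} t∈ eq z → noB t∈ eq (cancel (+ 2) (ev e (sp t) - b) ¬Z-2
          (by (lem₁ a b c A (ev e (sp t))) (by (cong (_- c) (trans (ev-⊖ e (+ 2 · sp t) (sp s)) (cong (_- A) (ev-· e (+ 2) (sp t))))) z +ᶻ dom +ᶻ zs))))
        -- Twice the harmonic relation, plus a multiple of the progression with a replaced by A, no
        -- longer contains b.
        (by (trans (lem₂ a b c A N D (ev e (S j)) (ev e (S k))) (sym (cong₂ (λ x y → N * c * c + x * c + y)
              (trans (ev-⊖ e (num s ⊗ sp s ⊕ S k ⊗ den s) (+ 4 · (S j ⊗ den s))) (cong₂ _-_ (trans (ev-⊕ e (num s ⊗ sp s) (S k ⊗ den s)) (cong₂ _+_ (ev-⊗ e (num s) (sp s)) (ev-⊗ e (S k) (den s))))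
                (trans (ev-· e (+ 4) (S j ⊗ den s)) (cong (+ 4 *_) (ev-⊗ e (S j) (den s))))))
              (trans (ev-⊗ e (S k ⊗ den s) (sp s)) (cong (_* A) (ev-⊗ e (S k) (den s)))))))
          ((+ 2 *ᶻ harmonic D b c N (ev e (S j)) (ev e (S k)) va vb vc zvs zb zc img) +ᶻ ((N * c + ev e (S k) * D) *ᶻ (dom +ᶻ zs))))
      where
      A = ev e (sp s)
      N = ev e (num s)
      D = ev e (den s)
      lem₁ : ∀ a b c A x → + 2 * x - A - c + (a + c - + 2 * b) + (A - a) ≡ + 2 * (x - b)
      lem₁ = solve-∀
      lem₂ : ∀ a b c A N D Sj Sk → + 2 * (N * b * c + Sk * D * b - + 2 * (Sj * D * c)) + (N * c + Sk * D) * (a + c - + 2 * b + (A - a))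
        ≡ N * c * c + (N * A + Sk * D - + 4 * (Sj * D)) * c + Sk * D * A
      lem₂ = solve-∀

    mid : ∀ {i k a b c va vb vc} s → s ∈ exc → Z p (ev e (sp s) - b) → Z p (ev e (den s) * vb - ev e (num s)) →
      i ℕ.< q → (∀ {t} → t ∈ exc → si t ≡ i → ¬ Z p (ev e (sp t) - a)) → Z p (a * va - ev e (S i)) →
      k ℕ.< q → (∀ {t} → t ∈ exc → si t ≡ k → ¬ Z p (ev e (sp t) - c)) → ¬ Z p c → Z p (c * vc - ev e (S k)) →
      T (ap i (si s) k) → T (ap (σ i) (σ (ti s)) (σ k)) → Z p (a + c - + 2 * b) → ¬ Z p (va + vc - + 2 * vb)
    mid {i} {k} {a} {b} {c} {va} {vb} {vc} s s∈ zs zvs i<q noA za k<q noC c≢0 zc d₁ d₂ dom img =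
      quad⁻ k i (λ x → + 2 · sp s ⊖ x) (+ 2 · num s) (S i ⊗ den s ⊖ S k ⊗ den s ⊖ + 4 · (num s ⊗ sp s)) (+ 2 · (S k ⊗ den s ⊗ sp s)) c
        (when⁻ _ (T-∧⁺ d₁ d₂) (All.++⁻ʳ (rEnd s i k) (hyp₆ s∈ i<q k<q))) c≢0 noC
        (λ {t} t∈ eq z → noA t∈ eq (by (lem₁ a b c B (ev e (sp t)))
          ((+ 2 *ᶻ zs) -ᶻ by (cong (_- c) (trans (ev-⊖ e (+ 2 · sp s) (sp t)) (cong (_- ev e (sp t)) (ev-· e (+ 2) (sp s))))) z -ᶻ dom)))
        (by (trans (lem₂ a b c B N D (ev e (S i)) (ev e (S k))) (sym (trans (cong₂ (λ x y → ev e (+ 2 · num s) * c * c + x * c + y)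
              (trans (ev-⊖ e (S i ⊗ den s ⊖ S k ⊗ den s) (+ 4 · (num s ⊗ sp s))) (cong₂ _-_ (trans (ev-⊖ e (S i ⊗ den s) (S k ⊗ den s)) (cong₂ _-_ (ev-⊗ e (S i) (den s)) (ev-⊗ e (S k) (den s))))
                (trans (ev-· e (+ 4) (num s ⊗ sp s)) (cong (+ 4 *_) (ev-⊗ e (num s) (sp s))))))
              (trans (ev-· e (+ 2) (S k ⊗ den s ⊗ sp s)) (cong (+ 2 *_) (trans (ev-⊗ e (S k ⊗ den s) (sp s)) (cong (_* B) (ev-⊗ e (S k) (den s)))))))
              (cong (λ x → x * c * c + (ev e (S i) * D - ev e (S k) * D - + 4 * (N * B)) * c + + 2 * (ev e (S k) * D * B)) (ev-· e (+ 2) (num s))))))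
          (harmonic a D c (ev e (S i)) N (ev e (S k)) va vb vc za zvs zc img -ᶻ ((ev e (S k) * D - + 2 * (N * c)) *ᶻ (dom -ᶻ (+ 2 *ᶻ zs)))))
      where
      B = ev e (sp s)
      N = ev e (num s)
      D = ev e (den s)
      lem₁ : ∀ a b c B x → + 2 * (B - b) - (+ 2 * B - x - c) - (a + c - + 2 * b) ≡ x - a
      lem₁ = solve-∀
      lem₂ : ∀ a b c B N D Si Sk → Si * D * c + Sk * a * D - + 2 * (N * a * c) - (Sk * D - + 2 * (N * c)) * (a + c - + 2 * b - + 2 * (B - b))
        ≡ + 2 * N * c * c + (Si * D - Sk * D - + 4 * (N * B)) * c + + 2 * (Sk * D * B)
      lem₂ = solve-∀

    none : ∀ {i j k a b c va vb vc} → i ℕ.< q → j ℕ.< q → k ℕ.< q → ¬ Z p a → Z p (a * va - ev e (S i)) → Z p (b * vb - ev e (S j)) → Z p (c * vc - ev e (S k)) →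
      T (ap i j k) → T (ap (σ i) (σ j) (σ k)) → Z p (a + c - + 2 * b) → Z p (va + vc - + 2 * vb) → i ≡ j × Z p (a - b)
    none {i} {j} {k} {a} {b} {c} {va} {vb} {vc} i<q j<q k<q a≢0 za zb zc d₁ d₂ dom img
      with when-not _ _ ((i ≡ᵇ j) ∧ (j ≡ᵇ k)) d₁ d₂ (hNone i<q j<q k<q)
    -- Completing the square in the binary form would exhibit a² times the discriminant as a square,
    -- where a is invertible.
    ... | inj₂ (h ∷ []) = ⊥-elim (NonRes-square a _ a≢0 h (+ 2 * Si * c + (Si + Sk - + 4 * Sj) * a)
        (by (trans (lem a c Si Sj Sk) (cong (λ x → (+ 2 * Si * c + (Si + Sk - + 4 * Sj) * a) * (+ 2 * Si * c + (Si + Sk - + 4 * Sj) * a) - a * a * x) (sym disc))) (+ 4 * Si *ᶻ form)))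
      where
      Si = ev e (S i)
      Sj = ev e (S j)
      Sk = ev e (S k)
      lem₀ : ∀ a b c Si Sj Sk → + 2 * (Si * b * c + Sk * a * b - + 2 * (Sj * a * c)) + (Si * c + Sk * a) * (a + c - + 2 * b)
        ≡ Si * (c * c) + (Si + Sk - + 4 * Sj) * a * c + Sk * (a * a)
      lem₀ = solve-∀
      form : Z p (Si * (c * c) + (Si + Sk - + 4 * Sj) * a * c + Sk * (a * a))
      form = by (lem₀ a b c Si Sj Sk) ((+ 2 *ᶻ harmonic a b c Si Sj Sk va vb vc za zb zc img) +ᶻ ((Si * c + Sk * a) *ᶻ dom))
      lem : ∀ a c Si Sj Sk → + 4 * Si * (Si * (c * c) + (Si + Sk - + 4 * Sj) * a * c + Sk * (a * a))
        ≡ (+ 2 * Si * c + (Si + Sk - + 4 * Sj) * a) * (+ 2 * Si * c + (Si + Sk - + 4 * Sj) * a) - a * a * ((Si + Sk - + 4 * Sj) * (Si + Sk - + 4 * Sj) - + 4 * (Si * Sk))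
      lem = solve-∀
      trace : ev e (S i ⊕ S k ⊖ + 4 · S j) ≡ Si + Sk - + 4 * Sj
      trace = trans (ev-⊖ e (S i ⊕ S k) (+ 4 · S j)) (cong₂ _-_ (ev-⊕ e (S i) (S k)) (ev-· e (+ 4) (S j)))
      disc : ev e ((S i ⊕ S k ⊖ + 4 · S j) ⊗ (S i ⊕ S k ⊖ + 4 · S j) ⊖ + 4 · (S i ⊗ S k)) ≡ (Si + Sk - + 4 * Sj) * (Si + Sk - + 4 * Sj) - + 4 * (Si * Sk)
      disc = trans (ev-⊖ e ((S i ⊕ S k ⊖ + 4 · S j) ⊗ (S i ⊕ S k ⊖ + 4 · S j)) (+ 4 · (S i ⊗ S k)))
        (cong₂ _-_ (trans (ev-⊗ e (S i ⊕ S k ⊖ + 4 · S j) (S i ⊕ S k ⊖ + 4 · S j)) (cong₂ _*_ trace trace)) (trans (ev-· e (+ 4) (S i ⊗ S k)) (cong (+ 4 *_) (ev-⊗ e (S i) (S k)))))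
    ... | inj₁ r with ℕ.≡ᵇ⇒≡ i j (proj₁ (T-∧⁻ {i ≡ᵇ j} r)) | ℕ.≡ᵇ⇒≡ j k (proj₂ (T-∧⁻ {i ≡ᵇ j} r))
    -- With equal weights the form is S i (a - c)². So a ≡ c, and a ≡ b because 2 is invertible.
    ...   | refl | refl = refl , double-cancel a b c dom (square-zero (cancel Si ((a - c) * (a - c)) (hS i<q)
        (by (lem a b c Si) ((+ 2 *ᶻ harmonic a b c Si Si Si va vb vc za zb zc img) +ᶻ ((Si * c + Si * a) *ᶻ dom)))))
      where
      Si = ev e (S i)
      square-zero : Z p ((a - c) * (a - c)) → Z p (a - c)
      square-zero z = [ (λ x → x) , (λ x → x) ]′ (Z-prime (a - c) (a - c) z)
      lem : ∀ a b c S → + 2 * (S * b * c + S * a * b - + 2 * (S * a * c)) + (S * c + S * a) * (a + c - + 2 * b) ≡ S * ((a - c) * (a - c))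
      lem = solve-∀

    swap : ∀ a b c → Z p (a + c - + 2 * b) → Z p (c + a - + 2 * b)
    swap a b c z = by (cong (_- + 2 * b) (ℤ.+-comm a c)) z

    reverse : ∀ a b c → Z p (a + c - + 2 * b) → Z p (c - b) → Z p (a - b)
    reverse a b c z z′ = by (lem a b c) (z -ᶻ z′)
      where
      lem : ∀ a b c → a + c - + 2 * b - (c - b) ≡ a - b
      lem = solve-∀

    -- The alternative k ≡ j comes from progressions read backwards, with exceptional middle and
    -- last terms. As i, j, k form a progression modulo q, it implies i ≡ j just as well.
    destroyed : ∀ {i j k a b c τa τb τc va vb vc} → View i a τa va → View j b τb vb → View k c τc vc →
      T (ap i j k) → T (ap τa τb τc) → Z p (a + c - + 2 * b) → Z p (va + vc - + 2 * vb) →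
      (i ≡ j ⊎ k ≡ j) × Z p (a - b)
    destroyed {a = a} {b} {c} (special s s∈ zs zvs) (special t t∈ zt zvt) (special u u∈ zu zvu) d₁ d₂ dom img
      with same⁻ s t (allThree s t u s∈ t∈ u∈ zs zvs zt zvt zu zvu d₁ d₂ dom img)
    ... | i≡j , x≡y = inj₁ i≡j , by (lem a b (ev e (sp s)) (ev e (sp t))) (≡⇒Z x≡y -ᶻ zs +ᶻ zt)
      where
      lem : ∀ a b x y → x - y - (x - a) + (y - b) ≡ a - b
      lem = solve-∀
    destroyed {a = a} {b} {c} (special s s∈ zs zvs) (special t t∈ zt zvt) (generic k k<q noC c≢0 zc) d₁ d₂ dom img
      with same⁻ s t (endMid s t s∈ t∈ zs zvs zt zvt k<q zc d₁ d₂ dom img)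
    ... | i≡j , x≡y = inj₁ i≡j , by (lem a b (ev e (sp s)) (ev e (sp t))) (≡⇒Z x≡y -ᶻ zs +ᶻ zt)
      where
      lem : ∀ a b x y → x - y - (x - a) + (y - b) ≡ a - b
      lem = solve-∀
    destroyed {i} {j} {k} {a} {b} {c} {va = va} {vb} {vc} (generic .i i<q noA a≢0 za) (special t t∈ zt zvt) (special u u∈ zu zvu) d₁ d₂ dom img
      with same⁻ u t (endMid {c = a} u t u∈ t∈ zu zvu zt zvt i<q za (ap-sym {i} {j} {k} d₁) (ap-sym {σ i} {σ (ti t)} {σ (ti u)} d₂) (swap a b c dom) (swap va vb vc img))
    ... | k≡j , x≡y = inj₂ k≡j , reverse a b c dom (by (lem c b (ev e (sp u)) (ev e (sp t))) (≡⇒Z x≡y -ᶻ zu +ᶻ zt))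
      where
      lem : ∀ a b x y → x - y - (x - a) + (y - b) ≡ a - b
      lem = solve-∀
    destroyed {j = j} {a = a} {b} {c} (special s s∈ zs zvs) (generic .j j<q noB b≢0 zb) (special u u∈ zu zvu) d₁ d₂ dom img
      with ends {b = b} s u s∈ u∈ zs zvs zu zvu j<q zb d₁ d₂ dom img
    ... | r with same⁻ s u (proj₁ (T-∧⁻ {same s u} r))
    ...   | _ , x≡y = inj₁ (ℕ.≡ᵇ⇒≡ _ _ (proj₂ (T-∧⁻ {same s u} r))) , double-cancel a b c dom (by (lem a c (ev e (sp s)) (ev e (sp u))) (≡⇒Z x≡y -ᶻ zs +ᶻ zu))
      where
      lem : ∀ a b x y → x - y - (x - a) + (y - b) ≡ a - b
      lem = solve-∀
    destroyed {a = a} {b} {c} (special s s∈ zs zvs) (generic j j<q noB b≢0 zb) (generic k k<q noC c≢0 zc) d₁ d₂ dom img =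
      ⊥-elim (end {b = b} s s∈ zs zvs j<q noB zb k<q noC c≢0 zc d₁ d₂ dom img)
    destroyed {a = a} {b} {c} {va = va} {vb} {vc} (generic i i<q noA a≢0 za) (generic j j<q noB b≢0 zb) (special s s∈ zs zvs) d₁ d₂ dom img =
      ⊥-elim (end {b = b} s s∈ zs zvs j<q noB zb i<q noA a≢0 za (ap-sym {i} {j} {si s} d₁) (ap-sym {σ i} {σ j} {σ (ti s)} d₂) (swap a b c dom) (swap va vb vc img))
    destroyed {a = a} {b} {c} (generic i i<q noA a≢0 za) (special s s∈ zs zvs) (generic k k<q noC c≢0 zc) d₁ d₂ dom img =
      ⊥-elim (mid {a = a} s s∈ zs zvs i<q noA za k<q noC c≢0 zc d₁ d₂ dom img)
    destroyed {a = a} {b} {c} (generic i i<q noA a≢0 za) (generic j j<q noB b≢0 zb) (generic k k<q noC c≢0 zc) d₁ d₂ dom img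
      with none {b = b} {c} i<q j<q k<q a≢0 za zb zc d₁ d₂ dom img
    ... | i≡j , z = inj₁ i≡j , z

    move : List Entry → ℕ → ℤ → ℕ × ℤ
    move [] i x = i , x
    move (s ∷ ss) i x with si s ℕ.≟ i | Z? p (ev e (sp s) - x)
    ... | yes _ | yes _ = ti s , ev e (tp s)
    ... | _ | _ = move ss i x

    move-resp : ∀ ss i x y → Z p (x - y) → proj₁ (move ss i x) ≡ proj₁ (move ss i y) × Z p (proj₂ (move ss i x) - proj₂ (move ss i y))
    move-resp [] i x y z = refl , z
    move-resp (s ∷ ss) i x y z with si s ℕ.≟ i | Z? p (ev e (sp s) - x) | Z? p (ev e (sp s) - y)
    ... | no _ | _ | _ = move-resp ss i x y z
    ... | yes _ | yes _ | yes _ = refl , ≡⇒Z {x = ev e (tp s)} refl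
    ... | yes _ | no _ | no _ = move-resp ss i x y z
    ... | yes _ | yes zx | no ny = contradiction (Z-trans (ev e (sp s)) x y zx z) ny
    ... | yes _ | no nx | yes zy = contradiction (Z-trans (ev e (sp s)) y x zy (Z-sym x y z)) nx

    data Moved (i : ℕ) (x : ℤ) : ℕ × ℤ → Set where
      special : ∀ s → s ∈ exc → si s ≡ i → Z p (ev e (sp s) - x) → Moved i x (ti s , ev e (tp s))
      generic : (∀ {s} → s ∈ exc → si s ≡ i → ¬ Z p (ev e (sp s) - x)) → Moved i x (i , x)

    moved : ∀ i x → Moved i x (move exc i x)
    moved i x = go exc (λ m → m) (λ m _ → inj₁ m)
      where
      go : ∀ ss → (∀ {s} → s ∈ ss → s ∈ exc) →
        (∀ {s} → s ∈ exc → (eq : si s ≡ i) → s ∈ ss ⊎ ¬ Z p (ev e (sp s) - x)) → Moved i x (move ss i x)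
      go [] sub rest = generic (λ m eq → [ (λ ()) , (λ n → n) ]′ (rest m eq))
      go (s ∷ ss) sub rest with si s ℕ.≟ i | Z? p (ev e (sp s) - x)
      ... | yes eq | yes z = special s (sub (here refl)) eq z
      ... | no ne | _ = go ss (sub ∘ there) (λ m eq → drop eq (rest m eq))
        where
        drop : ∀ {t} → si t ≡ i → t ∈ s ∷ ss ⊎ ¬ Z p (ev e (sp t) - x) → t ∈ ss ⊎ ¬ Z p (ev e (sp t) - x)
        drop eq (inj₁ (here refl)) = contradiction eq ne
        drop eq (inj₁ (there m)) = inj₁ m
        drop eq (inj₂ n) = inj₂ n
      ... | yes _ | no ¬z = go ss (sub ∘ there) (λ m eq → drop (rest m eq))
        where
        drop : ∀ {t} → t ∈ s ∷ ss ⊎ ¬ Z p (ev e (sp t) - x) → t ∈ ss ⊎ ¬ Z p (ev e (sp t) - x)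
        drop (inj₁ (here refl)) = inj₂ ¬z
        drop (inj₁ (there m)) = inj₁ m
        drop (inj₂ n) = inj₂ n

    value : ℕ × ℤ → ℤ
    value (i , x) = ev e (S i) * J x

    view : ∀ {i x iy} → i ℕ.< q → Moved i x iy → View i x (σ (proj₁ iy)) (value iy)
    view i<q (special s s∈ refl z) = special s s∈ z image
      where
      image : Z p (ev e (den s) * (ev e (S (ti s)) * J (ev e (tp s))) - ev e (num s))
      image with isZero (tp s) in eq | htp s∈
      ... | true | _ rewrite ev-isZero e (tp s) (subst T (sym eq) tt) | J-zero 0ℤ Z0 = by (lem e (ev e (S (ti s)))) Z0
        where
        lem : ∀ e x → 0ℤ ≡ (1ℤ + e * 0ℤ) * (x * 0ℤ) - 0ℤ
        lem = solve-∀
      ... | false | h ∷ [] = by (lem (ev e (tp s)) (J (ev e (tp s))) (ev e (S (ti s)))) (ev e (S (ti s)) *ᶻ J-inv (ev e (tp s)) h)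
        where
        lem : ∀ t j x → x * (t * j - 1ℤ) ≡ t * (x * j) - x
        lem = solve-∀
    view {i} {x} i<q (generic none′) = generic i i<q none′ x≢0
      (by (lem x (J x) (ev e (S i))) (ev e (S i) *ᶻ J-inv x x≢0))
      where
      lem : ∀ t j x → x * (t * j - 1ℤ) ≡ t * (x * j) - x
      lem = solve-∀
      x≢0 : ¬ Z p x
      x≢0 z with hZero i<q
      ... | s , s∈ , eq , z₀ = none′ s∈ eq (subst (λ t → Z p (t - x)) (sym z₀) (by (sym (ℤ.+-identityˡ (- x))) (negᶻ z)))

    index<q : ∀ {i x iy} → i ℕ.< q → Moved i x iy → proj₁ iy ℕ.< q
    index<q i<q (special s s∈ _ _) = ti<q s∈
    index<q i<q (generic _) = i<q

    hInj : ∀ {s t} → s ∈ exc → t ∈ exc → ti s ≡ ti t → Z p (ev e (tp s) - ev e (tp t)) → T (same s t)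
    hInj {s} {t} s∈ t∈ eq z with when-not true _ (same s t) tt (ℕ.≡⇒≡ᵇ _ _ eq) (All.++⁻ˡ (rInj s t) (hyp₄ s∈ t∈))
    ... | inj₁ r = r
    ... | inj₂ (h ∷ []) = contradiction (by (sym (ev-⊖ e (tp s) (tp t))) z) h

    same-point : ∀ {x y} s t → Z p (ev e (sp s) - x) → Z p (ev e (sp t) - y) → T (same s t) → si s ≡ si t × Z p (x - y)
    same-point {x} {y} s t zs zt r = proj₁ (same⁻ s t r) , by (lem x y (ev e (sp s)) (ev e (sp t))) (≡⇒Z (proj₂ (same⁻ s t r)) -ᶻ zs +ᶻ zt)
      where
      lem : ∀ a b x y → x - y - (x - a) + (y - b) ≡ a - b
      lem = solve-∀

    image-special : ∀ {i x} s → ti s ≡ i → Z p (ev e (tp s) - x) → (∀ {t} → t ∈ exc → si t ≡ i → ¬ Z p (ev e (sp t) - x)) →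
      ¬ (∃[ t ] t ∈ exc × si t ≡ ti s × ev e (sp t) ≡ ev e (tp s))
    image-special {x = x} s eq z none′ (t , t∈ , st , ft) = none′ t∈ (trans st eq) (subst (λ u → Z p (u - x)) (sym ft) z)

    -- A generic point is its own image, and the image of an exceptional point is again exceptional,
    -- so only two exceptional points could collide.
    moved-inj : ∀ {i j x y ix jy} → Moved i x ix → Moved j y jy → proj₁ ix ≡ proj₁ jy → Z p (proj₂ ix - proj₂ jy) → i ≡ j × Z p (x - y)
    moved-inj (special s s∈ refl zs) (special t t∈ refl zt) eq z = same-point s t zs zt (hInj s∈ t∈ eq z)
    moved-inj (special s s∈ refl zs) (generic none′) eq z = ⊥-elim (image-special s eq z none′ (hImage s∈))
    moved-inj {x = x} (generic none′) (special s s∈ refl zs) eq z = ⊥-elim (image-special s (sym eq) (Z-sym x (ev e (tp s)) z) none′ (hImage s∈))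
    moved-inj (generic _) (generic _) eq z = eq , z

    value-moved-resp : ∀ ix jy → proj₁ ix ≡ proj₁ jy × Z p (proj₂ ix - proj₂ jy) →
      Z q (+ σ (proj₁ ix) - + σ (proj₁ jy)) × Z p (value ix - value jy)
    value-moved-resp (i , x) (.i , y) (refl , z) = ≡⇒Z {x = + σ i} refl , by (lem (ev e (S i)) (J x) (J y)) (ev e (S i) *ᶻ J-resp x y z)
      where
      lem : ∀ s x y → s * (x - y) ≡ s * x - s * y
      lem = solve-∀

    value-moved-inj : ∀ ix jy → proj₁ ix ℕ.< q → proj₁ jy ℕ.< q →
      Z q (+ σ (proj₁ ix) - + σ (proj₁ jy)) → Z p (value ix - value jy) → proj₁ ix ≡ proj₁ jy × Z p (proj₂ ix - proj₂ jy)
    value-moved-inj (i , x) (j , y) i<q j<q zτ zv with σ-inj i<q j<q (<⇒Z⇒≡ (σ<q i<q) (σ<q j<q) zτ)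
    ... | refl = refl , J-inj x y (cancel (ev e (S i)) (J x - J y) (hS i<q) (by (lem (ev e (S i)) (J x) (J y)) zv))
      where
      lem : ∀ s x y → s * x - s * y ≡ s * (x - y)
      lem = solve-∀

    ap⁺ : ∀ i j k → Z q (+ i + + k - + 2 * + j) → T (ap i j k)
    ap⁺ i j k z = ℕ.≡⇒≡ᵇ _ _ (%ℕ-cong (+ (i ℕ.+ k)) (+ (2 ℕ.* j)) (by (cong₂ _-_ (sym (ℤ.pos-+ i k)) (sym (ℤ.pos-* 2 j))) z))

    moved-destroyed : ∀ {i j k a b c} ma mb mc → i ℕ.< q → j ℕ.< q → k ℕ.< q → Moved i a ma → Moved j b mb → Moved k c mc →
      Z q (+ i + + k - + 2 * + j) → Z q (+ σ (proj₁ ma) + + σ (proj₁ mc) - + 2 * + σ (proj₁ mb)) →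
      Z p (a + c - + 2 * b) → Z p (value ma + value mc - + 2 * value mb) → (i ≡ j ⊎ k ≡ j) × Z p (a - b)
    moved-destroyed {i} {j} {k} ma mb mc i<q j<q k<q va vb vc zi zτ dom img = destroyed (view i<q va) (view j<q vb) (view k<q vc)
      (ap⁺ i j k zi) (ap⁺ (σ (proj₁ ma)) (σ (proj₁ mb)) (σ (proj₁ mc)) zτ) dom img

    private
      ι : ℤ → ℕ
      ι x = x %ℕ q

      ι<q : ∀ x → ι x ℕ.< q
      ι<q x = n%ℕd<d x q

      mv : ℤ → ℕ × ℤ
      mv x = move exc (ι x) x

      ι-Z : ∀ x y → ι x ≡ ι y → Z q (x - y)
      ι-Z x y eq = Z-trans x (+ ι x) y (%ℕ-Z q x) (Z-sym y (+ ι x) (subst (λ i → Z q (y - + i)) (sym eq) (%ℕ-Z q y)))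

    destroying : Destroying (q ℕ.* p)
    destroying = glue cqp cpq (λ x → + σ (proj₁ (mv x))) (λ x → value (mv x))
      (λ a b zq zp → value-moved-resp (mv a) (mv b)
        (subst (λ i → proj₁ (mv a) ≡ proj₁ (move exc i b) × Z p (proj₂ (mv a) - proj₂ (move exc i b))) (%ℕ-cong a b zq) (move-resp exc (ι a) a b zp)))
      (λ a b zτ zv → injective a b (value-moved-inj (mv a) (mv b) (index<q (ι<q a) (moved (ι a) a)) (index<q (ι<q b) (moved (ι b) b)) zτ zv))
      (λ a b c zq zp zτ zv → conclude a b c zq (moved-destroyed (mv a) (mv b) (mv c) (ι<q a) (ι<q b) (ι<q c) (moved (ι a) a) (moved (ι b) b) (moved (ι c) c)
        (by (lem a b c (+ ι a) (+ ι b) (+ ι c)) (zq -ᶻ %ℕ-Z q a -ᶻ %ℕ-Z q c +ᶻ (+ 2 *ᶻ %ℕ-Z q b))) zτ zp zv))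
      where
      lem : ∀ a b c x y z → (a + c - + 2 * b) - (a - x) - (c - z) + + 2 * (b - y) ≡ x + z - + 2 * y
      lem = solve-∀
      rev : ∀ a b c → a + c - + 2 * b - (c - b) ≡ a - b
      rev = solve-∀
      injective : ∀ a b → proj₁ (mv a) ≡ proj₁ (mv b) × Z p (proj₂ (mv a) - proj₂ (mv b)) → Z q (a - b) × Z p (a - b)
      injective a b (eq , z) with moved-inj (moved (ι a) a) (moved (ι b) b) eq z
      ... | ι≡ , z′ = ι-Z a b ι≡ , z′
      conclude : ∀ a b c → AP q a b c → (ι a ≡ ι b ⊎ ι c ≡ ι b) × Z p (a - b) → Z q (a - b) × Z p (a - b)
      conclude a b c zq (inj₁ eq , z) = ι-Z a b eq , z
      conclude a b c zq (inj₂ eq , z) = by (rev a b c) (zq -ᶻ ι-Z c b eq) , z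

-- The configurations for q = 1, 2, 3, 5, 7 and the conditions on e

nth : {A : Set} → A → List A → ℕ → A
nth d [] _ = d
nth d (x ∷ xs) zero = x
nth d (x ∷ xs) (suc n) = nth d xs n

X : Poly
X = 0ℤ ∷ 1ℤ ∷ []

cycle : List Poly → List Entry
cycle [] = []
cycle (f ∷ fs) = go f fs
  where
  go : Poly → List Poly → List Entry
  go g [] = (0 at g ↦ 0 at f) ∷ []
  go g (h ∷ hs) = (0 at g ↦ 0 at h) ∷ go h hs

cyclic : List (List Poly) → Config
cyclic cs = record { σ = λ i → i ; S = λ _ → 1ℤ ∷ [] ; exc = concatMap cycle cs }

-- Two exceptional points in each class, 0 and zᵢ. The zeros go to the points z along α, and the
-- points z go to the zeros along β.
twisted : List ℕ → List Poly → (α β : List ℕ) → List Poly → Config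
twisted σ S α β z = record
  { σ = nth 0 σ
  ; S = nth (1ℤ ∷ []) S
  ; exc = concatMap (λ i → (i at [] ↦ nth 0 α i at nth [] z (nth 0 α i)) ∷ (i at nth [] z i ↦ nth 0 β i at []) ∷ []) (upTo (length σ))
  }

constant : ℤ → Poly
constant c = c ∷ []

-- Found by computer search.
C₁ C₂ C₃ C₅ C₇ : Config
C₁ = cyclic (([] ∷ constant (+ 6) ∷ + 6 · X ∷ []) ∷ (constant (+ 18) ∷ + 18 · X ∷ []) ∷ (constant (+ 2) ∷ + 2 · X ∷ []) ∷ [])
C₂ = twisted (0 ∷ 1 ∷ []) (constant (+ 1) ∷ X ∷ []) (1 ∷ 0 ∷ []) (1 ∷ 0 ∷ []) (constant (+ 6) ∷ constant (+ 2) ∷ [])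
C₃ = twisted (0 ∷ 1 ∷ 2 ∷ []) (constant (+ 1) ∷ constant (+ 1) ∷ X ∷ []) (1 ∷ 2 ∷ 0 ∷ []) (1 ∷ 2 ∷ 0 ∷ []) (constant (+ 6) ∷ constant (+ 6) ∷ constant (+ 2) ∷ [])
C₅ = twisted (0 ∷ 1 ∷ 2 ∷ 4 ∷ 3 ∷ []) (constant (+ 1) ∷ X ∷ []) (1 ∷ 4 ∷ 3 ∷ 0 ∷ 2 ∷ []) (1 ∷ 4 ∷ 3 ∷ 0 ∷ 2 ∷ [])
  (+ 12 · X ∷ + 36 · X ∷ + 8 · X ∷ constant (+ 162) ∷ constant (+ 108) ∷ [])
C₇ = twisted (0 ∷ 1 ∷ 4 ∷ 2 ∷ 6 ∷ 3 ∷ 5 ∷ []) (constant (+ 1) ∷ constant (+ 1) ∷ constant (+ 1) ∷ constant (+ 1) ∷ constant (+ 1) ∷ X ∷ [])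
  (3 ∷ 5 ∷ 1 ∷ 0 ∷ 6 ∷ 4 ∷ 2 ∷ []) (1 ∷ 0 ∷ 4 ∷ 5 ∷ 2 ∷ 6 ∷ 3 ∷ [])
  (constant (+ 4) ∷ constant (+ 2) ∷ constant (+ 6) ∷ constant (+ 9) ∷ constant (+ 27) ∷ constant (+ 12) ∷ constant (+ 3) ∷ [])

strip : ℕ → List ℕ → ℕ → ℕ
strip zero _ n = n
strip (suc f) [] n = n
strip (suc f) (zero ∷ ds) n = strip f ds n
strip (suc f) (d@(suc _) ∷ ds) n = if (n ℕ.% d) ≡ᵇ 0 then strip f (d ∷ ds) (n ℕ./ d) else strip f ds n

lead : Poly → ℤ
lead [] = 0ℤ
lead (c ∷ []) = c
lead (c ∷ f) with lead f
... | + 0 = c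
... | l = l

-- A guess for the scalar between two proportional polynomials, applied to their leading
-- coefficients. A wrong guess only makes `covers` fail, as the difference is compared with zero
-- there.
ratio : ℤ → ℤ → ℤ
ratio a (+ 0) = 0ℤ
ratio a b@(+ suc n) = a /ℕ suc n
ratio a -[1+ n ] = - (a /ℕ suc n)

-- A short list of conditions on e from which all requirements of a configuration follow: these are
-- multiples of `polys` and square multiples of `discs`, with scalars whose prime factors are listed
-- in `units` and must differ from p.
record System : Set where
  field
    units : List ℕ
    polys discs : List Poly

squareRoots : List ℤ
squareRoots = map +_ (1 ∷ 2 ∷ 4 ∷ 6 ∷ 8 ∷ 18 ∷ 24 ∷ 72 ∷ [])

module _ (s : System) where

  open System s

  unit : ℤ → Bool
  unit c = strip 100 units ∣ c ∣ ≡ᵇ 1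

  covers : Req → Bool
  covers (nz f) = any (λ g → isZero (f ⊖ ratio (lead f) (lead g) · g) ∧ unit (ratio (lead f) (lead g))) polys
  covers (nr f) = any (λ d → any (λ h → isZero (f ⊖ (h * h) · d) ∧ unit h) squareRoots) discs

s₂ : System
s₂ = record
  { units = 2 ∷ 3 ∷ 5 ∷ 11 ∷ []
  ; polys =
      (+ 1 ∷ []) ∷ (-[1+ 3 ] ∷ + 3 ∷ []) ∷ (-[1+ 0 ] ∷ + 3 ∷ []) ∷ (-[1+ 0 ] ∷ + 12 ∷ []) ∷ (+ 0 ∷ + 1 ∷ []) ∷ []
  ; discs = (+ 0 ∷ -[1+ 0 ] ∷ + 1 ∷ []) ∷ (+ 1 ∷ -[1+ 0 ] ∷ + 0 ∷ []) ∷ []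
  }

s₃ : System
s₃ = record
  { units = 2 ∷ 3 ∷ 5 ∷ []
  ; polys =
      (+ 1 ∷ []) ∷ (-[1+ 0 ] ∷ + 3 ∷ []) ∷ (+ 0 ∷ + 1 ∷ []) ∷ []
  ; discs = (+ 0 ∷ -[1+ 0 ] ∷ + 1 ∷ []) ∷ (+ 9 ∷ -[1+ 9 ] ∷ + 1 ∷ []) ∷ []
  }

s₅ : System
s₅ = record
  { units = 2 ∷ 3 ∷ 5 ∷ []
  ; polys =
      (+ 1 ∷ []) ∷ (-[1+ 80 ] ∷ + 8 ∷ []) ∷ (-[1+ 26 ] ∷ + 1 ∷ []) ∷ (-[1+ 26 ] ∷ + 4 ∷ []) ∷
      (+ 0 ∷ + 1 ∷ []) ∷ (+ 9 ∷ + 1 ∷ []) ∷ (+ 9 ∷ + 2 ∷ []) ∷ (+ 81 ∷ + 10 ∷ []) ∷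
      (-[1+ 80 ] ∷ + 0 ∷ + 16 ∷ []) ∷ (-[1+ 8 ] ∷ + 0 ∷ + 4 ∷ []) ∷ (+ 0 ∷ + 0 ∷ + 1 ∷ []) ∷
      (+ 0 ∷ + 81 ∷ + 10 ∷ []) ∷ (+ 0 ∷ + 0 ∷ + 0 ∷ + 1 ∷ []) ∷ []
  ; discs = (+ 0 ∷ -[1+ 0 ] ∷ + 1 ∷ []) ∷ []
  }

s₇ : System
s₇ = record
  { units = 2 ∷ 3 ∷ 5 ∷ 7 ∷ 11 ∷ 13 ∷ 17 ∷ 19 ∷ 23 ∷ []
  ; polys =
      (+ 1 ∷ []) ∷ (+ 0 ∷ + 1 ∷ []) ∷ (+ 1 ∷ + 1 ∷ []) ∷ []
  ; discs = (+ 0 ∷ -[1+ 0 ] ∷ + 1 ∷ []) ∷ (+ 9 ∷ -[1+ 9 ] ∷ + 1 ∷ []) ∷ []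
  }

-- The requirements of all five configurations together. With e = -u the
-- discriminants are u(1 + u), 1 + u, (1 + u)(9 + u) and (1 + u)(1 + 9u), so that
-- u, 9 + u and 1 + 9u may be residues and 1 + u a nonresidue.
s∀ : System
s∀ = record
  { units = 2 ∷ 3 ∷ 5 ∷ 7 ∷ 11 ∷ 13 ∷ 17 ∷ 19 ∷ 23 ∷ []
  ; polys =
      (+ 1 ∷ []) ∷ (-[1+ 17 ] ∷ + 1 ∷ []) ∷ (-[1+ 16 ] ∷ + 1 ∷ []) ∷ (-[1+ 16 ] ∷ + 3 ∷ []) ∷
      (-[1+ 16 ] ∷ + 9 ∷ []) ∷ (-[1+ 14 ] ∷ + 1 ∷ []) ∷ (-[1+ 11 ] ∷ + 5 ∷ []) ∷ (-[1+ 8 ] ∷ + 1 ∷ []) ∷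
      (-[1+ 8 ] ∷ + 2 ∷ []) ∷ (-[1+ 8 ] ∷ + 5 ∷ []) ∷ (-[1+ 8 ] ∷ + 17 ∷ []) ∷ (-[1+ 8 ] ∷ + 25 ∷ []) ∷
      (-[1+ 5 ] ∷ + 1 ∷ []) ∷ (-[1+ 4 ] ∷ + 1 ∷ []) ∷ (-[1+ 4 ] ∷ + 3 ∷ []) ∷ (-[1+ 4 ] ∷ + 9 ∷ []) ∷
      (-[1+ 3 ] ∷ + 1 ∷ []) ∷ (-[1+ 3 ] ∷ + 3 ∷ []) ∷ (-[1+ 3 ] ∷ + 7 ∷ []) ∷ (-[1+ 2 ] ∷ + 1 ∷ []) ∷
      (-[1+ 2 ] ∷ + 2 ∷ []) ∷ (-[1+ 2 ] ∷ + 5 ∷ []) ∷ (-[1+ 2 ] ∷ + 10 ∷ []) ∷ (-[1+ 2 ] ∷ + 11 ∷ []) ∷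
      (-[1+ 2 ] ∷ + 17 ∷ []) ∷ (-[1+ 1 ] ∷ + 1 ∷ []) ∷ (-[1+ 1 ] ∷ + 3 ∷ []) ∷ (-[1+ 1 ] ∷ + 9 ∷ []) ∷
      (-[1+ 0 ] ∷ + 1 ∷ []) ∷ (-[1+ 0 ] ∷ + 2 ∷ []) ∷ (-[1+ 0 ] ∷ + 3 ∷ []) ∷ (-[1+ 0 ] ∷ + 5 ∷ []) ∷
      (-[1+ 0 ] ∷ + 6 ∷ []) ∷ (-[1+ 0 ] ∷ + 7 ∷ []) ∷ (-[1+ 0 ] ∷ + 9 ∷ []) ∷ (-[1+ 0 ] ∷ + 15 ∷ []) ∷
      (-[1+ 0 ] ∷ + 17 ∷ []) ∷ (-[1+ 0 ] ∷ + 18 ∷ []) ∷ (+ 0 ∷ + 1 ∷ []) ∷ (+ 1 ∷ + 1 ∷ []) ∷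
      (+ 1 ∷ + 2 ∷ []) ∷ (+ 1 ∷ + 3 ∷ []) ∷ (+ 1 ∷ + 5 ∷ []) ∷ (+ 1 ∷ + 7 ∷ []) ∷ (+ 1 ∷ + 9 ∷ []) ∷
      (+ 3 ∷ + 1 ∷ []) ∷ (+ 3 ∷ + 7 ∷ []) ∷ (+ 7 ∷ + 1 ∷ []) ∷ (+ 7 ∷ + 3 ∷ []) ∷ (+ 7 ∷ + 9 ∷ []) ∷
      (+ 9 ∷ + 1 ∷ []) ∷ (+ 9 ∷ + 7 ∷ []) ∷ (+ 9 ∷ + 119 ∷ []) ∷ (+ 0 ∷ -[1+ 24 ] ∷ + 9 ∷ []) ∷
      (+ 0 ∷ -[1+ 3 ] ∷ + 3 ∷ []) ∷ (+ 0 ∷ + 5 ∷ + 3 ∷ []) ∷ (+ 0 ∷ + 119 ∷ + 9 ∷ []) ∷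
      (+ 1 ∷ -[1+ 4 ] ∷ + 4 ∷ []) ∷ (+ 1 ∷ -[1+ 1 ] ∷ + 1 ∷ []) ∷ (+ 3 ∷ -[1+ 22 ] ∷ + 12 ∷ []) ∷
      (+ 3 ∷ -[1+ 1 ] ∷ + 3 ∷ []) ∷ (+ 4 ∷ -[1+ 4 ] ∷ + 1 ∷ []) ∷ (+ 9 ∷ -[1+ 172 ] ∷ + 36 ∷ []) ∷
      (+ 9 ∷ + 46 ∷ + 9 ∷ []) ∷ (+ 12 ∷ -[1+ 22 ] ∷ + 3 ∷ []) ∷ (+ 36 ∷ -[1+ 172 ] ∷ + 9 ∷ []) ∷
      (-[1+ 0 ] ∷ + 12 ∷ []) ∷ (-[1+ 80 ] ∷ + 8 ∷ []) ∷ (-[1+ 26 ] ∷ + 1 ∷ []) ∷ (-[1+ 26 ] ∷ + 4 ∷ []) ∷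
      (+ 9 ∷ + 2 ∷ []) ∷ (+ 81 ∷ + 10 ∷ []) ∷ (-[1+ 80 ] ∷ + 0 ∷ + 16 ∷ []) ∷ (-[1+ 8 ] ∷ + 0 ∷ + 4 ∷ []) ∷
      (+ 0 ∷ + 0 ∷ + 1 ∷ []) ∷ (+ 0 ∷ + 81 ∷ + 10 ∷ []) ∷ (+ 0 ∷ + 0 ∷ + 0 ∷ + 1 ∷ []) ∷ []
  ; discs = (+ 0 ∷ -[1+ 0 ] ∷ + 1 ∷ []) ∷ (+ 1 ∷ -[1+ 0 ] ∷ + 0 ∷ []) ∷ (+ 9 ∷ -[1+ 9 ] ∷ + 1 ∷ []) ∷ (+ 1 ∷ -[1+ 9 ] ∷ + 9 ∷ []) ∷ []
  }

covers₂ : all (covers s₂) (Requirements.reqs 2 C₂) ≡ true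
covers₂ = refl

covers₃ : all (covers s₃) (Requirements.reqs 3 C₃) ≡ true
covers₃ = refl

covers₅ : all (covers s₅) (Requirements.reqs 5 C₅) ≡ true
covers₅ = refl

covers₇ : all (covers s₇) (Requirements.reqs 7 C₇) ≡ true
covers₇ = refl

covers∀₁ : all (covers s∀) (Requirements.reqs 1 C₁) ≡ true
covers∀₁ = refl

covers∀₂ : all (covers s∀) (Requirements.reqs 2 C₂) ≡ true
covers∀₂ = refl

covers∀₃ : all (covers s∀) (Requirements.reqs 3 C₃) ≡ true
covers∀₃ = refl

covers∀₅ : all (covers s∀) (Requirements.reqs 5 C₅) ≡ true
covers∀₅ = refl

covers∀₇ : all (covers s∀) (Requirements.reqs 7 C₇) ≡ true
covers∀₇ = refl

-- The search for the parameter

infixr 8 _^ⁿ_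

_^ⁿ_ : ℤ → ℕ → ℤ
b ^ⁿ zero = 1ℤ
b ^ⁿ suc n = b * b ^ⁿ n

-- b ^ (length f - 1) times the value of f at a / b.
hev : ℤ → ℤ → Poly → ℤ
hev a b [] = 0ℤ
hev a b (c ∷ f) = c * b ^ⁿ length f + a * hev a b f

isFalse : Maybe Bool → Bool
isFalse (just false) = true
isFalse _ = false

record Candidate : Set where
  constructor candidate
  field
    wanted : List Req
    a b : ℤ

open Candidate

-- For even degree, hev differs from the value of f by a square factor.
shortOdd : Poly → Bool
shortOdd (_ ∷ []) = true
shortOdd (_ ∷ _ ∷ _ ∷ []) = true
shortOdd _ = false

signOk : (ℤ → Maybe Bool) → ℤ → ℤ → Req → Bool
signOk sign a b (nz f) = true
signOk sign a b (nr f) = shortOdd f ∧ isFalse (sign (hev a b f))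

signsOk : (ℤ → Maybe Bool) → Candidate → Bool
signsOk sign c = all (signOk sign (a c) (b c)) (wanted c)

nonvanishing : ℤ → ℤ → List Req → ℤ
nonvanishing a b [] = 1ℤ
nonvanishing a b (nz f ∷ rs) = hev a b f * nonvanishing a b rs
nonvanishing a b (nr f ∷ rs) = nonvanishing a b rs

-- The primes p dividing it are those for which e = a / b is undefined or violates some `nz`. For
-- all other p only the signs matter, and these do not refer to p itself.
obstruction : Candidate → ℤ
obstruction c = b c * nonvanishing (a c) (b c) (wanted c)

euclid : ℕ → ℕ → ℕ → ℕ
euclid zero m n = m
euclid (suc k) m zero = m
euclid (suc k) m n@(suc _) = euclid k n (m ℕ.% n)

commonObstruction : List Candidate → ℕ
commonObstruction = foldr (λ c g → euclid 1000000 ∣ obstruction c ∣ g) 0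

-- All primes below 113. They are invertible modulo every p above 112, which is why smaller p are
-- treated separately.
smallPrimes : List ℕ
smallPrimes = 2 ∷ 3 ∷ 5 ∷ 7 ∷ 11 ∷ 13 ∷ 17 ∷ 19 ∷ 23 ∷ 29 ∷ 31 ∷ 37 ∷ 41 ∷ 43 ∷ 47 ∷ 53 ∷ 59 ∷ 61 ∷ 67 ∷ 71 ∷ 73 ∷ 79 ∷ 83 ∷ 89 ∷ 97 ∷ 101 ∷ 103 ∷ 107 ∷ 109 ∷ []

-- The obstructions have no common prime factor outside ds, so that modulo any
-- other prime one of the candidates is unobstructed.
groupOk : (ℤ → Maybe Bool) → List ℕ → List Candidate → Bool
groupOk sign ds cs = all (signsOk sign) cs ∧ (strip 1000000 ds (commonObstruction cs) ≡ᵇ 1)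

record Known : Set where
  constructor known
  field
    minusOne : Maybe Bool
    primes : List (ℕ × Bool)

-- Trial division by the numbers of known character; `nothing` if something other than 1 remains or
-- the fuel runs out.
signℕ : ℕ → List (ℕ × Bool) → ℕ → Maybe Bool
signℕ zero _ n = nothing
signℕ (suc k) [] n = if n ≡ᵇ 1 then just true else nothing
signℕ (suc k) ((zero , _) ∷ ds) n = nothing
signℕ (suc k) ds@((d@(suc _) , s) ∷ ds′) n = if (n ℕ.% d) ≡ᵇ 0 then Maybe.map (xnor s) (signℕ k ds (n ℕ./ d)) else signℕ k ds′ n

signℤ : Known → ℤ → Maybe Bool
signℤ k (+ n) = signℕ 10000 (Known.primes k) n
signℤ (known nothing ds) -[1+ n ] = nothing
signℤ (known (just s) ds) -[1+ n ] = Maybe.map (xnor s) (signℕ 10000 ds (suc n))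

-- The leaves offer candidates a / b for e; in separate, those for the moduli 3, 5
-- and 7 and for 2 differ, and the modulus 1 has configurations without parameter.
data Tree : Set where
  split : ℕ → Tree → Tree → Tree
  splitNeg : Tree → Tree → Tree
  uniform : List (ℤ × ℤ) → Tree
  separate : List (List (List ℤ)) → (e₃₅₇ e₂ : List (ℤ × ℤ)) → Tree
  smallResidues : Tree

-- Soundness of the search for a given prime

module Candidates (p : ℕ) (pr : Prime p) (10<p : 10 ℕ.< p) where

  open Residues p pr 10<p public

  Holds : ℤ → Req → Set
  Holds = HoldsAt p pr 2<p

  Sound : (ℤ → Maybe Bool) → Set
  Sound sign = ∀ {x s} → sign x ≡ just s → Sg s x

  ¬Z-1or : ∀ n → n ≡ 1 → ¬ (p ℕ.∣ n)
  ¬Z-1or n refl d = ¬Z-1 (∣ᵤ⇒∣ d)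

  -- Dividing out a number prime to p never removes a factor p, so a final 1 is conclusive wherever
  -- the recursion stops.
  strip-sound : ∀ k ds n → All (λ d → ¬ p ℕ.∣ d) ds → strip k ds n ≡ 1 → ¬ p ℕ.∣ n
  strip-sound zero ds n _ eq = ¬Z-1or n eq
  strip-sound (suc k) [] n _ eq = ¬Z-1or n eq
  strip-sound (suc k) (zero ∷ ds) n (_ ∷ h) eq = strip-sound k ds n h eq
  strip-sound (suc k) (d@(suc _) ∷ ds) n (nd ∷ h) eq p∣n with (n ℕ.% d) ≡ᵇ 0 in r
  ... | false = strip-sound k ds n h eq p∣n
  ... | true = [ strip-sound k (d ∷ ds) (n ℕ./ d) (nd ∷ h) eq , nd ]′
        (euclidsLemma (n ℕ./ d) d pr (subst (p ℕ.∣_) (trans (ℕ.m≡m%n+[m/n]*n n d) (cong (ℕ._+ (n ℕ./ d) ℕ.* d) (ℕ.≡ᵇ⇒≡ (n ℕ.% d) 0 (subst T (sym r) tt)))) p∣n))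

  -- Common divisors are invariant under each step, so the result is correct even if the fuel is
  -- exhausted before the gcd is reached.
  euclid-∣ : ∀ k m n → p ℕ.∣ m → p ℕ.∣ n → p ℕ.∣ euclid k m n
  euclid-∣ zero m n dm dn = dm
  euclid-∣ (suc k) m zero dm dn = dm
  euclid-∣ (suc k) m n@(suc _) dm dn = euclid-∣ k n (m ℕ.% n) dn (ℕ.%-presˡ-∣ dm dn)

  unobstructed : ∀ cs → ¬ p ℕ.∣ commonObstruction cs → ∃[ c ] c ∈ cs × ¬ Z p (obstruction c)
  unobstructed [] n = contradiction (p ℕ.∣0) n
  unobstructed (c ∷ cs) n with Z? p (obstruction c)
  ... | no ¬z = c , here refl , ¬z
  ... | yes z with unobstructed cs (λ d → n (euclid-∣ 1000000 ∣ obstruction c ∣ (commonObstruction cs) (∣⇒∣ᵤ z) d))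
  ...   | c′ , c′∈ , ¬z = c′ , there c′∈ , ¬z

  -- The additional factor b on the left turns the exponent `length f` - 1 into `length f`, which
  -- also makes sense for the empty polynomial.
  homogenize : ∀ a b e f → Z p (b * e - a) → Z p (b * hev a b f - b ^ⁿ length f * ev e f)
  homogenize a b e [] z = by (lem b (ℤ.+ 1)) Z0
    where
    lem : ∀ b o → 0ℤ ≡ b * 0ℤ - o * 0ℤ
    lem = solve-∀
  homogenize a b e (c ∷ f) z = by (lem a b c e (b ^ⁿ length f) (hev a b f) (ev e f))
    ((a *ᶻ homogenize a b e f z) -ᶻ ((b ^ⁿ length f * ev e f) *ᶻ z))
    where
    lem : ∀ a b c e n h v → a * (b * h - n * v) - n * v * (b * e - a) ≡ b * (c * n + a * h) - b * n * (c + e * v)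
    lem = solve-∀

  hev-nz : ∀ a b e f → Z p (b * e - a) → ¬ Z p b → ¬ Z p (hev a b f) → ¬ Z p (ev e f)
  hev-nz a b e f z nb nh zf = ¬Z-* nb nh (by (lem (b * hev a b f) (b ^ⁿ length f * ev e f)) (homogenize a b e f z +ᶻ (b ^ⁿ length f *ᶻ zf)))
    where
    lem : ∀ x y → x - y + y ≡ x
    lem = solve-∀

  hev-nr : ∀ a b e f → Z p (b * e - a) → ¬ Z p b → T (shortOdd f) → NonRes (hev a b f) → NonRes (ev e f)
  hev-nr a b e f@(c ∷ []) z nb _ n = NonRes-resp (hev a b f) (ev e f) (≡⇒Z (lem a c e)) n
    where
    lem : ∀ a c e → c * 1ℤ + a * 0ℤ ≡ c + e * 0ℤ
    lem = solve-∀
  hev-nr a b e f@(_ ∷ _ ∷ _ ∷ []) z nb _ n = NonRes-square⁻ b (ev e f) (NonRes-resp (hev a b f) (b * b * ev e f)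
      (cancel b _ nb (by (lem b (hev a b f) (ev e f)) (homogenize a b e f z))) n)
    where
    lem : ∀ b h v → b * h - b * (b * (b * 1ℤ)) * v ≡ b * (h - b * b * v)
    lem = solve-∀

  all⁻ : ∀ {A : Set} (f : A → Bool) xs → T (all f xs) → All (T ∘ f) xs
  all⁻ f [] _ = []
  all⁻ f (x ∷ xs) t with f x in eq
  ... | true = subst T (sym eq) tt ∷ all⁻ f xs t

  candidate-sound : ∀ {sign} → Sound sign → ∀ c → T (signsOk sign c) → ¬ Z p (obstruction c) → ∃[ e ] All (Holds e) (wanted c)
  candidate-sound {sign} sound c ok nobs = e , go (wanted c) ok (λ z → nobs (b c *ᶻ z))
    where
    nb : ¬ Z p (b c)
    nb z = nobs (by (ℤ.*-comm rest (b c)) (rest *ᶻ z))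
      where
      rest : ℤ
      rest = nonvanishing (a c) (b c) (wanted c)
    e : ℤ
    e = a c * J (b c)
    lem : ∀ a b j → a * (b * j - 1ℤ) ≡ b * (a * j) - a
    lem = solve-∀
    ze : Z p (b c * e - a c)
    ze = by (lem (a c) (b c) (J (b c))) (a c *ᶻ J-inv (b c) nb)
    go : ∀ rs → T (signsOk sign (candidate rs (a c) (b c))) →
      ¬ Z p (nonvanishing (a c) (b c) rs) → All (Holds e) rs
    go [] _ _ = []
    go (nz f ∷ rs) t n = hev-nz (a c) (b c) e f ze nb (λ z → n (by (ℤ.*-comm (nonvanishing (a c) (b c) rs) (hev (a c) (b c) f)) (nonvanishing (a c) (b c) rs *ᶻ z))) ∷ go rs t (λ z → n (hev (a c) (b c) f *ᶻ z))
    go (nr f ∷ rs) t n with shortOdd f in odd | sign (hev (a c) (b c) f) in eq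
    ... | true | just false = hev-nr (a c) (b c) e f ze nb (subst T (sym odd) tt) (sound eq) ∷ go rs t n

  group-sound : ∀ {sign} → Sound sign → ∀ ds cs → All (λ d → ¬ p ℕ.∣ d) ds → T (groupOk sign ds cs) →
    ∃[ c ] c ∈ cs × ∃[ e ] All (Holds e) (wanted c)
  group-sound {sign} sound ds cs hd ok with Equivalence.to (T-∧ {all (signsOk sign) cs}) ok
  ... | signs , st with unobstructed cs (strip-sound 1000000 ds _ hd (ℕ.≡ᵇ⇒≡ _ 1 st))
  ...   | c , c∈ , n = c , c∈ , candidate-sound sound c (All.lookup (all⁻ (signsOk sign) cs signs) c∈) n

  covers-sound : ∀ s {e} → All (λ d → ¬ p ℕ.∣ d) (System.units s) → All (Holds e) (map nz (System.polys s) ++ map nr (System.discs s)) →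
    ∀ r → T (covers s r) → Holds e r
  covers-sound s {e} hu h (nz f) t with find (Any.any⁻ _ (System.polys s) t)
  ... | g , g∈ , t′ with Equivalence.to (T-∧ {isZero (f ⊖ ratio (lead f) (lead g) · g)}) t′
  ...   | eq , u = λ z → ¬Z-* {ratio (lead f) (lead g)} {ev e g} (λ zr → strip-sound 100 (System.units s) _ hu (ℕ.≡ᵇ⇒≡ _ 1 u) (∣⇒∣ᵤ zr))
            (All.lookup (All.++⁻ˡ (map nz (System.polys s)) h) (Any.map⁺ (Any.map (cong nz) g∈)))
            (by (trans (ev-isZero-⊖ e f (ratio (lead f) (lead g) · g) eq) (ev-· e (ratio (lead f) (lead g)) g)) z)
  covers-sound s {e} hu h (nr f) t with find (Any.any⁻ _ (System.discs s) t)
  ... | d , d∈ , t′ with find (Any.any⁻ _ squareRoots t′)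
  ...   | k , _ , t″ with Equivalence.to (T-∧ {isZero (f ⊖ (k * k) · d)}) t″
  ...     | eq , u = NonRes-resp (k * k * ev e d) (ev e f) (≡⇒Z (sym (trans (ev-isZero-⊖ e f ((k * k) · d) eq) (ev-· e (k * k) d))))
            (NonRes-square k (ev e d) (λ zr → strip-sound 100 (System.units s) _ hu (ℕ.≡ᵇ⇒≡ _ 1 u) (∣⇒∣ᵤ zr))
              (All.lookup (All.++⁻ʳ (map nz (System.polys s)) h) (Any.map⁺ (Any.map (cong nr) d∈))))

  Evidence : Known → Set
  Evidence (known m ds) = (∀ {s} → m ≡ just s → Sg s -1ℤ) × All (λ (d , s) → Sg s (+ d)) ds

  signℕ-sound : ∀ k ds n {s} → All (λ (d , s) → Sg s (+ d)) ds → signℕ k ds n ≡ just s → Sg s (+ n)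
  signℕ-sound (suc k) [] n h eq with n ≡ᵇ 1 in r
  signℕ-sound (suc k) [] n h refl | true = subst (λ m → Sg true (+ m)) (sym (ℕ.≡ᵇ⇒≡ n 1 (subst T (sym r) tt))) Sg-1
  signℕ-sound (suc k) ((suc d , s) ∷ ds) n (hd ∷ h) eq with (n ℕ.% suc d) ≡ᵇ 0 in r
  ... | false = signℕ-sound k ds n h eq
  ... | true with signℕ k ((suc d , s) ∷ ds) (n ℕ./ suc d) in r′
  signℕ-sound (suc k) ((suc d , s) ∷ ds) n (hd ∷ h) refl | true | just s′ =
    subst (Sg (xnor s s′)) (trans (sym (ℤ.pos-* (suc d) (n ℕ./ suc d))) (cong +_ (trans (ℕ.*-comm (suc d) (n ℕ./ suc d))
        (sym (trans (ℕ.m≡m%n+[m/n]*n n (suc d)) (cong (ℕ._+ (n ℕ./ suc d) ℕ.* suc d) (ℕ.≡ᵇ⇒≡ (n ℕ.% suc d) 0 (subst T (sym r) tt))))))))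
      (Sg-* s s′ (+ suc d) (+ (n ℕ./ suc d)) hd (signℕ-sound k ((suc d , s) ∷ ds) (n ℕ./ suc d) (hd ∷ h) r′))

  signℤ-sound : ∀ k → Evidence k → Sound (signℤ k)
  signℤ-sound k (hm , h) {+ n} eq = signℕ-sound 10000 (Known.primes k) n h eq
  signℤ-sound (known (just s) ds) (hm , h) { -[1+ n ]} eq with signℕ 10000 ds (suc n) in r
  signℤ-sound (known (just s) ds) (hm , h) { -[1+ n ]} refl | just s′ =
    subst (Sg (xnor s s′)) (ℤ.-1*i≡-i (+ suc n)) (Sg-* s s′ -1ℤ (+ suc n) (hm refl) (signℕ-sound 10000 ds (suc n) h r))

-- The case distinction on small quadratic characters

wantedOf : System → List Req
wantedOf s = map nz (System.polys s) ++ map nr (System.discs s)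

-- One parameter for three moduli. The modulus 2 gets its own in `separate`, since it alone among
-- these four asks for 1 - e to be a nonresidue.
wanted₃₅₇ : List Req
wanted₃₅₇ = wantedOf s₃ ++ wantedOf s₅ ++ wantedOf s₇

concrete : List (List ℤ) → Config
concrete cs = cyclic (map (map (λ c → c ∷ [])) cs)

fromPairs : List Req → List (ℤ × ℤ) → List Candidate
fromPairs w = map (λ (a , b) → candidate w a b)

isTrue : Maybe Bool → Bool
isTrue (just true) = true
isTrue _ = false

-- The bound 113 makes d invertible modulo p, so that both branches of a split yield a sign. The
-- concrete configurations have constant coefficients; 0 / 1 is a dummy parameter for them.
check : Known → Tree → Bool
check k@(known m ds) (split d t u) = (0 <ᵇ d) ∧ ((d <ᵇ 113) ∧ (check (known m ((d , true) ∷ ds)) t ∧ check (known m ((d , false) ∷ ds)) u))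
check (known _ ds) (splitNeg t u) = check (known (just true) ds) t ∧ check (known (just false) ds) u
check k (uniform es) = groupOk (signℤ k) smallPrimes (fromPairs (wantedOf s∀) es)
check k (separate cs es fs) = groupOk (signℤ k) smallPrimes (map (λ c → candidate (Requirements.reqs 1 (concrete c)) 0ℤ 1ℤ) cs)
  ∧ (groupOk (signℤ k) smallPrimes (fromPairs wanted₃₅₇ es) ∧ groupOk (signℤ k) smallPrimes (fromPairs (wantedOf s₂) fs))
check (known _ ds) smallResidues = all (λ n → isTrue (signℕ 10000 ds (suc n))) (upTo 42)

tree : Tree
tree =
  split 2
   (split 3
    (split 5
     (split 7
      (split 11
       (splitNeg
        (split 13
         (split 17
          (split 19
           (split 23
            (split 29
             (split 31
              (split 37
               (split 41
                -- All primes up to 41 are residues on this branch, and therefore all numbers up to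
                -- 42.
                smallResidues
                -- Now 41 is the least nonresidue. The first candidate is x = 1, y = 40, with x + y
                -- = 41, 9 x + y = 7² and x + 9 y = 19².
                (uniform ((-[1+ 0 ] , + 40) ∷ (-[1+ 2 ] , + 38) ∷ (-[1+ 9 ] , + 31) ∷ (-[1+ 17 ] , + 23) ∷ (-[1+ 6 ] , + 75) ∷ [])))
               (uniform ((-[1+ 0 ] , + 36) ∷ (-[1+ 5 ] , + 31) ∷ (-[1+ 9 ] , + 27) ∷ (-[1+ 28 ] , + 45) ∷ [])))
              (uniform ((-[1+ 2 ] , + 28) ∷ (-[1+ 3 ] , + 27) ∷ (-[1+ 12 ] , + 18) ∷ (-[1+ 28 ] , + 64) ∷ [])))
             (uniform ((-[1+ 1 ] , + 27) ∷ (-[1+ 4 ] , + 24) ∷ (-[1+ 11 ] , + 17) ∷ [])))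
            (uniform ((-[1+ 3 ] , + 19) ∷ (-[1+ 8 ] , + 14) ∷ (-[1+ 8 ] , + 175) ∷ (-[1+ 14 ] , + 169) ∷ [])))
           (uniform ((-[1+ 8 ] , + 10) ∷ (-[1+ 0 ] , + 75) ∷ (-[1+ 8 ] , + 143) ∷ [])))
          (split 19
           (uniform ((-[1+ 3 ] , + 13) ∷ (-[1+ 5 ] , + 11) ∷ (-[1+ 4 ] , + 63) ∷ (-[1+ 0 ] , + 135) ∷ []))
           (uniform ((-[1+ 3 ] , + 13) ∷ (-[1+ 5 ] , + 11) ∷ (-[1+ 4 ] , + 63) ∷ (-[1+ 8 ] , + 10) ∷ []))))
         (split 17
          (uniform ((-[1+ 4 ] , + 99) ∷ (-[1+ 26 ] , + 77) ∷ (-[1+ 76 ] , + 27) ∷ (-[1+ 3 ] , + 9) ∷ []))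
          (uniform ((-[1+ 4 ] , + 99) ∷ (-[1+ 26 ] , + 77) ∷ (-[1+ 76 ] , + 27) ∷ (-[1+ 6 ] , + 27) ∷ (-[1+ 26 ] , + 7) ∷ []))))
        (split 13
         (split 17
          (split 19
           (split 23
            (split 29
             (split 31
              (split 37
               (split 41
                smallResidues
                (uniform ((-[1+ 0 ] , + 40) ∷ (-[1+ 2 ] , + 38) ∷ (-[1+ 9 ] , + 31) ∷ (-[1+ 17 ] , + 23) ∷ (-[1+ 6 ] , + 75) ∷ [])))
               (uniform ((-[1+ 0 ] , + 36) ∷ (-[1+ 5 ] , + 31) ∷ (-[1+ 9 ] , + 27) ∷ (-[1+ 28 ] , + 45) ∷ [])))
              (uniform ((-[1+ 2 ] , + 28) ∷ (-[1+ 3 ] , + 27) ∷ (-[1+ 12 ] , + 18) ∷ (-[1+ 28 ] , + 64) ∷ [])))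
             (uniform ((-[1+ 1 ] , + 27) ∷ (-[1+ 4 ] , + 24) ∷ (-[1+ 11 ] , + 17) ∷ [])))
            (uniform ((-[1+ 3 ] , + 19) ∷ (-[1+ 8 ] , + 14) ∷ (-[1+ 8 ] , + 175) ∷ (-[1+ 14 ] , + 169) ∷ [])))
           (uniform ((-[1+ 8 ] , + 10) ∷ (-[1+ 0 ] , + 75) ∷ (-[1+ 8 ] , + 143) ∷ [])))
          (split 19
           (uniform ((-[1+ 3 ] , + 13) ∷ (-[1+ 5 ] , + 11) ∷ (-[1+ 4 ] , + 63) ∷ (-[1+ 0 ] , + 135) ∷ []))
           (uniform ((-[1+ 3 ] , + 13) ∷ (-[1+ 5 ] , + 11) ∷ (-[1+ 4 ] , + 63) ∷ (-[1+ 8 ] , + 10) ∷ []))))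
         -- The cycle 0, 1, 3 has the discriminants 52 = 4 · 13 and -32 = -2 · 16, and here 13 and
         -- -2 are nonresidues. For the other moduli, e = -12 and e = -1 / 12 make 1 - e equal to 13
         -- and 13 / 12.
         (separate (((+ 0 ∷ + 1 ∷ + 3 ∷ []) ∷ []) ∷ []) ((-[1+ 11 ] , + 1) ∷ []) ((-[1+ 0 ] , + 12) ∷ []))))
       (splitNeg
        (split 13
         (split 17
          (uniform ((-[1+ 2 ] , + 8) ∷ (-[1+ 38 ] , + 49) ∷ (-[1+ 48 ] , + 39) ∷ (-[1+ 16 ] , + 27) ∷ []))
          (uniform ((-[1+ 2 ] , + 8) ∷ (-[1+ 38 ] , + 49) ∷ (-[1+ 48 ] , + 39) ∷ (-[1+ 3 ] , + 13) ∷ [])))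
         (split 17
          (uniform ((-[1+ 2 ] , + 8) ∷ (-[1+ 3 ] , + 9) ∷ (-[1+ 8 ] , + 17) ∷ (-[1+ 2 ] , + 85) ∷ []))
          (uniform ((-[1+ 2 ] , + 8) ∷ (-[1+ 6 ] , + 27) ∷ (-[1+ 62 ] , + 5) ∷ []))))
        (split 13
         (separate (((+ 0 ∷ + 7 ∷ + 13 ∷ + 21 ∷ []) ∷ []) ∷ []) ((-[1+ 7 ] , + 3) ∷ (-[1+ 2 ] , + 8) ∷ []) ((-[1+ 0 ] , + 10) ∷ []))
         (separate (((+ 0 ∷ + 1 ∷ + 3 ∷ []) ∷ []) ∷ []) ((-[1+ 7 ] , + 3) ∷ (-[1+ 2 ] , + 8) ∷ []) ((-[1+ 0 ] , + 10) ∷ [])))))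
      (split 11
       (splitNeg
        (split 13
         (split 17
          (uniform ((-[1+ 0 ] , + 6) ∷ (-[1+ 5 ] , + 1) ∷ (-[1+ 10 ] , + 45) ∷ (-[1+ 7 ] , + 13) ∷ []))
          (uniform ((-[1+ 0 ] , + 6) ∷ (-[1+ 5 ] , + 1) ∷ (-[1+ 10 ] , + 45) ∷ (-[1+ 3 ] , + 13) ∷ [])))
         (split 17
          (uniform ((-[1+ 0 ] , + 6) ∷ (-[1+ 5 ] , + 1) ∷ (-[1+ 3 ] , + 9) ∷ []))
          (separate (((+ 0 ∷ + 1 ∷ + 14 ∷ + 3 ∷ []) ∷ []) ∷ ((+ 0 ∷ + 9 ∷ -[1+ 16 ] ∷ + 27 ∷ []) ∷ []) ∷ []) ((-[1+ 5 ] , + 1) ∷ []) ((-[1+ 0 ] , + 6) ∷ []))))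
        (split 13
         (split 17
          (uniform ((-[1+ 0 ] , + 6) ∷ (-[1+ 5 ] , + 1) ∷ (-[1+ 10 ] , + 45) ∷ (-[1+ 7 ] , + 13) ∷ []))
          (uniform ((-[1+ 0 ] , + 6) ∷ (-[1+ 5 ] , + 1) ∷ (-[1+ 10 ] , + 45) ∷ (-[1+ 3 ] , + 13) ∷ [])))
         (separate (((+ 0 ∷ + 1 ∷ + 3 ∷ []) ∷ []) ∷ []) ((-[1+ 5 ] , + 1) ∷ []) ((-[1+ 0 ] , + 6) ∷ []))))
       (splitNeg
        (split 13
         (split 17
          (uniform ((-[1+ 38 ] , + 49) ∷ (-[1+ 48 ] , + 39) ∷ (-[1+ 7 ] , + 13) ∷ (-[1+ 12 ] , + 8) ∷ (-[1+ 16 ] , + 27) ∷ []))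
          (split 19
           (uniform ((-[1+ 38 ] , + 49) ∷ (-[1+ 48 ] , + 39) ∷ (-[1+ 3 ] , + 13) ∷ (-[1+ 2 ] , + 25) ∷ (-[1+ 8 ] , + 19) ∷ []))
           (separate (((+ 0 ∷ + 12 ∷ + 1 ∷ + 36 ∷ []) ∷ []) ∷ ((+ 0 ∷ + 7 ∷ + 2 ∷ + 21 ∷ []) ∷ []) ∷ []) ((-[1+ 5 ] , + 1) ∷ []) ((-[1+ 0 ] , + 6) ∷ []))))
         (separate (((+ 0 ∷ + 7 ∷ + 13 ∷ + 21 ∷ []) ∷ []) ∷ []) ((-[1+ 5 ] , + 1) ∷ []) ((-[1+ 0 ] , + 6) ∷ [])))
        (split 13
         (split 17
          (uniform ((-[1+ 38 ] , + 49) ∷ (-[1+ 48 ] , + 39) ∷ (-[1+ 7 ] , + 13) ∷ (-[1+ 12 ] , + 8) ∷ (-[1+ 16 ] , + 27) ∷ []))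
          (separate (((+ 0 ∷ + 35 ∷ + 27 ∷ + 105 ∷ []) ∷ []) ∷ ((+ 0 ∷ + 2 ∷ + 10 ∷ + 3 ∷ []) ∷ []) ∷ []) ((-[1+ 5 ] , + 1) ∷ []) ((-[1+ 0 ] , + 6) ∷ [])))
         (separate (((+ 0 ∷ + 1 ∷ + 3 ∷ []) ∷ []) ∷ []) ((-[1+ 5 ] , + 1) ∷ []) ((-[1+ 0 ] , + 6) ∷ []))))))
     (split 7
      (split 11
       (splitNeg
        (split 13
         (uniform ((-[1+ 0 ] , + 39) ∷ (-[1+ 12 ] , + 27) ∷ (-[1+ 38 ] , + 1) ∷ []))
         (separate (((+ 0 ∷ + 2 ∷ -[1+ 77 ] ∷ + 3 ∷ []) ∷ []) ∷ ((+ 0 ∷ + 18 ∷ -[1+ 51 ] ∷ -[1+ 116 ] ∷ + 27 ∷ []) ∷ []) ∷ []) ((-[1+ 8 ] , + 11) ∷ []) ((-[1+ 0 ] , + 4) ∷ [])))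
        (split 13
         (uniform ((-[1+ 0 ] , + 39) ∷ (-[1+ 12 ] , + 27) ∷ (-[1+ 38 ] , + 1) ∷ []))
         (separate (((+ 0 ∷ + 1 ∷ + 3 ∷ []) ∷ []) ∷ []) ((-[1+ 8 ] , + 11) ∷ []) ((-[1+ 0 ] , + 4) ∷ []))))
       (splitNeg
        (split 13
         (separate (((+ 0 ∷ + 9 ∷ -[1+ 12 ] ∷ + 27 ∷ []) ∷ []) ∷ ((+ 0 ∷ + 27 ∷ + 297 ∷ + 243 ∷ []) ∷ (+ 81 ∷ -[1+ 8 ] ∷ + 1 ∷ []) ∷ []) ∷ []) ((-[1+ 8 ] , + 11) ∷ []) ((-[1+ 0 ] , + 4) ∷ []))
         (separate (((+ 0 ∷ + 9 ∷ -[1+ 10 ] ∷ + 1 ∷ + 27 ∷ []) ∷ []) ∷ ((+ 0 ∷ + 99 ∷ -[1+ 8 ] ∷ + 11 ∷ + 297 ∷ []) ∷ []) ∷ ((+ 0 ∷ + 315 ∷ -[1+ 8 ] ∷ + 35 ∷ + 945 ∷ []) ∷ []) ∷ []) ((-[1+ 8 ] , + 11) ∷ []) ((-[1+ 0 ] , + 4) ∷ [])))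
        (split 13
         (separate (((+ 0 ∷ + 9 ∷ -[1+ 12 ] ∷ + 27 ∷ []) ∷ []) ∷ ((+ 0 ∷ + 240 ∷ -[1+ 207 ] ∷ -[1+ 1039 ] ∷ + 2160 ∷ []) ∷ (+ 720 ∷ + 45 ∷ + 180 ∷ []) ∷ []) ∷ []) ((-[1+ 8 ] , + 11) ∷ []) ((-[1+ 0 ] , + 4) ∷ []))
         (separate (((+ 0 ∷ + 1 ∷ + 3 ∷ []) ∷ []) ∷ []) ((-[1+ 8 ] , + 11) ∷ []) ((-[1+ 0 ] , + 4) ∷ [])))))
      (split 11
       (splitNeg
        (split 13
         (uniform ((-[1+ 0 ] , + 39) ∷ (-[1+ 12 ] , + 27) ∷ (-[1+ 38 ] , + 1) ∷ []))
         (separate (((+ 0 ∷ + 27 ∷ + 1 ∷ + 81 ∷ []) ∷ []) ∷ ((+ 0 ∷ + 45 ∷ -[1+ 8 ] ∷ + 5 ∷ + 135 ∷ []) ∷ []) ∷ []) ((-[1+ 8 ] , + 11) ∷ []) ((-[1+ 0 ] , + 4) ∷ [])))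
        (separate (((+ 0 ∷ + 15 ∷ + 3 ∷ + 5 ∷ + 45 ∷ []) ∷ []) ∷ []) ((-[1+ 8 ] , + 11) ∷ []) ((-[1+ 0 ] , + 4) ∷ [])))
       (splitNeg
        (separate (((+ 0 ∷ + 1 ∷ -[1+ 5 ] ∷ + 36 ∷ + 3 ∷ []) ∷ []) ∷ ((+ 0 ∷ + 3 ∷ -[1+ 17 ] ∷ + 4 ∷ + 9 ∷ []) ∷ []) ∷ []) ((-[1+ 8 ] , + 11) ∷ []) ((-[1+ 0 ] , + 4) ∷ []))
        (separate (((+ 0 ∷ + 1 ∷ -[1+ 5 ] ∷ + 36 ∷ + 3 ∷ []) ∷ []) ∷ ((+ 0 ∷ + 2 ∷ -[1+ 11 ] ∷ -[1+ 0 ] ∷ + 6 ∷ []) ∷ []) ∷ ((+ 0 ∷ + 7 ∷ -[1+ 41 ] ∷ + 54 ∷ + 21 ∷ []) ∷ []) ∷ []) ((-[1+ 8 ] , + 11) ∷ []) ((-[1+ 0 ] , + 4) ∷ []))))))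
    (split 5
     (split 7
      (split 11
       (splitNeg
        (split 13
         (uniform ((-[1+ 0 ] , + 11) ∷ (-[1+ 10 ] , + 1) ∷ (-[1+ 10 ] , + 13) ∷ []))
         (uniform ((-[1+ 0 ] , + 11) ∷ (-[1+ 10 ] , + 1) ∷ (-[1+ 4 ] , + 99) ∷ [])))
        (split 13
         (uniform ((-[1+ 0 ] , + 11) ∷ (-[1+ 10 ] , + 1) ∷ (-[1+ 10 ] , + 13) ∷ []))
         (uniform ((-[1+ 0 ] , + 11) ∷ (-[1+ 10 ] , + 1) ∷ (-[1+ 4 ] , + 99) ∷ []))))
       (splitNeg
        (split 13
         (separate (((+ 0 ∷ + 1 ∷ + 25 ∷ + 3 ∷ []) ∷ []) ∷ ((+ 0 ∷ + 27 ∷ -[1+ 116 ] ∷ + 169 ∷ + 81 ∷ []) ∷ []) ∷ []) ((-[1+ 2 ] , + 1) ∷ []) ((-[1+ 0 ] , + 2) ∷ []))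
         (separate (((+ 0 ∷ + 1 ∷ + 25 ∷ + 3 ∷ []) ∷ []) ∷ ((+ 0 ∷ + 9 ∷ -[1+ 14 ] ∷ + 1 ∷ + 27 ∷ []) ∷ []) ∷ []) ((-[1+ 2 ] , + 1) ∷ []) ((-[1+ 0 ] , + 2) ∷ [])))
        (separate (((+ 0 ∷ + 3 ∷ -[1+ 0 ] ∷ + 11 ∷ + 9 ∷ []) ∷ []) ∷ []) ((-[1+ 2 ] , + 1) ∷ []) ((-[1+ 0 ] , + 2) ∷ []))))
      (split 11
       (separate (((+ 0 ∷ + 2 ∷ -[1+ 0 ] ∷ + 6 ∷ []) ∷ []) ∷ []) ((-[1+ 2 ] , + 1) ∷ []) ((-[1+ 0 ] , + 2) ∷ []))
       (splitNeg
        (separate (((+ 0 ∷ + 3 ∷ + 11 ∷ + 9 ∷ []) ∷ []) ∷ []) ((-[1+ 2 ] , + 1) ∷ []) ((-[1+ 0 ] , + 2) ∷ []))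
        (split 13
         (separate (((+ 0 ∷ + 9 ∷ -[1+ 14 ] ∷ + 1 ∷ + 81 ∷ []) ∷ (+ 27 ∷ -[1+ 296 ] ∷ + 99 ∷ []) ∷ []) ∷ ((+ 0 ∷ + 1 ∷ -[1+ 10 ] ∷ + 121 ∷ + 9 ∷ []) ∷ (+ 3 ∷ + 15 ∷ -[1+ 24 ] ∷ []) ∷ []) ∷ ((+ 0 ∷ + 7 ∷ -[1+ 76 ] ∷ + 99 ∷ + 63 ∷ []) ∷ (+ 21 ∷ -[1+ 34 ] ∷ + 385 ∷ []) ∷ []) ∷ ((+ 0 ∷ + 45 ∷ -[1+ 194 ] ∷ + 845 ∷ + 405 ∷ []) ∷ (+ 135 ∷ + 675 ∷ + 27 ∷ []) ∷ []) ∷ ((+ 0 ∷ + 45 ∷ -[1+ 10 ] ∷ + 5 ∷ + 405 ∷ []) ∷ (+ 135 ∷ -[1+ 1484 ] ∷ -[1+ 404 ] ∷ []) ∷ []) ∷ []) ((-[1+ 2 ] , + 1) ∷ []) ((-[1+ 0 ] , + 2) ∷ []))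
         (separate (((+ 0 ∷ + 1 ∷ + 3 ∷ []) ∷ []) ∷ []) ((-[1+ 2 ] , + 1) ∷ []) ((-[1+ 0 ] , + 2) ∷ []))))))
     (split 7
      (split 11
       (splitNeg
        (separate (((+ 0 ∷ + 6 ∷ -[1+ 2 ] ∷ + 8 ∷ + 18 ∷ []) ∷ []) ∷ ((+ 0 ∷ + 3 ∷ -[1+ 7 ] ∷ + 4 ∷ + 9 ∷ []) ∷ []) ∷ []) ((-[1+ 2 ] , + 1) ∷ []) ((-[1+ 0 ] , + 2) ∷ []))
        (separate (((+ 0 ∷ + 6 ∷ -[1+ 1 ] ∷ + 1 ∷ + 9 ∷ []) ∷ []) ∷ []) ((-[1+ 2 ] , + 1) ∷ []) ((-[1+ 0 ] , + 2) ∷ [])))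
       (splitNeg
        (separate (((+ 0 ∷ + 3 ∷ + 11 ∷ + 9 ∷ []) ∷ []) ∷ []) ((-[1+ 2 ] , + 1) ∷ []) ((-[1+ 0 ] , + 2) ∷ []))
        (separate (((+ 0 ∷ + 11 ∷ + 99 ∷ + 27 ∷ + 33 ∷ []) ∷ []) ∷ []) ((-[1+ 2 ] , + 1) ∷ []) ((-[1+ 0 ] , + 2) ∷ []))))
      (split 11
       (splitNeg
        (split 13
         (separate (((+ 0 ∷ + 1 ∷ -[1+ 38 ] ∷ + 3 ∷ []) ∷ []) ∷ ((+ 0 ∷ + 2 ∷ -[1+ 77 ] ∷ + 3 ∷ []) ∷ []) ∷ []) ((-[1+ 2 ] , + 1) ∷ []) ((-[1+ 0 ] , + 2) ∷ []))
         (separate (((+ 0 ∷ + 27 ∷ -[1+ 8 ] ∷ + 1 ∷ + 81 ∷ []) ∷ []) ∷ ((+ 0 ∷ + 27 ∷ -[1+ 2 ] ∷ + 1 ∷ + 81 ∷ []) ∷ []) ∷ ((+ 0 ∷ + 2 ∷ -[1+ 0 ] ∷ + 39 ∷ + 6 ∷ []) ∷ []) ∷ []) ((-[1+ 2 ] , + 1) ∷ []) ((-[1+ 0 ] , + 2) ∷ [])))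
        (separate (((+ 0 ∷ + 6 ∷ -[1+ 1 ] ∷ + 1 ∷ + 9 ∷ []) ∷ []) ∷ []) ((-[1+ 2 ] , + 1) ∷ []) ((-[1+ 0 ] , + 2) ∷ [])))
       (splitNeg
        (separate (((+ 0 ∷ + 1 ∷ -[1+ 10 ] ∷ + 5 ∷ + 3 ∷ []) ∷ []) ∷ []) ((-[1+ 2 ] , + 1) ∷ []) ((-[1+ 0 ] , + 2) ∷ []))
        (separate (((+ 0 ∷ + 3 ∷ -[1+ 0 ] ∷ + 11 ∷ + 9 ∷ []) ∷ []) ∷ []) ((-[1+ 2 ] , + 1) ∷ []) ((-[1+ 0 ] , + 2) ∷ [])))))))
   (split 3
    (split 5
     (split 7
      (split 11
       (splitNeg
        (split 13
         (split 17
          (uniform ((-[1+ 12 ] , + 27) ∷ (-[1+ 26 ] , + 13) ∷ (-[1+ 26 ] , + 77) ∷ (-[1+ 2 ] , + 85) ∷ []))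
          (uniform ((-[1+ 12 ] , + 27) ∷ (-[1+ 26 ] , + 13) ∷ (-[1+ 26 ] , + 77) ∷ (-[1+ 3 ] , + 13) ∷ [])))
         (separate (((+ 0 ∷ + 1 ∷ + 3 ∷ []) ∷ []) ∷ []) ((-[1+ 0 ] , + 7) ∷ (-[1+ 2 ] , + 5) ∷ []) ((-[1+ 0 ] , + 1) ∷ [])))
        (split 13
         (split 17
          (uniform ((-[1+ 12 ] , + 27) ∷ (-[1+ 26 ] , + 13) ∷ (-[1+ 26 ] , + 77) ∷ (-[1+ 2 ] , + 85) ∷ []))
          (uniform ((-[1+ 12 ] , + 27) ∷ (-[1+ 26 ] , + 13) ∷ (-[1+ 26 ] , + 77) ∷ (-[1+ 3 ] , + 13) ∷ [])))
         (separate (((+ 0 ∷ + 81 ∷ -[1+ 38 ] ∷ -[1+ 12 ] ∷ + 243 ∷ []) ∷ []) ∷ ((+ 0 ∷ + 9 ∷ + 7 ∷ + 1 ∷ + 27 ∷ []) ∷ []) ∷ []) ((-[1+ 0 ] , + 7) ∷ (-[1+ 2 ] , + 5) ∷ []) ((-[1+ 0 ] , + 1) ∷ []))))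
       (splitNeg
        (separate (((+ 0 ∷ + 21 ∷ -[1+ 2 ] ∷ + 7 ∷ + 63 ∷ []) ∷ []) ∷ ((+ 0 ∷ + 7 ∷ -[1+ 0 ] ∷ -[1+ 8 ] ∷ + 21 ∷ []) ∷ []) ∷ []) ((-[1+ 0 ] , + 7) ∷ (-[1+ 2 ] , + 5) ∷ []) ((-[1+ 0 ] , + 1) ∷ []))
        (separate (((+ 0 ∷ + 3 ∷ -[1+ 20 ] ∷ + 49 ∷ + 9 ∷ []) ∷ []) ∷ ((+ 0 ∷ + 6 ∷ -[1+ 2 ] ∷ + 8 ∷ + 18 ∷ []) ∷ []) ∷ []) ((-[1+ 0 ] , + 7) ∷ (-[1+ 2 ] , + 5) ∷ []) ((-[1+ 0 ] , + 1) ∷ []))))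
      (split 11
       (splitNeg
        (separate (((+ 0 ∷ + 15 ∷ -[1+ 2 ] ∷ + 5 ∷ + 45 ∷ []) ∷ []) ∷ []) ((-[1+ 0 ] , + 7) ∷ (-[1+ 2 ] , + 5) ∷ []) ((-[1+ 0 ] , + 1) ∷ []))
        (separate (((+ 0 ∷ + 7 ∷ -[1+ 41 ] ∷ + 54 ∷ + 21 ∷ []) ∷ []) ∷ ((+ 0 ∷ + 7 ∷ -[1+ 8 ] ∷ + 54 ∷ + 21 ∷ []) ∷ []) ∷ ((+ 0 ∷ + 2 ∷ -[1+ 13 ] ∷ + 18 ∷ + 3 ∷ []) ∷ []) ∷ []) ((-[1+ 0 ] , + 7) ∷ (-[1+ 2 ] , + 5) ∷ []) ((-[1+ 0 ] , + 1) ∷ [])))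
       (splitNeg
        (separate (((+ 0 ∷ + 3 ∷ -[1+ 20 ] ∷ + 1 ∷ + 9 ∷ []) ∷ []) ∷ ((+ 0 ∷ + 15 ∷ -[1+ 2 ] ∷ + 5 ∷ + 45 ∷ []) ∷ []) ∷ []) ((-[1+ 0 ] , + 7) ∷ (-[1+ 2 ] , + 5) ∷ []) ((-[1+ 0 ] , + 1) ∷ []))
        (separate (((+ 0 ∷ + 3 ∷ -[1+ 20 ] ∷ + 49 ∷ + 9 ∷ []) ∷ []) ∷ ((+ 0 ∷ + 3 ∷ -[1+ 6 ] ∷ + 49 ∷ + 9 ∷ []) ∷ []) ∷ ((+ 0 ∷ + 27 ∷ -[1+ 62 ] ∷ + 25 ∷ + 81 ∷ []) ∷ []) ∷ []) ((-[1+ 0 ] , + 7) ∷ (-[1+ 2 ] , + 5) ∷ []) ((-[1+ 0 ] , + 1) ∷ [])))))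
     (split 7
      (split 11
       (splitNeg
        (separate (((+ 0 ∷ + 3 ∷ -[1+ 20 ] ∷ + 11 ∷ + 9 ∷ []) ∷ []) ∷ ((+ 0 ∷ + 21 ∷ -[1+ 10 ] ∷ + 77 ∷ + 63 ∷ []) ∷ []) ∷ []) ((-[1+ 0 ] , + 7) ∷ (-[1+ 2 ] , + 5) ∷ []) ((-[1+ 0 ] , + 1) ∷ []))
        (separate (((+ 0 ∷ + 8 ∷ -[1+ 7 ] ∷ + 3 ∷ + 12 ∷ []) ∷ []) ∷ []) ((-[1+ 0 ] , + 7) ∷ (-[1+ 2 ] , + 5) ∷ []) ((-[1+ 0 ] , + 1) ∷ [])))
       (splitNeg
        (split 13
         (split 17
          (uniform ((-[1+ 4 ] , + 11) ∷ (-[1+ 10 ] , + 5) ∷ (-[1+ 5 ] , + 11) ∷ (-[1+ 6 ] , + 27) ∷ []))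
          (split 19
           (uniform ((-[1+ 4 ] , + 11) ∷ (-[1+ 10 ] , + 5) ∷ (-[1+ 3 ] , + 13) ∷ (-[1+ 9 ] , + 1) ∷ []))
           (uniform ((-[1+ 4 ] , + 11) ∷ (-[1+ 10 ] , + 5) ∷ (-[1+ 3 ] , + 13) ∷ (-[1+ 0 ] , + 75) ∷ []))))
         (separate (((+ 0 ∷ + 1 ∷ + 3 ∷ []) ∷ []) ∷ []) ((-[1+ 0 ] , + 7) ∷ (-[1+ 2 ] , + 5) ∷ []) ((-[1+ 0 ] , + 1) ∷ [])))
        (split 13
         (split 17
          (uniform ((-[1+ 4 ] , + 11) ∷ (-[1+ 10 ] , + 5) ∷ (-[1+ 5 ] , + 11) ∷ (-[1+ 6 ] , + 27) ∷ []))
          (split 19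
           (uniform ((-[1+ 4 ] , + 11) ∷ (-[1+ 10 ] , + 5) ∷ (-[1+ 3 ] , + 13) ∷ (-[1+ 9 ] , + 1) ∷ []))
           (uniform ((-[1+ 4 ] , + 11) ∷ (-[1+ 10 ] , + 5) ∷ (-[1+ 3 ] , + 13) ∷ (-[1+ 0 ] , + 75) ∷ []))))
         (separate (((+ 0 ∷ + 9 ∷ -[1+ 14 ] ∷ + 1 ∷ + 27 ∷ []) ∷ []) ∷ ((+ 0 ∷ + 33 ∷ -[1+ 54 ] ∷ -[1+ 4 ] ∷ + 99 ∷ []) ∷ []) ∷ []) ((-[1+ 0 ] , + 7) ∷ (-[1+ 2 ] , + 5) ∷ []) ((-[1+ 0 ] , + 1) ∷ [])))))
      (split 11
       (splitNeg
        (separate (((+ 0 ∷ + 1 ∷ -[1+ 0 ] ∷ + 7 ∷ + 3 ∷ []) ∷ []) ∷ []) ((-[1+ 0 ] , + 7) ∷ (-[1+ 2 ] , + 5) ∷ []) ((-[1+ 0 ] , + 1) ∷ []))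
        (separate (((+ 0 ∷ + 3 ∷ -[1+ 20 ] ∷ -[1+ 6 ] ∷ + 9 ∷ []) ∷ []) ∷ []) ((-[1+ 0 ] , + 7) ∷ (-[1+ 2 ] , + 5) ∷ []) ((-[1+ 0 ] , + 1) ∷ [])))
       (separate (((+ 0 ∷ + 2 ∷ -[1+ 0 ] ∷ + 6 ∷ []) ∷ []) ∷ []) ((-[1+ 0 ] , + 7) ∷ (-[1+ 2 ] , + 5) ∷ []) ((-[1+ 0 ] , + 1) ∷ [])))))
    (split 5
     (split 7
      (split 11
       (splitNeg
        (separate (((+ 0 ∷ + 12 ∷ + 1 ∷ + 4 ∷ + 36 ∷ []) ∷ []) ∷ ((+ 0 ∷ + 12 ∷ + 1 ∷ + 9 ∷ + 36 ∷ []) ∷ []) ∷ []) ((-[1+ 0 ] , + 7) ∷ (-[1+ 2 ] , + 1) ∷ []) ((-[1+ 0 ] , + 1) ∷ []))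
        (separate (((+ 0 ∷ + 3 ∷ + 11 ∷ + 9 ∷ []) ∷ []) ∷ []) ((-[1+ 0 ] , + 7) ∷ (-[1+ 2 ] , + 1) ∷ []) ((-[1+ 0 ] , + 1) ∷ [])))
       (splitNeg
        (separate (((+ 0 ∷ + 1 ∷ -[1+ 10 ] ∷ + 5 ∷ + 3 ∷ []) ∷ []) ∷ []) ((-[1+ 0 ] , + 7) ∷ (-[1+ 2 ] , + 1) ∷ []) ((-[1+ 0 ] , + 1) ∷ []))
        (separate (((+ 0 ∷ + 3 ∷ -[1+ 20 ] ∷ + 147 ∷ + 27 ∷ []) ∷ (+ 9 ∷ -[1+ 5 ] ∷ + 4 ∷ []) ∷ []) ∷ ((+ 0 ∷ + 400 ∷ + 900 ∷ + 2025 ∷ + 3600 ∷ []) ∷ (+ 1200 ∷ -[1+ 335 ] ∷ -[1+ 8399 ] ∷ []) ∷ []) ∷ ((+ 0 ∷ + 4 ∷ + 9 ∷ + 16 ∷ + 36 ∷ []) ∷ (+ 12 ∷ -[1+ 7 ] ∷ -[1+ 17 ] ∷ []) ∷ []) ∷ []) ((-[1+ 0 ] , + 7) ∷ (-[1+ 2 ] , + 1) ∷ []) ((-[1+ 0 ] , + 1) ∷ []))))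
      (split 11
       (uniform ((-[1+ 2 ] , + 8) ∷ (-[1+ 0 ] , + 11) ∷ (-[1+ 10 ] , + 1) ∷ []))
       (splitNeg
        (separate (((+ 0 ∷ + 49 ∷ + 5 ∷ + 3 ∷ + 147 ∷ []) ∷ []) ∷ ((+ 0 ∷ + 6 ∷ + 3 ∷ + 2 ∷ + 18 ∷ []) ∷ []) ∷ []) ((-[1+ 0 ] , + 7) ∷ (-[1+ 2 ] , + 1) ∷ []) ((-[1+ 0 ] , + 1) ∷ []))
        (separate (((+ 0 ∷ + 1 ∷ -[1+ 6 ] ∷ + 49 ∷ + 9 ∷ []) ∷ (+ 3 ∷ -[1+ 20 ] ∷ + 7 ∷ []) ∷ []) ∷ ((+ 0 ∷ + 63 ∷ -[1+ 440 ] ∷ + 175 ∷ + 567 ∷ []) ∷ (+ 189 ∷ -[1+ 62 ] ∷ -[1+ 26 ] ∷ []) ∷ []) ∷ []) ((-[1+ 0 ] , + 7) ∷ (-[1+ 2 ] , + 1) ∷ []) ((-[1+ 0 ] , + 1) ∷ [])))))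
     (split 7
      (split 11
       (splitNeg
        (separate (((+ 0 ∷ + 3 ∷ -[1+ 0 ] ∷ + 11 ∷ + 9 ∷ []) ∷ []) ∷ []) ((-[1+ 0 ] , + 7) ∷ (-[1+ 2 ] , + 1) ∷ []) ((-[1+ 0 ] , + 1) ∷ []))
        (split 13
         (separate (((+ 0 ∷ + 1 ∷ + 25 ∷ + 3 ∷ []) ∷ []) ∷ ((+ 0 ∷ + 1 ∷ + 14 ∷ + 3 ∷ []) ∷ []) ∷ []) ((-[1+ 0 ] , + 7) ∷ (-[1+ 2 ] , + 1) ∷ []) ((-[1+ 0 ] , + 1) ∷ []))
         (separate (((+ 0 ∷ + 1 ∷ + 25 ∷ + 3 ∷ []) ∷ []) ∷ ((+ 0 ∷ + 45 ∷ -[1+ 8 ] ∷ + 5 ∷ + 135 ∷ []) ∷ []) ∷ []) ((-[1+ 0 ] , + 7) ∷ (-[1+ 2 ] , + 1) ∷ []) ((-[1+ 0 ] , + 1) ∷ []))))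
       (splitNeg
        (split 13
         (split 17
          (separate (((+ 0 ∷ + 18 ∷ + 22 ∷ + 27 ∷ []) ∷ []) ∷ []) ((-[1+ 0 ] , + 7) ∷ (-[1+ 2 ] , + 1) ∷ []) ((-[1+ 0 ] , + 1) ∷ []))
          (split 19
           (uniform ((-[1+ 4 ] , + 11) ∷ (-[1+ 10 ] , + 5) ∷ (-[1+ 3 ] , + 13) ∷ (-[1+ 9 ] , + 1) ∷ []))
           (separate (((+ 0 ∷ + 25 ∷ -[1+ 0 ] ∷ + 75 ∷ []) ∷ []) ∷ ((+ 0 ∷ + 17 ∷ -[1+ 24 ] ∷ + 51 ∷ []) ∷ []) ∷ []) ((-[1+ 0 ] , + 7) ∷ (-[1+ 2 ] , + 1) ∷ []) ((-[1+ 0 ] , + 1) ∷ []))))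
         (separate (((+ 0 ∷ + 1 ∷ + 3 ∷ []) ∷ []) ∷ []) ((-[1+ 0 ] , + 7) ∷ (-[1+ 2 ] , + 1) ∷ []) ((-[1+ 0 ] , + 1) ∷ [])))
        (split 13
         (split 17
          (separate (((+ 0 ∷ + 3 ∷ -[1+ 32 ] ∷ + 77 ∷ + 9 ∷ []) ∷ []) ∷ ((+ 0 ∷ + 3 ∷ -[1+ 6 ] ∷ + 77 ∷ + 9 ∷ []) ∷ []) ∷ ((+ 0 ∷ + 21 ∷ -[1+ 48 ] ∷ -[1+ 4 ] ∷ + 63 ∷ []) ∷ []) ∷ []) ((-[1+ 0 ] , + 7) ∷ (-[1+ 2 ] , + 1) ∷ []) ((-[1+ 0 ] , + 1) ∷ []))
          (split 19
           (uniform ((-[1+ 4 ] , + 11) ∷ (-[1+ 10 ] , + 5) ∷ (-[1+ 3 ] , + 13) ∷ (-[1+ 9 ] , + 1) ∷ []))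
           (separate (((+ 0 ∷ + 7 ∷ + 2 ∷ + 21 ∷ []) ∷ []) ∷ []) ((-[1+ 0 ] , + 7) ∷ (-[1+ 2 ] , + 1) ∷ []) ((-[1+ 0 ] , + 1) ∷ []))))
         (separate (((+ 0 ∷ + 45 ∷ -[1+ 8 ] ∷ + 5 ∷ + 135 ∷ []) ∷ []) ∷ ((+ 0 ∷ + 9 ∷ -[1+ 4 ] ∷ + 1 ∷ + 27 ∷ []) ∷ []) ∷ []) ((-[1+ 0 ] , + 7) ∷ (-[1+ 2 ] , + 1) ∷ []) ((-[1+ 0 ] , + 1) ∷ [])))))
      (split 11
       (splitNeg
        (separate (((+ 0 ∷ + 1 ∷ -[1+ 0 ] ∷ + 7 ∷ + 3 ∷ []) ∷ []) ∷ []) ((-[1+ 0 ] , + 7) ∷ (-[1+ 2 ] , + 1) ∷ []) ((-[1+ 0 ] , + 1) ∷ []))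
        (separate (((+ 0 ∷ + 3 ∷ + 11 ∷ + 9 ∷ []) ∷ []) ∷ []) ((-[1+ 0 ] , + 7) ∷ (-[1+ 2 ] , + 1) ∷ []) ((-[1+ 0 ] , + 1) ∷ [])))
       (splitNeg
        (separate (((+ 0 ∷ + 1 ∷ -[1+ 0 ] ∷ + 7 ∷ + 3 ∷ []) ∷ []) ∷ []) ((-[1+ 0 ] , + 7) ∷ (-[1+ 2 ] , + 1) ∷ []) ((-[1+ 0 ] , + 1) ∷ []))
        (separate (((+ 0 ∷ + 27 ∷ -[1+ 62 ] ∷ + 25 ∷ + 81 ∷ []) ∷ []) ∷ ((+ 0 ∷ + 189 ∷ -[1+ 74 ] ∷ + 175 ∷ + 567 ∷ []) ∷ []) ∷ ((+ 0 ∷ + 2 ∷ -[1+ 1 ] ∷ + 12 ∷ + 3 ∷ []) ∷ []) ∷ []) ((-[1+ 0 ] , + 7) ∷ (-[1+ 2 ] , + 1) ∷ []) ((-[1+ 0 ] , + 1) ∷ [])))))))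

tree-ok : check (known nothing []) tree ≡ true
tree-ok = refl

-- Tabulation by the least nonresidue N

allFrom : (ℕ → Bool) → ℕ → ℕ → Bool
allFrom f zero n = true
allFrom f (suc k) n = f n ∧ allFrom f k (suc n)

∧-true : ∀ a b → a ∧ b ≡ true → a ≡ true × b ≡ true
∧-true true true _ = refl , refl

allFrom⁻ : ∀ f k n m → allFrom f k n ≡ true → n ℕ.≤ m → m ℕ.< n ℕ.+ k → f m ≡ true
allFrom⁻ f zero n m _ n≤m m<n = contradiction n≤m (ℕ.<⇒≱ (subst (m ℕ.<_) (ℕ.+-identityʳ n) m<n))
allFrom⁻ f (suc k) n m eq n≤m m<n =
  [ (λ n<m → allFrom⁻ f k (suc n) m (proj₂ both) n<m (subst (m ℕ.<_) (ℕ.+-suc n k) m<n)) , (λ n≡m → subst (λ i → f i ≡ true) n≡m (proj₁ both)) ]′ (ℕ.m≤n⇒m<n∨m≡n n≤m)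
  where
  both : f n ≡ true × allFrom f k (suc n) ≡ true
  both = ∧-true (f n) (allFrom f k (suc n)) eq

-- Is m a product of numbers in [1 , N)?
splits : ℕ → ℕ → List ℕ → ℕ → Bool
splits zero N ds m = false
splits (suc k) N ds zero = false
splits (suc k) N ds m@(suc _) with m <ᵇ N | ds
... | true | _ = true
... | false | [] = false
... | false | zero ∷ ds′ = false
... | false | d@(suc _) ∷ ds′ = if (m ℕ.% d) ≡ᵇ 0 then (d <ᵇ N) ∧ splits k N ds (m ℕ./ d) else splits k N ds′ m

-- The signs that can be read off when N is the least nonresidue: products of numbers below N are
-- residues, and N times such a product is a nonresidue.
signBelow : ℕ → List ℕ → ℕ → ℤ → Maybe Bool
signBelow k ds zero _ = nothing
signBelow k ds N -[1+ n ] = nothing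
signBelow k ds N@(suc _) (+ n) =
  if (n ℕ.% N) ≡ᵇ 0
  then (if splits k N ds (n ℕ./ N) then just false else nothing)
  else (if splits k N ds n then just true else nothing)

-- e = -x / y with x + y = N, so that 1 - e = N / y.
candidatesFor : ℕ → List Candidate
candidatesFor N = map (λ y → candidate (wantedOf s∀) (- (+ (N ℕ.∸ suc y))) (+ suc y))
  (filterᵇ (λ y → splits 100 N smallPrimes (N ℕ.+ 8 ℕ.* suc y) ∧ splits 100 N smallPrimes (9 ℕ.* N ℕ.∸ 8 ℕ.* suc y)) (upTo (N ℕ.∸ 1)))

properDivisor : ℕ → ℕ → Bool
properDivisor N zero = false
properDivisor N d@(suc _) = (1 <ᵇ d) ∧ ((d <ᵇ N) ∧ ((N ℕ.% d) ≡ᵇ 0))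

groupsOk : ℕ → ℕ → Bool
groupsOk N k = groupOk (signBelow 100 smallPrimes N) (N ∷ smallPrimes) (take k (candidatesFor N))

-- A least nonresidue is prime, so N with a proper divisor can be dismissed. For the others the
-- obstructions of nine candidates are tried before those of twenty.
leastOk : ℕ → Bool
leastOk N = any (properDivisor N) smallPrimes ∨ any (groupsOk N) (9 ∷ 20 ∷ [])

degree : Poly → ℕ
degree f = List.length f ℕ.∸ 1

-- A coefficient composed of invertible primes keeps the polynomial from vanishing identically
-- modulo p, so that its degree bounds the number of its roots.
hasUnit : ℕ → List ℕ → Poly → Bool
hasUnit k ds = any (λ c → strip k ds ℤ.∣ c ∣ ≡ᵇ 1)

obstructions-nonzero : all (hasUnit 100 smallPrimes) (System.polys s∀) ≡ true
obstructions-nonzero = refl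

fewObstructions : (ℕ.sum (map degree (System.polys s∀)) <ᵇ 105) ≡ true
fewObstructions = refl

-- Wrapped in a data type, so that comparing two types never evaluates the table.
data Table (k n : ℕ) : Set where
  table : allFrom leastOk k n ≡ true → Table k n

-- The range ends before 43 + 9557 = 9600, where the argument for large N takes over.
leastOk-all : Table 9557 43
leastOk-all = table refl

-- Explicit permutations

tail : List ℕ → List ℕ
tail [] = []
tail (_ ∷ xs) = xs

module _ (n : ℕ) .{{_ : NonZero n}} where

  -- One test for two purposes: distinct images of the first two terms give injectivity, and the
  -- second conjunct destroys the progression.
  column : ℕ → ℕ → ℕ → Bool
  column a b c = not (a ≡ᵇ b) ∧ not ((a ℕ.+ c) ℕ.% n ≡ᵇ (2 ℕ.* b) ℕ.% n)

  row : (xs ys zs : List ℕ) → Bool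
  row [] _ _ = true
  row (x ∷ xs) (y ∷ ys) (z ∷ zs) = column x y z ∧ row xs ys zs
  row (_ ∷ _) _ _ = false

  rows : ℕ → (xs ys zs : List ℕ) → Bool
  rows zero xs ys zs = true
  rows (suc k) xs ys zs = row xs ys zs ∧ rows k xs (tail ys) (tail (tail zs))

-- Row r compares the list with its shifts by r and 2r.
tableOk : ℕ × List ℕ → Bool
tableOk (zero , l) = false
tableOk (n@(suc m) , l) = (length l ≡ᵇ n) ∧ (all (_<ᵇ n) l ∧ rows n m l (tail (l ++ l ++ l)) (tail (tail (l ++ l ++ l))))

tables : List (ℕ × List ℕ)
tables =
  (4 , 2 ∷ 0 ∷ 3 ∷ 1 ∷ []) ∷
  (6 , 1 ∷ 4 ∷ 5 ∷ 3 ∷ 2 ∷ 0 ∷ []) ∷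
  (8 , 6 ∷ 4 ∷ 5 ∷ 0 ∷ 1 ∷ 7 ∷ 3 ∷ 2 ∷ []) ∷
  (9 , 3 ∷ 7 ∷ 4 ∷ 0 ∷ 8 ∷ 1 ∷ 2 ∷ 5 ∷ 6 ∷ []) ∷
  (10 , 8 ∷ 2 ∷ 7 ∷ 0 ∷ 1 ∷ 4 ∷ 3 ∷ 5 ∷ 6 ∷ 9 ∷ []) ∷
  (11 , 10 ∷ 8 ∷ 3 ∷ 5 ∷ 2 ∷ 6 ∷ 4 ∷ 9 ∷ 1 ∷ 0 ∷ 7 ∷ []) ∷
  (12 , 4 ∷ 10 ∷ 3 ∷ 6 ∷ 1 ∷ 7 ∷ 0 ∷ 11 ∷ 5 ∷ 9 ∷ 2 ∷ 8 ∷ []) ∷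
  (13 , 3 ∷ 7 ∷ 0 ∷ 11 ∷ 5 ∷ 1 ∷ 8 ∷ 9 ∷ 6 ∷ 10 ∷ 2 ∷ 12 ∷ 4 ∷ []) ∷
  (14 , 0 ∷ 13 ∷ 8 ∷ 11 ∷ 9 ∷ 3 ∷ 4 ∷ 1 ∷ 5 ∷ 2 ∷ 10 ∷ 12 ∷ 7 ∷ 6 ∷ []) ∷
  (15 , 4 ∷ 12 ∷ 6 ∷ 9 ∷ 1 ∷ 3 ∷ 8 ∷ 0 ∷ 14 ∷ 2 ∷ 13 ∷ 11 ∷ 7 ∷ 10 ∷ 5 ∷ []) ∷
  (17 , 2 ∷ 10 ∷ 14 ∷ 11 ∷ 3 ∷ 7 ∷ 15 ∷ 1 ∷ 13 ∷ 9 ∷ 0 ∷ 5 ∷ 8 ∷ 4 ∷ 6 ∷ 12 ∷ 16 ∷ []) ∷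
  (18 , 4 ∷ 0 ∷ 15 ∷ 1 ∷ 6 ∷ 12 ∷ 8 ∷ 9 ∷ 11 ∷ 2 ∷ 10 ∷ 7 ∷ 5 ∷ 16 ∷ 17 ∷ 14 ∷ 3 ∷ 13 ∷ []) ∷
  (19 , 13 ∷ 11 ∷ 0 ∷ 17 ∷ 14 ∷ 6 ∷ 8 ∷ 1 ∷ 7 ∷ 2 ∷ 9 ∷ 10 ∷ 4 ∷ 5 ∷ 15 ∷ 18 ∷ 3 ∷ 16 ∷ 12 ∷ []) ∷
  (20 , 9 ∷ 12 ∷ 2 ∷ 16 ∷ 18 ∷ 14 ∷ 6 ∷ 7 ∷ 15 ∷ 17 ∷ 0 ∷ 11 ∷ 10 ∷ 1 ∷ 19 ∷ 5 ∷ 13 ∷ 3 ∷ 8 ∷ 4 ∷ []) ∷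
  (21 , 19 ∷ 4 ∷ 16 ∷ 12 ∷ 20 ∷ 9 ∷ 18 ∷ 0 ∷ 17 ∷ 11 ∷ 8 ∷ 7 ∷ 15 ∷ 6 ∷ 13 ∷ 2 ∷ 14 ∷ 3 ∷ 1 ∷ 10 ∷ 5 ∷ []) ∷
  (22 , 8 ∷ 13 ∷ 15 ∷ 9 ∷ 18 ∷ 17 ∷ 20 ∷ 12 ∷ 2 ∷ 6 ∷ 16 ∷ 21 ∷ 7 ∷ 1 ∷ 0 ∷ 11 ∷ 3 ∷ 5 ∷ 14 ∷ 10 ∷ 19 ∷ 4 ∷ []) ∷
  (23 , 21 ∷ 17 ∷ 1 ∷ 19 ∷ 5 ∷ 11 ∷ 3 ∷ 10 ∷ 16 ∷ 20 ∷ 18 ∷ 4 ∷ 6 ∷ 12 ∷ 14 ∷ 8 ∷ 0 ∷ 13 ∷ 15 ∷ 7 ∷ 9 ∷ 2 ∷ 22 ∷ []) ∷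
  (25 , 9 ∷ 7 ∷ 3 ∷ 10 ∷ 6 ∷ 0 ∷ 13 ∷ 23 ∷ 15 ∷ 22 ∷ 24 ∷ 14 ∷ 16 ∷ 11 ∷ 19 ∷ 4 ∷ 5 ∷ 8 ∷ 1 ∷ 2 ∷ 17 ∷ 18 ∷ 21 ∷
    20 ∷ 12 ∷ []) ∷
  (27 , 1 ∷ 17 ∷ 11 ∷ 0 ∷ 10 ∷ 21 ∷ 12 ∷ 24 ∷ 7 ∷ 16 ∷ 3 ∷ 19 ∷ 22 ∷ 13 ∷ 5 ∷ 26 ∷ 4 ∷ 25 ∷ 23 ∷ 18 ∷ 2 ∷ 6 ∷ 9 ∷
    8 ∷ 14 ∷ 15 ∷ 20 ∷ []) ∷
  (28 , 0 ∷ 18 ∷ 25 ∷ 9 ∷ 20 ∷ 1 ∷ 8 ∷ 24 ∷ 27 ∷ 10 ∷ 26 ∷ 12 ∷ 5 ∷ 15 ∷ 2 ∷ 16 ∷ 17 ∷ 13 ∷ 11 ∷ 21 ∷ 7 ∷ 14 ∷ 6 ∷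
    19 ∷ 22 ∷ 4 ∷ 23 ∷ 3 ∷ []) ∷
  (29 , 22 ∷ 28 ∷ 8 ∷ 24 ∷ 17 ∷ 21 ∷ 11 ∷ 23 ∷ 14 ∷ 6 ∷ 5 ∷ 27 ∷ 16 ∷ 7 ∷ 18 ∷ 3 ∷ 2 ∷ 0 ∷ 1 ∷ 12 ∷ 26 ∷ 10 ∷ 15 ∷
    9 ∷ 25 ∷ 19 ∷ 4 ∷ 13 ∷ 20 ∷ []) ∷
  (30 , 7 ∷ 3 ∷ 10 ∷ 11 ∷ 26 ∷ 20 ∷ 29 ∷ 22 ∷ 5 ∷ 9 ∷ 23 ∷ 8 ∷ 18 ∷ 21 ∷ 28 ∷ 14 ∷ 2 ∷ 4 ∷ 24 ∷ 0 ∷ 12 ∷ 15 ∷ 19 ∷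
    13 ∷ 16 ∷ 6 ∷ 1 ∷ 27 ∷ 25 ∷ 17 ∷ []) ∷
  (31 , 10 ∷ 14 ∷ 29 ∷ 18 ∷ 5 ∷ 30 ∷ 20 ∷ 1 ∷ 6 ∷ 12 ∷ 16 ∷ 11 ∷ 8 ∷ 27 ∷ 2 ∷ 19 ∷ 15 ∷ 9 ∷ 22 ∷ 7 ∷ 17 ∷ 28 ∷
    25 ∷ 4 ∷ 21 ∷ 13 ∷ 23 ∷ 24 ∷ 3 ∷ 26 ∷ 0 ∷ []) ∷
  (35 , 4 ∷ 26 ∷ 19 ∷ 13 ∷ 2 ∷ 14 ∷ 25 ∷ 31 ∷ 5 ∷ 29 ∷ 15 ∷ 21 ∷ 7 ∷ 22 ∷ 30 ∷ 17 ∷ 24 ∷ 0 ∷ 32 ∷ 3 ∷ 27 ∷ 11 ∷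
    20 ∷ 28 ∷ 16 ∷ 23 ∷ 1 ∷ 10 ∷ 33 ∷ 6 ∷ 12 ∷ 9 ∷ 34 ∷ 8 ∷ 18 ∷ []) ∷
  (37 , 17 ∷ 20 ∷ 29 ∷ 15 ∷ 8 ∷ 25 ∷ 32 ∷ 24 ∷ 0 ∷ 18 ∷ 22 ∷ 14 ∷ 31 ∷ 27 ∷ 30 ∷ 5 ∷ 26 ∷ 35 ∷ 3 ∷ 4 ∷ 7 ∷ 34 ∷
    36 ∷ 13 ∷ 33 ∷ 12 ∷ 9 ∷ 1 ∷ 19 ∷ 16 ∷ 2 ∷ 6 ∷ 28 ∷ 23 ∷ 21 ∷ 10 ∷ 11 ∷ []) ∷
  (41 , 27 ∷ 2 ∷ 24 ∷ 39 ∷ 28 ∷ 12 ∷ 9 ∷ 40 ∷ 22 ∷ 31 ∷ 1 ∷ 30 ∷ 14 ∷ 13 ∷ 11 ∷ 6 ∷ 3 ∷ 26 ∷ 5 ∷ 19 ∷ 25 ∷ 8 ∷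
    34 ∷ 37 ∷ 7 ∷ 16 ∷ 4 ∷ 38 ∷ 32 ∷ 29 ∷ 18 ∷ 15 ∷ 0 ∷ 36 ∷ 17 ∷ 35 ∷ 23 ∷ 33 ∷ 20 ∷ 21 ∷ 10 ∷ []) ∷
  (42 , 9 ∷ 39 ∷ 5 ∷ 21 ∷ 26 ∷ 18 ∷ 1 ∷ 37 ∷ 4 ∷ 33 ∷ 22 ∷ 16 ∷ 29 ∷ 14 ∷ 12 ∷ 24 ∷ 35 ∷ 2 ∷ 32 ∷ 13 ∷ 23 ∷ 20 ∷
    41 ∷ 38 ∷ 34 ∷ 19 ∷ 17 ∷ 7 ∷ 30 ∷ 31 ∷ 0 ∷ 36 ∷ 27 ∷ 10 ∷ 6 ∷ 8 ∷ 25 ∷ 15 ∷ 11 ∷ 3 ∷ 28 ∷ 40 ∷ []) ∷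
  (43 , 35 ∷ 10 ∷ 41 ∷ 28 ∷ 11 ∷ 7 ∷ 15 ∷ 26 ∷ 25 ∷ 30 ∷ 13 ∷ 42 ∷ 33 ∷ 20 ∷ 19 ∷ 0 ∷ 16 ∷ 36 ∷ 38 ∷ 4 ∷ 39 ∷ 22 ∷
    3 ∷ 21 ∷ 5 ∷ 12 ∷ 8 ∷ 24 ∷ 17 ∷ 37 ∷ 40 ∷ 34 ∷ 27 ∷ 32 ∷ 1 ∷ 31 ∷ 14 ∷ 2 ∷ 23 ∷ 29 ∷ 9 ∷ 18 ∷ 6 ∷ []) ∷
  (45 , 42 ∷ 16 ∷ 25 ∷ 29 ∷ 24 ∷ 39 ∷ 10 ∷ 38 ∷ 3 ∷ 15 ∷ 4 ∷ 7 ∷ 12 ∷ 27 ∷ 28 ∷ 43 ∷ 26 ∷ 11 ∷ 13 ∷ 6 ∷ 22 ∷ 8 ∷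
    36 ∷ 9 ∷ 41 ∷ 37 ∷ 20 ∷ 23 ∷ 34 ∷ 2 ∷ 14 ∷ 33 ∷ 17 ∷ 44 ∷ 0 ∷ 30 ∷ 40 ∷ 1 ∷ 21 ∷ 19 ∷ 5 ∷ 31 ∷ 35 ∷ 32 ∷ 18 ∷ []) ∷
  (47 , 2 ∷ 45 ∷ 28 ∷ 38 ∷ 46 ∷ 11 ∷ 33 ∷ 3 ∷ 37 ∷ 9 ∷ 12 ∷ 5 ∷ 24 ∷ 30 ∷ 42 ∷ 20 ∷ 43 ∷ 44 ∷ 19 ∷ 34 ∷ 40 ∷ 7 ∷
    39 ∷ 18 ∷ 8 ∷ 31 ∷ 17 ∷ 23 ∷ 15 ∷ 41 ∷ 10 ∷ 0 ∷ 6 ∷ 1 ∷ 26 ∷ 14 ∷ 25 ∷ 13 ∷ 32 ∷ 16 ∷ 21 ∷ 36 ∷ 29 ∷ 4 ∷ 27 ∷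
    35 ∷ 22 ∷ []) ∷
  (49 , 37 ∷ 28 ∷ 33 ∷ 15 ∷ 36 ∷ 4 ∷ 14 ∷ 5 ∷ 44 ∷ 19 ∷ 13 ∷ 23 ∷ 25 ∷ 43 ∷ 21 ∷ 24 ∷ 16 ∷ 22 ∷ 47 ∷ 8 ∷ 11 ∷ 0 ∷
    30 ∷ 6 ∷ 46 ∷ 41 ∷ 48 ∷ 31 ∷ 42 ∷ 7 ∷ 12 ∷ 38 ∷ 18 ∷ 27 ∷ 45 ∷ 34 ∷ 40 ∷ 29 ∷ 20 ∷ 17 ∷ 2 ∷ 3 ∷ 32 ∷ 35 ∷ 9 ∷
    10 ∷ 26 ∷ 1 ∷ 39 ∷ []) ∷
  (50 , 32 ∷ 21 ∷ 9 ∷ 18 ∷ 34 ∷ 43 ∷ 38 ∷ 16 ∷ 45 ∷ 3 ∷ 1 ∷ 29 ∷ 39 ∷ 4 ∷ 36 ∷ 8 ∷ 0 ∷ 47 ∷ 26 ∷ 24 ∷ 28 ∷ 42 ∷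
    37 ∷ 13 ∷ 25 ∷ 19 ∷ 10 ∷ 35 ∷ 2 ∷ 33 ∷ 7 ∷ 12 ∷ 30 ∷ 6 ∷ 27 ∷ 11 ∷ 41 ∷ 22 ∷ 14 ∷ 20 ∷ 49 ∷ 5 ∷ 17 ∷ 46 ∷ 44 ∷
    40 ∷ 15 ∷ 23 ∷ 48 ∷ 31 ∷ []) ∷
  (53 , 9 ∷ 1 ∷ 43 ∷ 21 ∷ 49 ∷ 0 ∷ 48 ∷ 15 ∷ 42 ∷ 14 ∷ 26 ∷ 47 ∷ 17 ∷ 22 ∷ 40 ∷ 3 ∷ 27 ∷ 38 ∷ 52 ∷ 23 ∷ 30 ∷ 25 ∷
    35 ∷ 20 ∷ 36 ∷ 37 ∷ 46 ∷ 31 ∷ 4 ∷ 7 ∷ 6 ∷ 28 ∷ 12 ∷ 44 ∷ 24 ∷ 11 ∷ 41 ∷ 16 ∷ 8 ∷ 18 ∷ 5 ∷ 2 ∷ 19 ∷ 50 ∷ 34 ∷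
    33 ∷ 51 ∷ 10 ∷ 45 ∷ 32 ∷ 29 ∷ 13 ∷ 39 ∷ []) ∷
  (59 , 11 ∷ 58 ∷ 14 ∷ 13 ∷ 38 ∷ 37 ∷ 32 ∷ 51 ∷ 12 ∷ 22 ∷ 31 ∷ 36 ∷ 57 ∷ 15 ∷ 47 ∷ 48 ∷ 4 ∷ 56 ∷ 3 ∷ 25 ∷ 27 ∷ 9 ∷
    53 ∷ 44 ∷ 26 ∷ 18 ∷ 30 ∷ 28 ∷ 45 ∷ 50 ∷ 40 ∷ 42 ∷ 19 ∷ 2 ∷ 23 ∷ 6 ∷ 7 ∷ 33 ∷ 49 ∷ 21 ∷ 39 ∷ 10 ∷ 52 ∷ 34 ∷
    46 ∷ 0 ∷ 16 ∷ 1 ∷ 17 ∷ 43 ∷ 54 ∷ 35 ∷ 20 ∷ 8 ∷ 24 ∷ 29 ∷ 41 ∷ 5 ∷ 55 ∷ []) ∷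
  (61 , 34 ∷ 21 ∷ 24 ∷ 3 ∷ 33 ∷ 16 ∷ 58 ∷ 11 ∷ 52 ∷ 15 ∷ 0 ∷ 54 ∷ 39 ∷ 6 ∷ 14 ∷ 7 ∷ 17 ∷ 57 ∷ 49 ∷ 9 ∷ 31 ∷ 36 ∷
    19 ∷ 45 ∷ 2 ∷ 42 ∷ 30 ∷ 5 ∷ 38 ∷ 12 ∷ 23 ∷ 29 ∷ 37 ∷ 60 ∷ 50 ∷ 41 ∷ 25 ∷ 28 ∷ 32 ∷ 47 ∷ 4 ∷ 1 ∷ 10 ∷ 18 ∷ 46 ∷
    59 ∷ 40 ∷ 48 ∷ 22 ∷ 27 ∷ 43 ∷ 44 ∷ 56 ∷ 55 ∷ 26 ∷ 20 ∷ 51 ∷ 13 ∷ 35 ∷ 8 ∷ 53 ∷ []) ∷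
  (63 , 23 ∷ 46 ∷ 9 ∷ 17 ∷ 16 ∷ 31 ∷ 43 ∷ 26 ∷ 10 ∷ 29 ∷ 52 ∷ 61 ∷ 37 ∷ 7 ∷ 36 ∷ 48 ∷ 57 ∷ 51 ∷ 2 ∷ 50 ∷ 8 ∷ 44 ∷
    34 ∷ 53 ∷ 4 ∷ 49 ∷ 39 ∷ 22 ∷ 38 ∷ 11 ∷ 20 ∷ 32 ∷ 27 ∷ 41 ∷ 30 ∷ 0 ∷ 1 ∷ 33 ∷ 18 ∷ 21 ∷ 25 ∷ 14 ∷ 13 ∷ 35 ∷
    19 ∷ 45 ∷ 5 ∷ 60 ∷ 12 ∷ 55 ∷ 40 ∷ 54 ∷ 6 ∷ 24 ∷ 3 ∷ 42 ∷ 56 ∷ 47 ∷ 58 ∷ 15 ∷ 59 ∷ 62 ∷ 28 ∷ []) ∷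
  (67 , 14 ∷ 34 ∷ 61 ∷ 4 ∷ 47 ∷ 40 ∷ 53 ∷ 58 ∷ 48 ∷ 56 ∷ 12 ∷ 55 ∷ 62 ∷ 30 ∷ 32 ∷ 29 ∷ 43 ∷ 5 ∷ 45 ∷ 1 ∷ 64 ∷ 46 ∷
    21 ∷ 20 ∷ 44 ∷ 51 ∷ 24 ∷ 65 ∷ 22 ∷ 36 ∷ 60 ∷ 54 ∷ 66 ∷ 49 ∷ 2 ∷ 63 ∷ 0 ∷ 23 ∷ 25 ∷ 15 ∷ 52 ∷ 57 ∷ 13 ∷ 3 ∷ 7 ∷
    50 ∷ 28 ∷ 10 ∷ 19 ∷ 18 ∷ 11 ∷ 42 ∷ 33 ∷ 37 ∷ 8 ∷ 6 ∷ 39 ∷ 9 ∷ 27 ∷ 38 ∷ 16 ∷ 17 ∷ 26 ∷ 59 ∷ 41 ∷ 35 ∷ 31 ∷ []) ∷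
  (70 , 3 ∷ 36 ∷ 57 ∷ 0 ∷ 23 ∷ 7 ∷ 21 ∷ 9 ∷ 49 ∷ 46 ∷ 44 ∷ 66 ∷ 69 ∷ 10 ∷ 58 ∷ 68 ∷ 12 ∷ 34 ∷ 35 ∷ 31 ∷ 53 ∷ 47 ∷
    56 ∷ 27 ∷ 48 ∷ 55 ∷ 29 ∷ 67 ∷ 33 ∷ 54 ∷ 50 ∷ 18 ∷ 40 ∷ 59 ∷ 16 ∷ 1 ∷ 4 ∷ 39 ∷ 22 ∷ 30 ∷ 43 ∷ 5 ∷ 6 ∷ 28 ∷ 8 ∷
    14 ∷ 61 ∷ 32 ∷ 25 ∷ 64 ∷ 20 ∷ 65 ∷ 24 ∷ 51 ∷ 26 ∷ 42 ∷ 45 ∷ 63 ∷ 38 ∷ 60 ∷ 2 ∷ 52 ∷ 19 ∷ 13 ∷ 41 ∷ 17 ∷ 62 ∷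
    11 ∷ 37 ∷ 15 ∷ []) ∷
  (71 , 36 ∷ 23 ∷ 14 ∷ 67 ∷ 53 ∷ 17 ∷ 40 ∷ 57 ∷ 47 ∷ 66 ∷ 51 ∷ 3 ∷ 30 ∷ 13 ∷ 5 ∷ 60 ∷ 45 ∷ 48 ∷ 15 ∷ 34 ∷ 11 ∷
    49 ∷ 0 ∷ 46 ∷ 31 ∷ 39 ∷ 16 ∷ 55 ∷ 69 ∷ 58 ∷ 59 ∷ 43 ∷ 8 ∷ 42 ∷ 6 ∷ 28 ∷ 1 ∷ 20 ∷ 9 ∷ 7 ∷ 37 ∷ 54 ∷ 56 ∷ 4 ∷
    50 ∷ 2 ∷ 38 ∷ 70 ∷ 22 ∷ 63 ∷ 12 ∷ 29 ∷ 21 ∷ 64 ∷ 44 ∷ 52 ∷ 68 ∷ 61 ∷ 62 ∷ 10 ∷ 26 ∷ 32 ∷ 24 ∷ 35 ∷ 18 ∷ 25 ∷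
    19 ∷ 33 ∷ 27 ∷ 65 ∷ 41 ∷ []) ∷
  (73 , 45 ∷ 42 ∷ 65 ∷ 60 ∷ 57 ∷ 0 ∷ 23 ∷ 71 ∷ 68 ∷ 61 ∷ 63 ∷ 24 ∷ 47 ∷ 64 ∷ 25 ∷ 3 ∷ 4 ∷ 6 ∷ 54 ∷ 66 ∷ 52 ∷ 69 ∷
    19 ∷ 13 ∷ 43 ∷ 58 ∷ 21 ∷ 70 ∷ 37 ∷ 5 ∷ 44 ∷ 17 ∷ 39 ∷ 53 ∷ 29 ∷ 8 ∷ 34 ∷ 30 ∷ 1 ∷ 10 ∷ 40 ∷ 20 ∷ 27 ∷ 56 ∷
    48 ∷ 11 ∷ 41 ∷ 50 ∷ 2 ∷ 36 ∷ 72 ∷ 33 ∷ 55 ∷ 22 ∷ 49 ∷ 26 ∷ 14 ∷ 16 ∷ 7 ∷ 38 ∷ 12 ∷ 32 ∷ 9 ∷ 51 ∷ 62 ∷ 31 ∷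
    28 ∷ 59 ∷ 46 ∷ 35 ∷ 18 ∷ 15 ∷ 67 ∷ []) ∷
  (75 , 67 ∷ 33 ∷ 44 ∷ 28 ∷ 64 ∷ 21 ∷ 17 ∷ 71 ∷ 38 ∷ 32 ∷ 0 ∷ 45 ∷ 26 ∷ 30 ∷ 27 ∷ 7 ∷ 37 ∷ 18 ∷ 34 ∷ 63 ∷ 51 ∷
    16 ∷ 11 ∷ 56 ∷ 66 ∷ 5 ∷ 53 ∷ 2 ∷ 49 ∷ 6 ∷ 39 ∷ 54 ∷ 50 ∷ 4 ∷ 14 ∷ 41 ∷ 52 ∷ 47 ∷ 9 ∷ 74 ∷ 69 ∷ 19 ∷ 70 ∷ 25 ∷
    8 ∷ 68 ∷ 48 ∷ 29 ∷ 43 ∷ 36 ∷ 23 ∷ 24 ∷ 1 ∷ 72 ∷ 20 ∷ 62 ∷ 58 ∷ 60 ∷ 15 ∷ 42 ∷ 73 ∷ 46 ∷ 31 ∷ 35 ∷ 61 ∷ 10 ∷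
    40 ∷ 12 ∷ 22 ∷ 3 ∷ 65 ∷ 13 ∷ 59 ∷ 55 ∷ 57 ∷ []) ∷
  (77 , 5 ∷ 60 ∷ 13 ∷ 39 ∷ 61 ∷ 43 ∷ 36 ∷ 40 ∷ 23 ∷ 57 ∷ 9 ∷ 11 ∷ 37 ∷ 69 ∷ 55 ∷ 1 ∷ 46 ∷ 33 ∷ 22 ∷ 54 ∷ 58 ∷ 26 ∷
    8 ∷ 15 ∷ 17 ∷ 29 ∷ 68 ∷ 67 ∷ 10 ∷ 2 ∷ 75 ∷ 51 ∷ 62 ∷ 12 ∷ 44 ∷ 18 ∷ 28 ∷ 47 ∷ 27 ∷ 48 ∷ 4 ∷ 56 ∷ 71 ∷ 0 ∷ 42 ∷
    20 ∷ 16 ∷ 74 ∷ 19 ∷ 7 ∷ 3 ∷ 21 ∷ 59 ∷ 72 ∷ 70 ∷ 76 ∷ 6 ∷ 63 ∷ 50 ∷ 52 ∷ 31 ∷ 49 ∷ 53 ∷ 34 ∷ 35 ∷ 66 ∷ 64 ∷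
    45 ∷ 73 ∷ 65 ∷ 38 ∷ 14 ∷ 24 ∷ 30 ∷ 25 ∷ 41 ∷ 32 ∷ []) ∷
  (79 , 43 ∷ 28 ∷ 57 ∷ 13 ∷ 65 ∷ 10 ∷ 32 ∷ 78 ∷ 11 ∷ 33 ∷ 36 ∷ 34 ∷ 54 ∷ 12 ∷ 58 ∷ 0 ∷ 71 ∷ 61 ∷ 41 ∷ 74 ∷ 4 ∷
    53 ∷ 22 ∷ 35 ∷ 49 ∷ 46 ∷ 6 ∷ 1 ∷ 19 ∷ 47 ∷ 70 ∷ 77 ∷ 75 ∷ 66 ∷ 72 ∷ 50 ∷ 67 ∷ 44 ∷ 15 ∷ 7 ∷ 40 ∷ 27 ∷ 48 ∷
    68 ∷ 55 ∷ 29 ∷ 21 ∷ 42 ∷ 45 ∷ 25 ∷ 52 ∷ 14 ∷ 16 ∷ 38 ∷ 24 ∷ 31 ∷ 76 ∷ 18 ∷ 60 ∷ 59 ∷ 73 ∷ 23 ∷ 26 ∷ 37 ∷ 39 ∷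
    62 ∷ 69 ∷ 2 ∷ 3 ∷ 64 ∷ 8 ∷ 51 ∷ 63 ∷ 5 ∷ 30 ∷ 20 ∷ 9 ∷ 56 ∷ 17 ∷ []) ∷
  (83 , 34 ∷ 22 ∷ 5 ∷ 43 ∷ 37 ∷ 79 ∷ 4 ∷ 72 ∷ 33 ∷ 51 ∷ 44 ∷ 81 ∷ 67 ∷ 59 ∷ 75 ∷ 52 ∷ 65 ∷ 31 ∷ 62 ∷ 70 ∷ 77 ∷
    13 ∷ 17 ∷ 68 ∷ 15 ∷ 3 ∷ 9 ∷ 82 ∷ 18 ∷ 41 ∷ 48 ∷ 74 ∷ 56 ∷ 23 ∷ 0 ∷ 40 ∷ 29 ∷ 36 ∷ 32 ∷ 24 ∷ 30 ∷ 14 ∷ 61 ∷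
    47 ∷ 66 ∷ 54 ∷ 8 ∷ 20 ∷ 25 ∷ 16 ∷ 46 ∷ 55 ∷ 12 ∷ 73 ∷ 42 ∷ 78 ∷ 50 ∷ 1 ∷ 6 ∷ 2 ∷ 71 ∷ 28 ∷ 69 ∷ 39 ∷ 60 ∷ 35 ∷
    38 ∷ 45 ∷ 19 ∷ 64 ∷ 63 ∷ 10 ∷ 49 ∷ 53 ∷ 26 ∷ 27 ∷ 57 ∷ 7 ∷ 21 ∷ 80 ∷ 11 ∷ 58 ∷ 76 ∷ []) ∷
  (89 , 86 ∷ 43 ∷ 68 ∷ 51 ∷ 2 ∷ 20 ∷ 50 ∷ 46 ∷ 71 ∷ 15 ∷ 77 ∷ 36 ∷ 18 ∷ 24 ∷ 60 ∷ 49 ∷ 45 ∷ 67 ∷ 78 ∷ 13 ∷ 23 ∷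
    7 ∷ 56 ∷ 61 ∷ 79 ∷ 63 ∷ 16 ∷ 37 ∷ 47 ∷ 64 ∷ 29 ∷ 27 ∷ 70 ∷ 58 ∷ 30 ∷ 32 ∷ 31 ∷ 34 ∷ 66 ∷ 87 ∷ 82 ∷ 88 ∷ 35 ∷
    39 ∷ 22 ∷ 40 ∷ 55 ∷ 57 ∷ 48 ∷ 62 ∷ 84 ∷ 14 ∷ 54 ∷ 65 ∷ 85 ∷ 0 ∷ 83 ∷ 74 ∷ 69 ∷ 1 ∷ 81 ∷ 25 ∷ 38 ∷ 76 ∷ 52 ∷
    19 ∷ 4 ∷ 41 ∷ 3 ∷ 75 ∷ 11 ∷ 28 ∷ 5 ∷ 59 ∷ 21 ∷ 73 ∷ 9 ∷ 80 ∷ 17 ∷ 26 ∷ 42 ∷ 53 ∷ 12 ∷ 8 ∷ 44 ∷ 72 ∷ 33 ∷ 6 ∷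
    10 ∷ []) ∷
  (91 , 36 ∷ 85 ∷ 51 ∷ 69 ∷ 15 ∷ 60 ∷ 25 ∷ 67 ∷ 43 ∷ 30 ∷ 59 ∷ 0 ∷ 29 ∷ 64 ∷ 17 ∷ 41 ∷ 39 ∷ 40 ∷ 81 ∷ 5 ∷ 54 ∷
    63 ∷ 26 ∷ 88 ∷ 14 ∷ 66 ∷ 79 ∷ 6 ∷ 20 ∷ 61 ∷ 10 ∷ 7 ∷ 89 ∷ 28 ∷ 9 ∷ 19 ∷ 65 ∷ 18 ∷ 1 ∷ 45 ∷ 32 ∷ 4 ∷ 12 ∷ 34 ∷
    37 ∷ 71 ∷ 90 ∷ 3 ∷ 35 ∷ 2 ∷ 50 ∷ 16 ∷ 22 ∷ 52 ∷ 53 ∷ 33 ∷ 82 ∷ 76 ∷ 23 ∷ 58 ∷ 77 ∷ 70 ∷ 21 ∷ 46 ∷ 55 ∷ 48 ∷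
    44 ∷ 56 ∷ 38 ∷ 57 ∷ 73 ∷ 11 ∷ 68 ∷ 74 ∷ 27 ∷ 80 ∷ 47 ∷ 24 ∷ 31 ∷ 8 ∷ 84 ∷ 62 ∷ 72 ∷ 49 ∷ 83 ∷ 42 ∷ 78 ∷ 87 ∷
    13 ∷ 75 ∷ 86 ∷ []) ∷
  (97 , 96 ∷ 27 ∷ 64 ∷ 74 ∷ 10 ∷ 53 ∷ 42 ∷ 68 ∷ 80 ∷ 38 ∷ 90 ∷ 40 ∷ 88 ∷ 62 ∷ 45 ∷ 72 ∷ 23 ∷ 7 ∷ 95 ∷ 21 ∷ 19 ∷
    43 ∷ 26 ∷ 12 ∷ 92 ∷ 87 ∷ 33 ∷ 37 ∷ 66 ∷ 65 ∷ 46 ∷ 82 ∷ 57 ∷ 61 ∷ 69 ∷ 48 ∷ 83 ∷ 25 ∷ 79 ∷ 94 ∷ 63 ∷ 0 ∷ 78 ∷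
    54 ∷ 89 ∷ 59 ∷ 76 ∷ 86 ∷ 75 ∷ 81 ∷ 44 ∷ 77 ∷ 11 ∷ 15 ∷ 17 ∷ 36 ∷ 28 ∷ 85 ∷ 4 ∷ 55 ∷ 1 ∷ 51 ∷ 58 ∷ 35 ∷ 67 ∷
    9 ∷ 49 ∷ 8 ∷ 24 ∷ 30 ∷ 70 ∷ 22 ∷ 93 ∷ 50 ∷ 52 ∷ 32 ∷ 29 ∷ 39 ∷ 31 ∷ 18 ∷ 14 ∷ 60 ∷ 56 ∷ 84 ∷ 13 ∷ 47 ∷ 41 ∷
    34 ∷ 91 ∷ 5 ∷ 71 ∷ 2 ∷ 73 ∷ 6 ∷ 3 ∷ 20 ∷ 16 ∷ []) ∷
  (98 , 68 ∷ 78 ∷ 77 ∷ 25 ∷ 66 ∷ 37 ∷ 43 ∷ 73 ∷ 32 ∷ 9 ∷ 76 ∷ 90 ∷ 74 ∷ 91 ∷ 47 ∷ 51 ∷ 36 ∷ 12 ∷ 93 ∷ 10 ∷ 92 ∷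
    58 ∷ 64 ∷ 39 ∷ 4 ∷ 22 ∷ 89 ∷ 1 ∷ 87 ∷ 70 ∷ 11 ∷ 19 ∷ 61 ∷ 14 ∷ 3 ∷ 59 ∷ 65 ∷ 35 ∷ 28 ∷ 94 ∷ 97 ∷ 23 ∷ 2 ∷ 48 ∷
    83 ∷ 57 ∷ 18 ∷ 41 ∷ 15 ∷ 31 ∷ 20 ∷ 54 ∷ 82 ∷ 52 ∷ 29 ∷ 79 ∷ 88 ∷ 56 ∷ 6 ∷ 67 ∷ 96 ∷ 16 ∷ 44 ∷ 85 ∷ 24 ∷ 84 ∷
    80 ∷ 34 ∷ 72 ∷ 13 ∷ 40 ∷ 30 ∷ 55 ∷ 69 ∷ 27 ∷ 62 ∷ 7 ∷ 75 ∷ 38 ∷ 49 ∷ 81 ∷ 21 ∷ 46 ∷ 26 ∷ 50 ∷ 33 ∷ 63 ∷ 8 ∷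
    71 ∷ 86 ∷ 42 ∷ 0 ∷ 95 ∷ 53 ∷ 60 ∷ 5 ∷ 17 ∷ 45 ∷ []) ∷
  (101 , 20 ∷ 90 ∷ 68 ∷ 22 ∷ 72 ∷ 44 ∷ 10 ∷ 91 ∷ 7 ∷ 98 ∷ 83 ∷ 70 ∷ 73 ∷ 34 ∷ 57 ∷ 39 ∷ 19 ∷ 97 ∷ 37 ∷ 66 ∷ 43 ∷
    32 ∷ 52 ∷ 18 ∷ 45 ∷ 87 ∷ 40 ∷ 21 ∷ 12 ∷ 31 ∷ 2 ∷ 13 ∷ 67 ∷ 80 ∷ 50 ∷ 75 ∷ 94 ∷ 89 ∷ 16 ∷ 1 ∷ 100 ∷ 23 ∷ 77 ∷
    38 ∷ 88 ∷ 78 ∷ 59 ∷ 29 ∷ 15 ∷ 49 ∷ 95 ∷ 47 ∷ 58 ∷ 4 ∷ 65 ∷ 93 ∷ 76 ∷ 61 ∷ 25 ∷ 17 ∷ 79 ∷ 55 ∷ 63 ∷ 86 ∷ 69 ∷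
    33 ∷ 3 ∷ 96 ∷ 92 ∷ 8 ∷ 30 ∷ 54 ∷ 51 ∷ 24 ∷ 41 ∷ 60 ∷ 82 ∷ 36 ∷ 11 ∷ 85 ∷ 64 ∷ 0 ∷ 99 ∷ 5 ∷ 9 ∷ 56 ∷ 42 ∷ 71 ∷
    62 ∷ 46 ∷ 28 ∷ 48 ∷ 27 ∷ 35 ∷ 84 ∷ 6 ∷ 53 ∷ 81 ∷ 14 ∷ 26 ∷ 74 ∷ []) ∷
  (103 , 50 ∷ 44 ∷ 20 ∷ 18 ∷ 4 ∷ 54 ∷ 34 ∷ 32 ∷ 89 ∷ 69 ∷ 46 ∷ 15 ∷ 65 ∷ 25 ∷ 71 ∷ 59 ∷ 87 ∷ 1 ∷ 39 ∷ 75 ∷ 64 ∷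
    55 ∷ 11 ∷ 82 ∷ 33 ∷ 73 ∷ 76 ∷ 36 ∷ 85 ∷ 43 ∷ 40 ∷ 49 ∷ 24 ∷ 38 ∷ 17 ∷ 70 ∷ 19 ∷ 35 ∷ 41 ∷ 22 ∷ 68 ∷ 6 ∷ 98 ∷
    63 ∷ 99 ∷ 8 ∷ 95 ∷ 13 ∷ 2 ∷ 61 ∷ 72 ∷ 96 ∷ 97 ∷ 57 ∷ 31 ∷ 51 ∷ 56 ∷ 67 ∷ 102 ∷ 86 ∷ 101 ∷ 12 ∷ 45 ∷ 26 ∷ 60 ∷
    42 ∷ 80 ∷ 16 ∷ 21 ∷ 14 ∷ 79 ∷ 29 ∷ 53 ∷ 52 ∷ 23 ∷ 37 ∷ 66 ∷ 84 ∷ 7 ∷ 100 ∷ 5 ∷ 3 ∷ 74 ∷ 28 ∷ 9 ∷ 10 ∷ 62 ∷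
    93 ∷ 78 ∷ 94 ∷ 90 ∷ 48 ∷ 81 ∷ 83 ∷ 77 ∷ 0 ∷ 88 ∷ 27 ∷ 30 ∷ 47 ∷ 92 ∷ 91 ∷ 58 ∷ []) ∷
  (105 , 15 ∷ 4 ∷ 51 ∷ 53 ∷ 1 ∷ 96 ∷ 73 ∷ 70 ∷ 43 ∷ 17 ∷ 61 ∷ 50 ∷ 54 ∷ 75 ∷ 72 ∷ 95 ∷ 57 ∷ 46 ∷ 90 ∷ 27 ∷ 47 ∷
    3 ∷ 9 ∷ 59 ∷ 24 ∷ 81 ∷ 91 ∷ 104 ∷ 2 ∷ 19 ∷ 85 ∷ 10 ∷ 13 ∷ 28 ∷ 22 ∷ 93 ∷ 11 ∷ 76 ∷ 100 ∷ 89 ∷ 34 ∷ 99 ∷ 94 ∷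
    26 ∷ 25 ∷ 30 ∷ 12 ∷ 66 ∷ 7 ∷ 82 ∷ 83 ∷ 71 ∷ 103 ∷ 88 ∷ 40 ∷ 80 ∷ 102 ∷ 86 ∷ 33 ∷ 14 ∷ 58 ∷ 56 ∷ 6 ∷ 36 ∷ 48 ∷
    21 ∷ 62 ∷ 64 ∷ 68 ∷ 101 ∷ 16 ∷ 45 ∷ 87 ∷ 41 ∷ 8 ∷ 32 ∷ 97 ∷ 74 ∷ 23 ∷ 29 ∷ 63 ∷ 69 ∷ 49 ∷ 78 ∷ 55 ∷ 20 ∷ 79 ∷
    60 ∷ 84 ∷ 35 ∷ 18 ∷ 65 ∷ 38 ∷ 31 ∷ 37 ∷ 42 ∷ 77 ∷ 67 ∷ 39 ∷ 0 ∷ 52 ∷ 5 ∷ 98 ∷ 44 ∷ 92 ∷ []) ∷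
  (107 , 105 ∷ 41 ∷ 65 ∷ 101 ∷ 102 ∷ 104 ∷ 5 ∷ 75 ∷ 13 ∷ 43 ∷ 33 ∷ 89 ∷ 8 ∷ 44 ∷ 95 ∷ 23 ∷ 7 ∷ 85 ∷ 2 ∷ 48 ∷ 40 ∷
    70 ∷ 3 ∷ 88 ∷ 61 ∷ 60 ∷ 1 ∷ 91 ∷ 77 ∷ 59 ∷ 98 ∷ 0 ∷ 21 ∷ 86 ∷ 92 ∷ 66 ∷ 30 ∷ 56 ∷ 94 ∷ 42 ∷ 28 ∷ 38 ∷ 6 ∷ 26 ∷
    45 ∷ 69 ∷ 10 ∷ 53 ∷ 99 ∷ 46 ∷ 72 ∷ 17 ∷ 49 ∷ 87 ∷ 51 ∷ 18 ∷ 25 ∷ 57 ∷ 78 ∷ 83 ∷ 62 ∷ 52 ∷ 64 ∷ 55 ∷ 37 ∷ 80 ∷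
    103 ∷ 11 ∷ 34 ∷ 58 ∷ 81 ∷ 82 ∷ 63 ∷ 27 ∷ 20 ∷ 9 ∷ 14 ∷ 47 ∷ 106 ∷ 96 ∷ 68 ∷ 19 ∷ 36 ∷ 50 ∷ 71 ∷ 24 ∷ 16 ∷ 35 ∷
    22 ∷ 4 ∷ 76 ∷ 67 ∷ 32 ∷ 15 ∷ 90 ∷ 100 ∷ 73 ∷ 39 ∷ 97 ∷ 29 ∷ 54 ∷ 84 ∷ 93 ∷ 12 ∷ 74 ∷ 79 ∷ 31 ∷ []) ∷
  (109 , 91 ∷ 74 ∷ 71 ∷ 45 ∷ 11 ∷ 83 ∷ 52 ∷ 28 ∷ 27 ∷ 90 ∷ 67 ∷ 57 ∷ 86 ∷ 87 ∷ 24 ∷ 2 ∷ 20 ∷ 93 ∷ 106 ∷ 99 ∷ 34 ∷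
    47 ∷ 77 ∷ 97 ∷ 9 ∷ 73 ∷ 69 ∷ 18 ∷ 62 ∷ 105 ∷ 15 ∷ 16 ∷ 25 ∷ 10 ∷ 68 ∷ 76 ∷ 31 ∷ 41 ∷ 4 ∷ 32 ∷ 48 ∷ 79 ∷ 55 ∷
    78 ∷ 8 ∷ 81 ∷ 94 ∷ 96 ∷ 82 ∷ 101 ∷ 88 ∷ 56 ∷ 38 ∷ 36 ∷ 33 ∷ 42 ∷ 65 ∷ 44 ∷ 80 ∷ 102 ∷ 84 ∷ 53 ∷ 103 ∷ 61 ∷
    49 ∷ 50 ∷ 3 ∷ 5 ∷ 75 ∷ 19 ∷ 46 ∷ 26 ∷ 60 ∷ 95 ∷ 51 ∷ 23 ∷ 17 ∷ 7 ∷ 30 ∷ 1 ∷ 13 ∷ 43 ∷ 89 ∷ 37 ∷ 40 ∷ 59 ∷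
    104 ∷ 39 ∷ 21 ∷ 58 ∷ 64 ∷ 108 ∷ 100 ∷ 0 ∷ 22 ∷ 6 ∷ 66 ∷ 72 ∷ 85 ∷ 63 ∷ 54 ∷ 107 ∷ 70 ∷ 14 ∷ 12 ∷ 98 ∷ 92 ∷
    29 ∷ 35 ∷ []) ∷
  (119 , 29 ∷ 76 ∷ 115 ∷ 73 ∷ 45 ∷ 93 ∷ 116 ∷ 67 ∷ 88 ∷ 6 ∷ 95 ∷ 75 ∷ 3 ∷ 43 ∷ 57 ∷ 77 ∷ 81 ∷ 66 ∷ 49 ∷ 105 ∷ 18 ∷
    58 ∷ 34 ∷ 52 ∷ 103 ∷ 4 ∷ 28 ∷ 11 ∷ 19 ∷ 86 ∷ 74 ∷ 64 ∷ 62 ∷ 0 ∷ 37 ∷ 91 ∷ 113 ∷ 17 ∷ 109 ∷ 42 ∷ 50 ∷ 30 ∷ 89 ∷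
    72 ∷ 25 ∷ 32 ∷ 10 ∷ 85 ∷ 9 ∷ 99 ∷ 87 ∷ 107 ∷ 47 ∷ 8 ∷ 114 ∷ 33 ∷ 79 ∷ 71 ∷ 38 ∷ 118 ∷ 65 ∷ 54 ∷ 97 ∷ 41 ∷ 20 ∷
    102 ∷ 53 ∷ 21 ∷ 92 ∷ 26 ∷ 104 ∷ 110 ∷ 117 ∷ 59 ∷ 48 ∷ 39 ∷ 108 ∷ 46 ∷ 5 ∷ 15 ∷ 12 ∷ 63 ∷ 83 ∷ 69 ∷ 1 ∷ 98 ∷
    16 ∷ 78 ∷ 24 ∷ 84 ∷ 106 ∷ 7 ∷ 94 ∷ 101 ∷ 23 ∷ 51 ∷ 2 ∷ 14 ∷ 60 ∷ 82 ∷ 35 ∷ 56 ∷ 22 ∷ 31 ∷ 80 ∷ 61 ∷ 40 ∷ 13 ∷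
    44 ∷ 70 ∷ 111 ∷ 55 ∷ 112 ∷ 68 ∷ 100 ∷ 27 ∷ 90 ∷ 36 ∷ 96 ∷ []) ∷
  (125 , 69 ∷ 121 ∷ 59 ∷ 24 ∷ 85 ∷ 73 ∷ 58 ∷ 117 ∷ 39 ∷ 57 ∷ 104 ∷ 30 ∷ 124 ∷ 110 ∷ 52 ∷ 18 ∷ 108 ∷ 98 ∷ 10 ∷ 78 ∷
    70 ∷ 87 ∷ 31 ∷ 65 ∷ 107 ∷ 86 ∷ 5 ∷ 9 ∷ 62 ∷ 55 ∷ 67 ∷ 40 ∷ 45 ∷ 26 ∷ 16 ∷ 91 ∷ 83 ∷ 89 ∷ 56 ∷ 92 ∷ 33 ∷ 63 ∷
    42 ∷ 50 ∷ 8 ∷ 102 ∷ 114 ∷ 17 ∷ 38 ∷ 22 ∷ 118 ∷ 101 ∷ 100 ∷ 7 ∷ 51 ∷ 123 ∷ 41 ∷ 21 ∷ 71 ∷ 15 ∷ 34 ∷ 49 ∷ 27 ∷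
    1 ∷ 29 ∷ 79 ∷ 47 ∷ 6 ∷ 25 ∷ 74 ∷ 4 ∷ 66 ∷ 88 ∷ 48 ∷ 11 ∷ 82 ∷ 84 ∷ 36 ∷ 46 ∷ 116 ∷ 43 ∷ 99 ∷ 93 ∷ 3 ∷ 54 ∷
    68 ∷ 109 ∷ 112 ∷ 35 ∷ 14 ∷ 111 ∷ 75 ∷ 2 ∷ 32 ∷ 20 ∷ 37 ∷ 119 ∷ 96 ∷ 90 ∷ 105 ∷ 53 ∷ 95 ∷ 64 ∷ 60 ∷ 113 ∷ 81 ∷
    12 ∷ 13 ∷ 0 ∷ 80 ∷ 61 ∷ 122 ∷ 77 ∷ 19 ∷ 44 ∷ 23 ∷ 76 ∷ 72 ∷ 97 ∷ 115 ∷ 103 ∷ 106 ∷ 28 ∷ 120 ∷ 94 ∷ []) ∷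
  (133 , 51 ∷ 34 ∷ 38 ∷ 8 ∷ 33 ∷ 55 ∷ 3 ∷ 129 ∷ 13 ∷ 7 ∷ 18 ∷ 97 ∷ 5 ∷ 6 ∷ 118 ∷ 49 ∷ 61 ∷ 81 ∷ 22 ∷ 94 ∷ 101 ∷
    99 ∷ 102 ∷ 113 ∷ 105 ∷ 44 ∷ 110 ∷ 2 ∷ 29 ∷ 95 ∷ 24 ∷ 78 ∷ 68 ∷ 26 ∷ 47 ∷ 67 ∷ 31 ∷ 85 ∷ 74 ∷ 71 ∷ 116 ∷ 58 ∷
    39 ∷ 27 ∷ 87 ∷ 108 ∷ 112 ∷ 88 ∷ 107 ∷ 10 ∷ 17 ∷ 43 ∷ 124 ∷ 96 ∷ 1 ∷ 106 ∷ 21 ∷ 77 ∷ 75 ∷ 114 ∷ 65 ∷ 25 ∷ 59 ∷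
    120 ∷ 92 ∷ 103 ∷ 122 ∷ 42 ∷ 56 ∷ 104 ∷ 35 ∷ 53 ∷ 83 ∷ 4 ∷ 70 ∷ 69 ∷ 128 ∷ 14 ∷ 60 ∷ 28 ∷ 50 ∷ 36 ∷ 91 ∷ 66 ∷
    62 ∷ 32 ∷ 64 ∷ 12 ∷ 9 ∷ 100 ∷ 63 ∷ 131 ∷ 76 ∷ 125 ∷ 115 ∷ 89 ∷ 15 ∷ 79 ∷ 16 ∷ 73 ∷ 127 ∷ 37 ∷ 23 ∷ 72 ∷ 80 ∷
    41 ∷ 52 ∷ 98 ∷ 121 ∷ 0 ∷ 109 ∷ 119 ∷ 45 ∷ 20 ∷ 54 ∷ 46 ∷ 48 ∷ 19 ∷ 57 ∷ 130 ∷ 93 ∷ 117 ∷ 84 ∷ 132 ∷ 111 ∷ 11 ∷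
    30 ∷ 40 ∷ 86 ∷ 82 ∷ 123 ∷ 90 ∷ 126 ∷ []) ∷
  (147 , 41 ∷ 141 ∷ 24 ∷ 0 ∷ 74 ∷ 50 ∷ 42 ∷ 35 ∷ 82 ∷ 110 ∷ 70 ∷ 10 ∷ 91 ∷ 21 ∷ 97 ∷ 137 ∷ 16 ∷ 66 ∷ 3 ∷ 133 ∷
    71 ∷ 134 ∷ 39 ∷ 11 ∷ 14 ∷ 31 ∷ 40 ∷ 92 ∷ 118 ∷ 12 ∷ 20 ∷ 140 ∷ 136 ∷ 63 ∷ 25 ∷ 87 ∷ 38 ∷ 107 ∷ 103 ∷ 43 ∷ 1 ∷
    104 ∷ 57 ∷ 6 ∷ 67 ∷ 129 ∷ 139 ∷ 44 ∷ 33 ∷ 119 ∷ 142 ∷ 135 ∷ 26 ∷ 9 ∷ 18 ∷ 108 ∷ 90 ∷ 78 ∷ 125 ∷ 7 ∷ 77 ∷ 22 ∷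
    81 ∷ 84 ∷ 127 ∷ 72 ∷ 80 ∷ 59 ∷ 122 ∷ 2 ∷ 101 ∷ 126 ∷ 28 ∷ 105 ∷ 45 ∷ 124 ∷ 13 ∷ 83 ∷ 56 ∷ 115 ∷ 146 ∷ 15 ∷
    54 ∷ 61 ∷ 131 ∷ 48 ∷ 73 ∷ 121 ∷ 79 ∷ 76 ∷ 8 ∷ 19 ∷ 138 ∷ 75 ∷ 46 ∷ 102 ∷ 128 ∷ 53 ∷ 144 ∷ 30 ∷ 114 ∷ 65 ∷ 64 ∷
    94 ∷ 62 ∷ 130 ∷ 145 ∷ 113 ∷ 55 ∷ 36 ∷ 123 ∷ 23 ∷ 4 ∷ 96 ∷ 111 ∷ 95 ∷ 29 ∷ 116 ∷ 34 ∷ 27 ∷ 109 ∷ 143 ∷ 58 ∷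
    99 ∷ 120 ∷ 98 ∷ 85 ∷ 5 ∷ 49 ∷ 60 ∷ 51 ∷ 86 ∷ 88 ∷ 89 ∷ 32 ∷ 17 ∷ 69 ∷ 52 ∷ 132 ∷ 117 ∷ 106 ∷ 37 ∷ 93 ∷ 47 ∷
    112 ∷ 100 ∷ 68 ∷ []) ∷
  (161 , 98 ∷ 62 ∷ 36 ∷ 115 ∷ 78 ∷ 66 ∷ 40 ∷ 31 ∷ 149 ∷ 49 ∷ 131 ∷ 55 ∷ 110 ∷ 114 ∷ 160 ∷ 32 ∷ 24 ∷ 47 ∷ 100 ∷
    71 ∷ 85 ∷ 111 ∷ 148 ∷ 5 ∷ 54 ∷ 124 ∷ 15 ∷ 120 ∷ 63 ∷ 128 ∷ 51 ∷ 145 ∷ 144 ∷ 30 ∷ 104 ∷ 10 ∷ 87 ∷ 108 ∷ 143 ∷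
    139 ∷ 94 ∷ 79 ∷ 95 ∷ 103 ∷ 72 ∷ 14 ∷ 109 ∷ 11 ∷ 21 ∷ 105 ∷ 69 ∷ 157 ∷ 74 ∷ 23 ∷ 73 ∷ 92 ∷ 132 ∷ 86 ∷ 156 ∷
    136 ∷ 142 ∷ 64 ∷ 48 ∷ 93 ∷ 56 ∷ 126 ∷ 27 ∷ 13 ∷ 0 ∷ 88 ∷ 16 ∷ 60 ∷ 37 ∷ 91 ∷ 7 ∷ 137 ∷ 121 ∷ 113 ∷ 33 ∷ 106 ∷
    35 ∷ 6 ∷ 147 ∷ 153 ∷ 152 ∷ 3 ∷ 29 ∷ 57 ∷ 83 ∷ 18 ∷ 20 ∷ 96 ∷ 116 ∷ 77 ∷ 138 ∷ 155 ∷ 158 ∷ 50 ∷ 150 ∷ 26 ∷ 41 ∷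
    67 ∷ 90 ∷ 125 ∷ 133 ∷ 9 ∷ 43 ∷ 135 ∷ 101 ∷ 146 ∷ 107 ∷ 75 ∷ 22 ∷ 28 ∷ 80 ∷ 76 ∷ 8 ∷ 154 ∷ 129 ∷ 2 ∷ 52 ∷ 38 ∷
    122 ∷ 141 ∷ 99 ∷ 34 ∷ 17 ∷ 134 ∷ 61 ∷ 45 ∷ 119 ∷ 68 ∷ 39 ∷ 81 ∷ 25 ∷ 118 ∷ 89 ∷ 53 ∷ 4 ∷ 102 ∷ 70 ∷ 59 ∷ 44 ∷
    46 ∷ 1 ∷ 127 ∷ 159 ∷ 112 ∷ 97 ∷ 117 ∷ 12 ∷ 84 ∷ 123 ∷ 42 ∷ 82 ∷ 151 ∷ 58 ∷ 65 ∷ 140 ∷ 130 ∷ 19 ∷ []) ∷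
  (175 , 3 ∷ 106 ∷ 96 ∷ 137 ∷ 140 ∷ 82 ∷ 52 ∷ 75 ∷ 12 ∷ 116 ∷ 158 ∷ 45 ∷ 102 ∷ 87 ∷ 153 ∷ 145 ∷ 94 ∷ 66 ∷ 135 ∷
    26 ∷ 133 ∷ 112 ∷ 48 ∷ 163 ∷ 100 ∷ 23 ∷ 109 ∷ 120 ∷ 103 ∷ 138 ∷ 35 ∷ 22 ∷ 1 ∷ 59 ∷ 61 ∷ 151 ∷ 36 ∷ 148 ∷ 129 ∷
    51 ∷ 161 ∷ 126 ∷ 134 ∷ 30 ∷ 117 ∷ 69 ∷ 114 ∷ 65 ∷ 42 ∷ 58 ∷ 107 ∷ 123 ∷ 111 ∷ 172 ∷ 0 ∷ 37 ∷ 8 ∷ 38 ∷ 168 ∷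
    50 ∷ 171 ∷ 10 ∷ 166 ∷ 118 ∷ 84 ∷ 40 ∷ 5 ∷ 7 ∷ 32 ∷ 92 ∷ 14 ∷ 47 ∷ 24 ∷ 155 ∷ 108 ∷ 29 ∷ 152 ∷ 90 ∷ 162 ∷ 80 ∷
    149 ∷ 104 ∷ 68 ∷ 34 ∷ 25 ∷ 33 ∷ 85 ∷ 165 ∷ 43 ∷ 154 ∷ 115 ∷ 157 ∷ 72 ∷ 6 ∷ 169 ∷ 98 ∷ 130 ∷ 170 ∷ 101 ∷ 131 ∷
    44 ∷ 15 ∷ 79 ∷ 76 ∷ 55 ∷ 74 ∷ 125 ∷ 16 ∷ 73 ∷ 31 ∷ 105 ∷ 173 ∷ 19 ∷ 160 ∷ 78 ∷ 164 ∷ 86 ∷ 64 ∷ 83 ∷ 144 ∷ 41 ∷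
    28 ∷ 159 ∷ 2 ∷ 121 ∷ 122 ∷ 57 ∷ 21 ∷ 91 ∷ 17 ∷ 67 ∷ 4 ∷ 88 ∷ 99 ∷ 54 ∷ 132 ∷ 93 ∷ 81 ∷ 141 ∷ 150 ∷ 71 ∷ 9 ∷
    11 ∷ 136 ∷ 27 ∷ 124 ∷ 147 ∷ 156 ∷ 167 ∷ 53 ∷ 89 ∷ 174 ∷ 119 ∷ 142 ∷ 39 ∷ 143 ∷ 77 ∷ 139 ∷ 46 ∷ 95 ∷ 70 ∷ 18 ∷
    20 ∷ 62 ∷ 97 ∷ 127 ∷ 63 ∷ 56 ∷ 110 ∷ 49 ∷ 128 ∷ 146 ∷ 13 ∷ 60 ∷ 113 ∷ []) ∷
  (245 , 44 ∷ 173 ∷ 43 ∷ 194 ∷ 56 ∷ 72 ∷ 143 ∷ 17 ∷ 33 ∷ 190 ∷ 134 ∷ 114 ∷ 5 ∷ 145 ∷ 68 ∷ 209 ∷ 215 ∷ 61 ∷ 184 ∷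
    63 ∷ 104 ∷ 175 ∷ 50 ∷ 108 ∷ 129 ∷ 105 ∷ 231 ∷ 197 ∷ 42 ∷ 220 ∷ 97 ∷ 199 ∷ 195 ∷ 124 ∷ 100 ∷ 24 ∷ 41 ∷ 29 ∷ 0 ∷
    111 ∷ 236 ∷ 53 ∷ 154 ∷ 126 ∷ 103 ∷ 226 ∷ 181 ∷ 2 ∷ 168 ∷ 214 ∷ 83 ∷ 6 ∷ 26 ∷ 23 ∷ 171 ∷ 113 ∷ 193 ∷ 218 ∷
    188 ∷ 206 ∷ 219 ∷ 71 ∷ 64 ∷ 229 ∷ 58 ∷ 123 ∷ 40 ∷ 93 ∷ 36 ∷ 57 ∷ 125 ∷ 131 ∷ 8 ∷ 94 ∷ 117 ∷ 182 ∷ 54 ∷ 77 ∷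
    228 ∷ 225 ∷ 137 ∷ 27 ∷ 185 ∷ 235 ∷ 202 ∷ 90 ∷ 67 ∷ 166 ∷ 139 ∷ 55 ∷ 148 ∷ 155 ∷ 138 ∷ 119 ∷ 179 ∷ 136 ∷ 240 ∷
    133 ∷ 169 ∷ 157 ∷ 12 ∷ 1 ∷ 135 ∷ 73 ∷ 180 ∷ 217 ∷ 130 ∷ 142 ∷ 223 ∷ 88 ∷ 232 ∷ 21 ∷ 178 ∷ 230 ∷ 35 ∷ 151 ∷
    212 ∷ 76 ∷ 244 ∷ 82 ∷ 242 ∷ 49 ∷ 147 ∷ 62 ∷ 196 ∷ 243 ∷ 224 ∷ 116 ∷ 238 ∷ 30 ∷ 28 ∷ 200 ∷ 101 ∷ 210 ∷ 3 ∷
    239 ∷ 163 ∷ 140 ∷ 10 ∷ 128 ∷ 31 ∷ 201 ∷ 160 ∷ 177 ∷ 79 ∷ 203 ∷ 19 ∷ 20 ∷ 59 ∷ 221 ∷ 107 ∷ 89 ∷ 222 ∷ 18 ∷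
    234 ∷ 241 ∷ 80 ∷ 141 ∷ 172 ∷ 70 ∷ 84 ∷ 81 ∷ 227 ∷ 167 ∷ 66 ∷ 98 ∷ 99 ∷ 102 ∷ 95 ∷ 45 ∷ 150 ∷ 183 ∷ 127 ∷ 110 ∷
    25 ∷ 112 ∷ 46 ∷ 186 ∷ 208 ∷ 216 ∷ 156 ∷ 69 ∷ 87 ∷ 204 ∷ 109 ∷ 96 ∷ 191 ∷ 86 ∷ 91 ∷ 187 ∷ 205 ∷ 14 ∷ 164 ∷ 74 ∷
    106 ∷ 47 ∷ 22 ∷ 121 ∷ 92 ∷ 38 ∷ 48 ∷ 233 ∷ 158 ∷ 174 ∷ 85 ∷ 13 ∷ 192 ∷ 16 ∷ 60 ∷ 39 ∷ 75 ∷ 165 ∷ 149 ∷ 146 ∷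
    159 ∷ 37 ∷ 152 ∷ 9 ∷ 15 ∷ 51 ∷ 34 ∷ 213 ∷ 78 ∷ 115 ∷ 144 ∷ 161 ∷ 122 ∷ 52 ∷ 170 ∷ 65 ∷ 211 ∷ 176 ∷ 4 ∷ 11 ∷
    118 ∷ 162 ∷ 153 ∷ 189 ∷ 207 ∷ 198 ∷ 132 ∷ 237 ∷ 120 ∷ 7 ∷ 32 ∷ []) ∷
  (343 , 213 ∷ 79 ∷ 337 ∷ 319 ∷ 258 ∷ 104 ∷ 52 ∷ 305 ∷ 308 ∷ 266 ∷ 19 ∷ 192 ∷ 7 ∷ 26 ∷ 94 ∷ 109 ∷ 254 ∷ 93 ∷ 137 ∷
    60 ∷ 145 ∷ 107 ∷ 268 ∷ 9 ∷ 221 ∷ 332 ∷ 159 ∷ 282 ∷ 208 ∷ 65 ∷ 193 ∷ 68 ∷ 133 ∷ 252 ∷ 323 ∷ 152 ∷ 326 ∷ 149 ∷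
    327 ∷ 281 ∷ 249 ∷ 80 ∷ 29 ∷ 164 ∷ 270 ∷ 131 ∷ 32 ∷ 189 ∷ 285 ∷ 120 ∷ 113 ∷ 36 ∷ 307 ∷ 315 ∷ 127 ∷ 235 ∷ 53 ∷
    161 ∷ 77 ∷ 255 ∷ 136 ∷ 227 ∷ 150 ∷ 143 ∷ 62 ∷ 156 ∷ 162 ∷ 102 ∷ 328 ∷ 273 ∷ 180 ∷ 274 ∷ 277 ∷ 338 ∷ 40 ∷ 48 ∷
    97 ∷ 115 ∷ 84 ∷ 296 ∷ 138 ∷ 142 ∷ 130 ∷ 135 ∷ 306 ∷ 341 ∷ 123 ∷ 132 ∷ 129 ∷ 207 ∷ 151 ∷ 157 ∷ 49 ∷ 167 ∷ 66 ∷
    313 ∷ 279 ∷ 265 ∷ 5 ∷ 177 ∷ 238 ∷ 46 ∷ 15 ∷ 96 ∷ 112 ∷ 203 ∷ 253 ∷ 194 ∷ 179 ∷ 75 ∷ 169 ∷ 122 ∷ 257 ∷ 212 ∷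
    280 ∷ 330 ∷ 92 ∷ 291 ∷ 91 ∷ 314 ∷ 57 ∷ 37 ∷ 114 ∷ 229 ∷ 295 ∷ 289 ∷ 72 ∷ 168 ∷ 160 ∷ 288 ∷ 211 ∷ 316 ∷ 98 ∷
    201 ∷ 264 ∷ 83 ∷ 271 ∷ 260 ∷ 239 ∷ 71 ∷ 215 ∷ 100 ∷ 325 ∷ 311 ∷ 230 ∷ 90 ∷ 82 ∷ 322 ∷ 56 ∷ 76 ∷ 173 ∷ 1 ∷
    200 ∷ 237 ∷ 55 ∷ 242 ∷ 293 ∷ 250 ∷ 336 ∷ 30 ∷ 74 ∷ 141 ∷ 134 ∷ 59 ∷ 18 ∷ 219 ∷ 340 ∷ 243 ∷ 199 ∷ 195 ∷ 294 ∷
    206 ∷ 222 ∷ 116 ∷ 342 ∷ 38 ∷ 309 ∷ 188 ∷ 331 ∷ 99 ∷ 86 ∷ 241 ∷ 147 ∷ 110 ∷ 154 ∷ 17 ∷ 320 ∷ 39 ∷ 51 ∷ 111 ∷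
    286 ∷ 335 ∷ 25 ∷ 124 ∷ 226 ∷ 148 ∷ 297 ∷ 140 ∷ 278 ∷ 16 ∷ 287 ∷ 263 ∷ 69 ∷ 106 ∷ 89 ∷ 209 ∷ 171 ∷ 50 ∷ 329 ∷
    24 ∷ 78 ∷ 324 ∷ 283 ∷ 317 ∷ 218 ∷ 187 ∷ 318 ∷ 119 ∷ 339 ∷ 165 ∷ 303 ∷ 21 ∷ 196 ∷ 236 ∷ 214 ∷ 198 ∷ 224 ∷ 267 ∷
    248 ∷ 31 ∷ 6 ∷ 58 ∷ 225 ∷ 300 ∷ 217 ∷ 310 ∷ 272 ∷ 10 ∷ 321 ∷ 85 ∷ 202 ∷ 299 ∷ 184 ∷ 54 ∷ 45 ∷ 251 ∷ 240 ∷
    223 ∷ 204 ∷ 28 ∷ 63 ∷ 43 ∷ 34 ∷ 261 ∷ 174 ∷ 13 ∷ 27 ∷ 302 ∷ 153 ∷ 190 ∷ 175 ∷ 33 ∷ 205 ∷ 3 ∷ 166 ∷ 42 ∷ 183 ∷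
    334 ∷ 181 ∷ 121 ∷ 23 ∷ 290 ∷ 117 ∷ 298 ∷ 2 ∷ 155 ∷ 185 ∷ 191 ∷ 146 ∷ 292 ∷ 256 ∷ 0 ∷ 182 ∷ 14 ∷ 301 ∷ 118 ∷
    234 ∷ 312 ∷ 64 ∷ 170 ∷ 172 ∷ 247 ∷ 22 ∷ 11 ∷ 101 ∷ 246 ∷ 333 ∷ 108 ∷ 125 ∷ 73 ∷ 70 ∷ 35 ∷ 4 ∷ 304 ∷ 139 ∷
    220 ∷ 61 ∷ 20 ∷ 158 ∷ 176 ∷ 197 ∷ 8 ∷ 269 ∷ 262 ∷ 276 ∷ 186 ∷ 231 ∷ 41 ∷ 178 ∷ 275 ∷ 244 ∷ 245 ∷ 105 ∷ 144 ∷
    126 ∷ 44 ∷ 95 ∷ 103 ∷ 67 ∷ 88 ∷ 87 ∷ 232 ∷ 128 ∷ 12 ∷ 210 ∷ 163 ∷ 259 ∷ 47 ∷ 233 ∷ 216 ∷ 81 ∷ 284 ∷ 228 ∷ []) ∷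
  []

tables-ok : all tableOk tables ≡ true
tables-ok = refl

-- Soundness of the explicit permutations

nth-tail : ∀ xs i → nth 0 (tail xs) i ≡ nth 0 xs (suc i)
nth-tail [] i = refl
nth-tail (_ ∷ _) i = refl

nth-++ˡ : ∀ xs ys i → i ℕ.< length xs → nth 0 (xs ++ ys) i ≡ nth 0 xs i
nth-++ˡ (x ∷ xs) ys zero _ = refl
nth-++ˡ (x ∷ xs) ys (suc i) (ℕ.s≤s lt) = nth-++ˡ xs ys i lt

nth-++ʳ : ∀ xs ys i → nth 0 (xs ++ ys) (length xs ℕ.+ i) ≡ nth 0 ys i
nth-++ʳ [] ys i = refl
nth-++ʳ (x ∷ xs) ys i = nth-++ʳ xs ys i

not⁻ : ∀ {b} → T (not b) → ¬ T b
not⁻ {false} _ ()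

module _ (n : ℕ) .{{_ : NonZero n}} where

  row⁻ : ∀ xs ys zs → T (row n xs ys zs) → ∀ i → i ℕ.< length xs → T (column n (nth 0 xs i) (nth 0 ys i) (nth 0 zs i))
  row⁻ (x ∷ xs) (y ∷ ys) (z ∷ zs) t zero _ = proj₁ (Equivalence.to (T-∧ {column n x y z}) t)
  row⁻ (x ∷ xs) (y ∷ ys) (z ∷ zs) t (suc i) (ℕ.s≤s lt) = row⁻ xs ys zs (proj₂ (Equivalence.to (T-∧ {column n x y z}) t)) i lt

  rows⁻ : ∀ k xs ys zs → T (rows n k xs ys zs) → ∀ j → j ℕ.< k → ∀ i → i ℕ.< length xs →
    T (column n (nth 0 xs i) (nth 0 ys (j ℕ.+ i)) (nth 0 zs (2 ℕ.* j ℕ.+ i)))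
  rows⁻ (suc k) xs ys zs t zero _ i lt = row⁻ xs ys zs (proj₁ (Equivalence.to (T-∧ {row n xs ys zs}) t)) i lt
  rows⁻ (suc k) xs ys zs t (suc j) (ℕ.s≤s j<k) i lt = subst (λ y → T (column n (nth 0 xs i) y (nth 0 zs (2 ℕ.* suc j ℕ.+ i)))) (nth-tail ys (j ℕ.+ i))
    (subst (λ z → T (column n (nth 0 xs i) (nth 0 (tail ys) (j ℕ.+ i)) z))
      (trans (nth-tail (tail zs) (2 ℕ.* j ℕ.+ i)) (trans (nth-tail zs (suc (2 ℕ.* j ℕ.+ i))) (cong (nth 0 zs) (lem j i))))
      (rows⁻ k xs (tail ys) (tail (tail zs)) (proj₂ (Equivalence.to (T-∧ {row n xs ys zs}) t)) j j<k i lt))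
    where
    lem : ∀ j i → 2 ℕ.+ (2 ℕ.* j ℕ.+ i) ≡ 2 ℕ.* suc j ℕ.+ i
    lem = ℕ.solve-∀

  -- Three copies suffice, as i + 2 r stays below 3 n.
  nth-periodic : ∀ l → length l ≡ n → ∀ m → m ℕ.< n ℕ.+ (n ℕ.+ n) → nth 0 (l ++ l ++ l) m ≡ nth 0 l (m ℕ.% n)
  nth-periodic l refl m m<3n with m ℕ.<? n
  ... | yes m<n = trans (nth-++ˡ l (l ++ l) m m<n) (cong (nth 0 l) (sym (ℕ.m<n⇒m%n≡m m<n)))
  ... | no m≮n with m ℕ.∸ n in eq | ℕ.m+[n∸m]≡n (ℕ.≮⇒≥ m≮n)
  ...   | m′ | n+m′ with m′ ℕ.<? n
  ...     | yes m′<n = trans (cong (nth 0 (l ++ l ++ l)) (sym n+m′)) (trans (nth-++ʳ l (l ++ l) m′) (trans (nth-++ˡ l l m′ m′<n)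
              (cong (nth 0 l) (trans (sym (ℕ.m<n⇒m%n≡m m′<n)) (trans (sym (ℕ.[m+n]%n≡m%n m′ n)) (cong (ℕ._% n) (trans (ℕ.+-comm m′ n) n+m′)))))))
  ...     | no m′≮n with m′ ℕ.∸ n | ℕ.m+[n∸m]≡n (ℕ.≮⇒≥ m′≮n)
  ...       | m″ | n+m″ = trans (cong (nth 0 (l ++ l ++ l)) (trans (sym n+m′) (cong (n ℕ.+_) (sym n+m″)))) (trans (nth-++ʳ l (l ++ l) (n ℕ.+ m″)) (trans (nth-++ʳ l l m″)
              (cong (nth 0 l) (trans (sym (ℕ.m<n⇒m%n≡m m″<n)) (trans (sym (ℕ.[m+n]%n≡m%n m″ n)) (trans (sym (ℕ.[m+n]%n≡m%n (m″ ℕ.+ n) n)) (cong (ℕ._% n) sum)))))))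
    where
    sum : m″ ℕ.+ n ℕ.+ n ≡ m
    sum = trans (cong (ℕ._+ n) (trans (ℕ.+-comm m″ n) n+m″)) (trans (ℕ.+-comm m′ n) n+m′)
    m″<n : m″ ℕ.< n
    m″<n = ℕ.+-cancelˡ-< n m″ n (ℕ.+-cancelˡ-< n (n ℕ.+ m″) (n ℕ.+ n) (subst (ℕ._< n ℕ.+ (n ℕ.+ n)) (trans (sym n+m′) (cong (n ℕ.+_) (sym n+m″))) m<3n))

  all-nth : ∀ (P : ℕ → Bool) xs → T (all P xs) → ∀ i → i ℕ.< length xs → T (P (nth 0 xs i))
  all-nth P (x ∷ xs) t zero _ = proj₁ (Equivalence.to (T-∧ {P x}) t)
  all-nth P (x ∷ xs) t (suc i) (ℕ.s≤s lt) = all-nth P xs (proj₂ (Equivalence.to (T-∧ {P x}) t)) i lt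

  module _ (l : List ℕ) (len : length l ≡ n) (bounded : T (all (_<ᵇ n) l))
    (ok : ∀ j → suc j ℕ.< n → ∀ i → i ℕ.< n → T (column n (nth 0 l i) (nth 0 l ((suc j ℕ.+ i) ℕ.% n)) (nth 0 l ((2 ℕ.* suc j ℕ.+ i) ℕ.% n)))) where

    private
      f : ℤ → ℕ
      f x = nth 0 l (x %ℕ n)

      f<n : ∀ x → f x ℕ.< n
      f<n x = ℕ.<ᵇ⇒< (f x) n (all-nth (_<ᵇ n) l bounded (x %ℕ n) (subst (x %ℕ n ℕ.<_) (sym len) (n%ℕd<d x n)))

      column⁻ : ∀ a r s → (r ≡ (s - a) %ℕ n) → ¬ Z n (s - a) → ∀ c → AP n a s c →
        ¬ f a ≡ f s × ¬ ((f a ℕ.+ f c) ℕ.% n ≡ (2 ℕ.* f s) ℕ.% n)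
      column⁻ a zero s r≡ ns c ap = contradiction (by (lem (s - a)) (subst (λ k → Z n (s - a - + k)) (sym r≡) (%ℕ-Z n (s - a)))) ns
        where
        lem : ∀ x → x - 0ℤ ≡ x
        lem = solve-∀
      column⁻ a (suc j) s r≡ ns c ap = (λ eq → not⁻ (proj₁ both) (ℕ.≡⇒≡ᵇ (f a) (f s) eq)) , (λ eq → not⁻ (proj₂ both) (ℕ.≡⇒≡ᵇ _ _ eq))
        where
        A : ℕ
        A = a %ℕ n
        r<n : suc j ℕ.< n
        r<n = subst (ℕ._< n) (sym r≡) (n%ℕd<d (s - a) n)
        r-Z : Z n (s - a - + suc j)
        r-Z = subst (λ k → Z n (s - a - + k)) (sym r≡) (%ℕ-Z n (s - a))
        s≡ : (suc j ℕ.+ A) ℕ.% n ≡ s %ℕ n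
        s≡ = %ℕ-cong (+ (suc j ℕ.+ A)) s (by (trans (lem s a (+ suc j) (+ A)) (cong (_- s) (sym (ℤ.pos-+ (suc j) A)))) (negᶻ r-Z -ᶻ %ℕ-Z n a))
          where
          lem : ∀ s a r A → - (s - a - r) - (a - A) ≡ r + A - s
          lem = solve-∀
        c≡ : (2 ℕ.* suc j ℕ.+ A) ℕ.% n ≡ c %ℕ n
        c≡ = %ℕ-cong (+ (2 ℕ.* suc j ℕ.+ A)) c (by (trans (lem s a c (+ suc j) (+ A)) (cong (_- c) (sym (trans (ℤ.pos-+ (2 ℕ.* suc j) A) (cong (_+ + A) (ℤ.pos-* 2 (suc j)))))))
            (negᶻ (+ 2 *ᶻ r-Z) -ᶻ %ℕ-Z n a -ᶻ ap))
          where
          lem : ∀ s a c r A → - (+ 2 * (s - a - r)) - (a - A) - (a + c - + 2 * s) ≡ + 2 * r + A - c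
          lem = solve-∀
        both : T (not (f a ≡ᵇ f s)) × T (not ((f a ℕ.+ f c) ℕ.% n ≡ᵇ (2 ℕ.* f s) ℕ.% n))
        both = Equivalence.to (T-∧ {not (f a ≡ᵇ f s)}) (subst (λ k → T (column n (f a) (nth 0 l k) (f c))) s≡
          (subst (λ k → T (column n (f a) (nth 0 l ((suc j ℕ.+ A) ℕ.% n)) (nth 0 l k))) c≡ (ok j r<n A (n%ℕd<d a n))))

    table⇒destroying : Destroying n
    table⇒destroying = record
      { image = λ x → + f x
      ; image-resp = λ a b z → ≡⇒Z (cong (λ i → + nth 0 l i) (%ℕ-cong a b z))
      ; image-inj = λ a b z → inj a b (Z? n (b - a)) (<⇒Z⇒≡ (f<n a) (f<n b) z)
      ; destroys = λ a b c d i → ap a b c d i (Z? n (b - a))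
      }
      where
      inj : ∀ a b → Dec (Z n (b - a)) → f a ≡ f b → Z n (a - b)
      inj a b (yes z) _ = Z-sym b a z
      -- Injectivity is read off from the same test, with a and b completed to a progression by 2 b
      -- - a.
      inj a b (no ¬z) eq = contradiction eq (proj₁ (column⁻ a _ b refl ¬z (+ 2 * b - a) (by (lem a b) Z0)))
        where
        lem : ∀ a b → 0ℤ ≡ a + (+ 2 * b - a) - + 2 * b
        lem = solve-∀
      ap : ∀ a b c → AP n a b c → AP n (+ f a) (+ f b) (+ f c) → Dec (Z n (b - a)) → Z n (a - b)
      ap a b c d i (yes z) = Z-sym b a z
      ap a b c d i (no ¬z) = contradiction (%ℕ-cong (+ (f a ℕ.+ f c)) (+ (2 ℕ.* f b)) (by (cong₂ _-_ (sym (ℤ.pos-+ (f a) (f c))) (sym (ℤ.pos-* 2 (f b)))) i))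
        (proj₂ (column⁻ a _ b refl ¬z c d))

tableOk⇒destroying : ∀ n l → T (tableOk (n , l)) → Destroying n
tableOk⇒destroying n@(suc m) l t = table⇒destroying n l len (proj₁ t₂) ok
  where
  t₁ = Equivalence.to (T-∧ {length l ≡ᵇ n}) t
  t₂ = Equivalence.to (T-∧ {all (_<ᵇ n) l}) (proj₂ t₁)
  len : length l ≡ n
  len = ℕ.≡ᵇ⇒≡ (length l) n (proj₁ t₁)
  three : List ℕ
  three = l ++ l ++ l
  ok : ∀ j → suc j ℕ.< n → ∀ i → i ℕ.< n → T (column n (nth 0 l i) (nth 0 l ((suc j ℕ.+ i) ℕ.% n)) (nth 0 l ((2 ℕ.* suc j ℕ.+ i) ℕ.% n)))
  ok j (ℕ.s≤s j<m) i i<n = subst (λ y → T (column n (nth 0 l i) y (nth 0 l ((2 ℕ.* suc j ℕ.+ i) ℕ.% n))))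
      (trans (nth-tail three (j ℕ.+ i)) (nth-periodic n l len (suc j ℕ.+ i) (ℕ.<-≤-trans (ℕ.+-mono-< (ℕ.s≤s j<m) i<n) (ℕ.+-monoʳ-≤ n (ℕ.m≤m+n n n)))))
      (subst (λ z → T (column n (nth 0 l i) (nth 0 (tail three) (j ℕ.+ i)) z))
        (trans (nth-tail (tail three) (2 ℕ.* j ℕ.+ i)) (trans (nth-tail three (suc (2 ℕ.* j ℕ.+ i))) (trans (cong (nth 0 three) (lem j i))
          (nth-periodic n l len (2 ℕ.* suc j ℕ.+ i) (subst (2 ℕ.* suc j ℕ.+ i ℕ.<_) (lem₃ n) (ℕ.+-mono-<-≤ (ℕ.*-monoʳ-< 2 (ℕ.s≤s j<m)) (ℕ.<⇒≤ i<n)))))))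
        (rows⁻ n m l (tail three) (tail (tail three)) (proj₂ t₂) j j<m i (subst (i ℕ.<_) (sym len) i<n)))
    where
    lem : ∀ j i → 2 ℕ.+ (2 ℕ.* j ℕ.+ i) ≡ 2 ℕ.* suc j ℕ.+ i
    lem = ℕ.solve-∀
    lem₃ : ∀ n → 2 ℕ.* n ℕ.+ n ≡ n ℕ.+ (n ℕ.+ n)
    lem₃ = ℕ.solve-∀

-- Primes above 112

-- Horner's scheme: the quotient of f by the linear polynomial with root e.
quotient : ℤ → Poly → Poly
quotient e [] = []
quotient e (c ∷ []) = []
quotient e (c ∷ f@(_ ∷ _)) = ev e f ∷ quotient e f

quotient-ev : ∀ e x f → ev x f ≡ (x - e) * ev x (quotient e f) + ev e f
quotient-ev e x [] = lem x e
  where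
  lem : ∀ x e → 0ℤ ≡ (x - e) * 0ℤ + 0ℤ
  lem = solve-∀
quotient-ev e x (c ∷ []) = lem x e c
  where
  lem : ∀ x e c → c + x * 0ℤ ≡ (x - e) * 0ℤ + (c + e * 0ℤ)
  lem = solve-∀
quotient-ev e x (c ∷ f@(_ ∷ _)) = trans (cong (λ t → c + x * t) (quotient-ev e x f)) (lem x e c (ev x (quotient e f)) (ev e f))
  where
  lem : ∀ x e c q v → c + x * ((x - e) * q + v) ≡ (x - e) * (v + x * q) + (c + e * v)
  lem = solve-∀

length-quotient : ∀ e c f → length (quotient e (c ∷ f)) ≡ length f
length-quotient e c [] = refl
length-quotient e c (d ∷ f) = cong suc (length-quotient e d f)

length-filter-¬ : ∀ {A : Set} {P : A → Set} (P? : ∀ x → Dec (P x)) xs → length (filter P? xs) ℕ.+ length (filter (¬? ∘ P?) xs) ≡ length xs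
length-filter-¬ P? [] = refl
length-filter-¬ P? (x ∷ xs) with P? x
... | yes _ = cong suc (length-filter-¬ P? xs)
... | no _ = trans (ℕ.+-suc _ _) (cong suc (length-filter-¬ P? xs))

module Regime (p : ℕ) (pr : Prime p) (112<p : 112 ℕ.< p) where

  10<p : 10 ℕ.< p
  10<p = ℕ.≤-trans (ℕ.m≤m+n 11 102) 112<p

  open Candidates p pr 10<p public

  private instance
    p≢0 : NonZero p
    p≢0 = prime⇒nonZero pr

  Distinct : List ℤ → Set
  Distinct = AllPairs (λ x y → ¬ Z p (x - y))

  -- The leading entry of the quotient is the value of the tail of f, so the constant term of f is
  -- the value of f minus e times that entry; the tail follows by recursion.
  coefficients-vanish : ∀ e f → Z p (ev e f) → All (Z p) (quotient e f) → All (Z p) f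
  coefficients-vanish e [] _ _ = []
  coefficients-vanish e (c ∷ []) z _ = by (lem c e) z ∷ []
    where
    lem : ∀ c e → c + e * 0ℤ ≡ c
    lem = solve-∀
  coefficients-vanish e (c ∷ f@(_ ∷ _)) z (zf ∷ h) = by (lem c e (ev e f)) (z -ᶻ (e *ᶻ zf)) ∷ coefficients-vanish e f zf h
    where
    lem : ∀ c e v → c + e * v - e * v ≡ c
    lem = solve-∀

  -- Dividing by one root leaves the others as roots of the quotient, because p is prime. So the
  -- quotient vanishes by induction, and f with it.
  too-many-roots : ∀ f es → Distinct es → All (λ e → Z p (ev e f)) es → length f ℕ.≤ length es → All (Z p) f
  too-many-roots [] es _ _ _ = []
  too-many-roots (c ∷ f) (e ∷ es) (d ∷ ds) (z ∷ zs) (ℕ.s≤s le) = coefficients-vanish e (c ∷ f) z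
    (too-many-roots (quotient e (c ∷ f)) es ds (All.zipWith root (d , zs)) (ℕ.≤-trans (ℕ.≤-reflexive (length-quotient e c f)) le))
    where
    lem : ∀ q v → q + v - v ≡ q
    lem = solve-∀
    root : ∀ {x} → ¬ Z p (e - x) × Z p (ev x (c ∷ f)) → Z p (ev x (quotient e (c ∷ f)))
    root {x} (ne , zx) = cancel (x - e) (ev x (quotient e (c ∷ f))) (λ w → ne (Z-sym x e w))
      (by (lem ((x - e) * ev x (quotient e (c ∷ f))) (ev e (c ∷ f))) (by (quotient-ev e x (c ∷ f)) zx -ᶻ z))

  -- Each polynomial removes at most `degree f` elements from the list, so one element outlasts all
  -- of them.
  sieve : ∀ fs es → All (λ f → ¬ All (Z p) f) fs → Distinct es → ℕ.sum (map degree fs) ℕ.< length es →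
    ∃[ e ] e ∈ es × All (λ f → ¬ Z p (ev e f)) fs
  sieve [] (e ∷ es) _ _ _ = e , here refl , []
  sieve (f ∷ fs) es (u ∷ us) ds lt with sieve fs (filter (¬? ∘ λ e → Z? p (ev e f)) es) us (AllPairs.filter⁺ _ ds) bound
    where
    P? = λ e → Z? p (ev e f)
    few : length (filter P? es) ℕ.≤ degree f
    few with length f ℕ.≤? length (filter P? es)
    ... | yes le = contradiction (too-many-roots f (filter P? es) (AllPairs.filter⁺ P? ds) (All.all-filter P? es) le) u
    ... | no ¬le = ℕ.≤-pred (ℕ.≤-trans (ℕ.≰⇒> ¬le) (ℕ.≤-trans (ℕ.m≤n+m∸n (length f) 1) (ℕ.≤-reflexive refl)))
    bound : ℕ.sum (map degree fs) ℕ.< length (filter (¬? ∘ P?) es)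
    bound = ℕ.+-cancelˡ-< (degree f) _ _ (ℕ.<-≤-trans lt (ℕ.≤-trans (ℕ.≤-reflexive (sym (length-filter-¬ P? es))) (ℕ.+-monoˡ-≤ _ few)))
  ... | e , e∈ , h with ∈-filter⁻ (¬? ∘ λ e → Z? p (ev e f)) {xs = es} e∈
  ...   | e∈′ , ne = e , e∈′ , ne ∷ h

  below113 : ℕ → Bool
  below113 d = (0 <ᵇ d) ∧ (d <ᵇ 113)

  below113⁻ : ∀ ds → T (all below113 ds) → All (λ d → ¬ p ℕ.∣ d) ds
  below113⁻ ds t = All.map (λ {d} → nonDivisor d) (all⁻ below113 ds t)
    where
    nonDivisor : ∀ d → T (below113 d) → ¬ p ℕ.∣ d
    nonDivisor (suc d) t dv = small (suc d) (ℕ.<-≤-trans (ℕ.<ᵇ⇒< (suc d) 113 t) 112<p) (∣ᵤ⇒∣ dv)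

  smallPrimes-∤ : All (λ d → ¬ p ℕ.∣ d) smallPrimes
  smallPrimes-∤ = below113⁻ smallPrimes tt

  hasUnit⁻ : ∀ k ds f → All (λ d → ¬ p ℕ.∣ d) ds → T (hasUnit k ds f) → ¬ All (Z p) f
  hasUnit⁻ k ds f hd t h with find (Any.any⁻ (λ c → strip k ds ∣ c ∣ ≡ᵇ 1) f t)
  ... | c , c∈ , s = strip-sound k ds ∣ c ∣ hd (ℕ.≡ᵇ⇒≡ (strip k ds ∣ c ∣) 1 s) (∣⇒∣ᵤ (All.lookup h c∈))

  hasUnits⁻ : ∀ k ds fs → All (λ d → ¬ p ℕ.∣ d) ds → all (hasUnit k ds) fs ≡ true → All (λ f → ¬ All (Z p) f) fs
  hasUnits⁻ k ds fs hd eq = All.map (λ {f} → hasUnit⁻ k ds f hd) (all⁻ (hasUnit k ds) fs (subst T (sym eq) tt))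

  Below : ℕ → Set
  Below N = ∀ n → 0 ℕ.< n → n ℕ.< N → Res (+ n)

  below-Sg : ∀ {N} → N ℕ.≤ p → Below N → ∀ n → 0 ℕ.< n → n ℕ.< N → Sg true (+ n)
  below-Sg N≤p h n@(suc _) 0<n n<N = small n (ℕ.<-≤-trans n<N N≤p) , h n 0<n n<N

  -- There are at most (p + 1) / 2 squares.
  someNonResidue : ¬ Below p
  someNonResidue h = square-roots-collide
    where
    half : ℕ
    half = p ℕ./ 2
    p-split : p ≡ p ℕ.% 2 ℕ.+ half ℕ.* 2
    p-split = ℕ.m≡m%n+[m/n]*n p 2
    residue : ∀ x → x ℕ.< p → Res (+ x)
    residue zero _ = 0ℤ , Z0
    residue (suc x) lt = h (suc x) (ℕ.s≤s ℕ.z≤n) lt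
    smallRoot : ∀ x → x ℕ.< p → ∃[ t ] t ℕ.< suc (suc half) × Z p (+ t * + t - + x)
    smallRoot x lt with residue x lt
    ... | t , z with suc (suc half) ℕ.≤? (t %ℕ p)
    ...   | no ¬le = t %ℕ p , ℕ.≰⇒> ¬le , square-resp t (+ (t %ℕ p)) (+ x) (%ℕ-Z p t) z
    -- The larger of the two square roots r and p - r is exchanged for the smaller: u² - r² is
    -- divisible by u + r = p.
    ...   | yes le = p ℕ.∸ t %ℕ p , ℕ.≤-<-trans bound (ℕ.n<1+n (suc half)) , by (lem (+ (p ℕ.∸ t %ℕ p)) (+ (t %ℕ p)) (+ x))
              (((+ (p ℕ.∸ t %ℕ p) - + (t %ℕ p)) *ᶻ by sum (by (ℤ.*-identityˡ (+ p)) (Z-self 1ℤ))) +ᶻ square-resp t (+ (t %ℕ p)) (+ x) (%ℕ-Z p t) z)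
      where
      lem : ∀ u r x → (u - r) * (u + r) + (r * r - x) ≡ u * u - x
      lem = solve-∀
      sum : + p ≡ + (p ℕ.∸ t %ℕ p) + + (t %ℕ p)
      sum = trans (cong +_ (sym (ℕ.m∸n+n≡m (ℕ.<⇒≤ (n%ℕd<d t p))))) (ℤ.pos-+ (p ℕ.∸ t %ℕ p) (t %ℕ p))
      bound : p ℕ.∸ t %ℕ p ℕ.≤ suc half
      bound = ℕ.m≤n+o⇒m∸n≤o p (t %ℕ p) (ℕ.≤-trans (ℕ.≤-reflexive p-split) (ℕ.≤-trans (ℕ.+-monoˡ-≤ (half ℕ.* 2) (ℕ.≤-pred (ℕ.m%n<n p 2)))
        (ℕ.≤-trans (ℕ.≤-reflexive (cong suc (trans (ℕ.*-comm half 2) (cong (half ℕ.+_) (ℕ.+-identityʳ half))))) (ℕ.+-mono-≤ {suc half} (ℕ.≤-trans (ℕ.n≤1+n _) le) (ℕ.n≤1+n half)))))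
    half+2<p : suc (suc half) ℕ.< p
    half+2<p = subst (suc (suc half) ℕ.<_) (sym p-split) (ℕ.<-≤-trans (ℕ.≤-trans (ℕ.≤-reflexive (ℕ.+-comm 3 half)) (ℕ.≤-trans (ℕ.+-monoʳ-≤ half 3≤half) (ℕ.≤-reflexive (trans (cong (half ℕ.+_) (sym (ℕ.+-identityʳ half))) (ℕ.*-comm 2 half))))) (ℕ.m≤n+m (half ℕ.* 2) (p ℕ.% 2)))
      where
      3≤half : 3 ℕ.≤ half
      3≤half with 3 ℕ.≤? half
      ... | yes le = le
      ... | no ¬le = contradiction 112<p (ℕ.≤⇒≯ (ℕ.≤-trans (ℕ.≤-reflexive p-split) (ℕ.≤-trans (ℕ.+-mono-≤ (ℕ.≤-pred (ℕ.m%n<n p 2)) (ℕ.*-monoˡ-≤ 2 (ℕ.≤-pred (ℕ.≰⇒> ¬le)))) (ℕ.m≤m+n 5 107))))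
    root : (x : Fin p) → ∃[ t ] t ℕ.< suc (suc half) × Z p (+ t * + t - + toℕ x)
    root x = smallRoot (toℕ x) (Fin.toℕ<n x)
    square-roots-collide : ⊥
    square-roots-collide with Fin.pigeonhole half+2<p (λ x → fromℕ< (proj₁ (proj₂ (root x))))
    ... | x , y , x<y , eq = Fin.<-irrefl (Fin.toℕ-injective (<⇒Z⇒≡ (Fin.toℕ<n x) (Fin.toℕ<n y)
          (by (lem (+ proj₁ (root x) * + proj₁ (root x)) (+ toℕ x) (+ toℕ y))
            (subst (λ t → Z p (+ t * + t - + toℕ y)) (sym same-root) (proj₂ (proj₂ (root y))) -ᶻ proj₂ (proj₂ (root x)))))) x<y
      where
      lem : ∀ s x y → (s - y) - (s - x) ≡ x - y
      lem = solve-∀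
      same-root : proj₁ (root x) ≡ proj₁ (root y)
      same-root = trans (sym (Fin.toℕ-fromℕ< (proj₁ (proj₂ (root x))))) (trans (cong toℕ eq) (Fin.toℕ-fromℕ< (proj₁ (proj₂ (root y)))))

  leastNonResidue : ∃[ N ] 0 ℕ.< N × N ℕ.< p × NonRes (+ N) × Below N
  leastNonResidue = [ (λ x → x) , (λ h → contradiction h someNonResidue) ]′ (search p ℕ.≤-refl)
    where
    search : ∀ m → m ℕ.≤ p → (∃[ N ] 0 ℕ.< N × N ℕ.< p × NonRes (+ N) × Below N) ⊎ Below m
    search zero _ = inj₂ (λ _ _ ())
    search (suc m) le with search m (ℕ.<⇒≤ le)
    ... | inj₁ found = inj₁ found
    ... | inj₂ h with m | res⊎nonRes (+ m)
    ...   | zero | _ = inj₂ (λ n 0<n n<1 → contradiction n<1 (ℕ.≤⇒≯ 0<n))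
    ...   | suc m′ | inj₂ n = inj₁ (suc m′ , ℕ.s≤s ℕ.z≤n , le , n , h)
    ...   | suc m′ | inj₁ r = inj₂ (λ n 0<n n<m → [ h n 0<n , (λ { refl → r }) ]′ (ℕ.m≤n⇒m<n∨m≡n (ℕ.≤-pred n<m)))

  module _ (N : ℕ) (0<N : 0 ℕ.< N) (N<p : N ℕ.< p) (N-nr : NonRes (+ N)) (below : Below N) where

    private
      residue : ∀ n → 0 ℕ.< n → n ℕ.< N → Sg true (+ n)
      residue = below-Sg (ℕ.<⇒≤ N<p) below

      _*ˢ_ : ∀ {m n} → Sg true (+ m) → Sg true (+ n) → Sg true (+ (m ℕ.* n))
      _*ˢ_ {m} {n} sm sn = subst (Sg true) (sym (ℤ.pos-* m n)) (Sg-* true true (+ m) (+ n) sm sn)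

      exact : ∀ m d .{{_ : NonZero d}} → T ((m ℕ.% d) ≡ᵇ 0) → m ≡ (m ℕ./ d) ℕ.* d
      exact m d t = trans (ℕ.m≡m%n+[m/n]*n m d) (cong (ℕ._+ (m ℕ./ d) ℕ.* d) (ℕ.≡ᵇ⇒≡ (m ℕ.% d) 0 t))

    splits-sound : ∀ k ds m → T (splits k N ds m) → Sg true (+ m)
    splits-sound (suc k) ds m@(suc _) t with m <ᵇ N in r | ds
    ... | true | _ = residue m (ℕ.s≤s ℕ.z≤n) (ℕ.<ᵇ⇒< m N (subst T (sym r) tt))
    ... | false | d@(suc _) ∷ ds′ with (m ℕ.% d) ≡ᵇ 0 in r′
    ...   | false = splits-sound k ds′ m t
    ...   | true with Equivalence.to (T-∧ {d <ᵇ N}) t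
    ...     | lt , t′ = subst (λ n → Sg true (+ n)) (sym (exact m d (subst T (sym r′) tt)))
                (splits-sound k (d ∷ ds′) (m ℕ./ d) t′ *ˢ residue d (ℕ.s≤s ℕ.z≤n) (ℕ.<ᵇ⇒< d N lt))

    signBelow-sound : ∀ k ds → Sound (signBelow k ds N)
    signBelow-sound k ds = go N refl
      where
      go : ∀ M → M ≡ N → ∀ {x s} → signBelow k ds M x ≡ just s → Sg s x
      go (suc M) refl {+ n} eq with (n ℕ.% suc M) ≡ᵇ 0 in r
      go (suc M) refl {+ n} eq | true with splits k (suc M) ds (n ℕ./ suc M) in r′
      go (suc M) refl {+ n} refl | true | true = subst NonRes (trans (sym (ℤ.pos-* (n ℕ./ suc M) (suc M))) (cong +_ (sym (exact n (suc M) (subst T (sym r) tt)))))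
        (Sg-* true false (+ (n ℕ./ suc M)) (+ suc M) (splits-sound k ds (n ℕ./ suc M) (subst T (sym r′) tt)) N-nr)
      go (suc M) refl {+ n} eq | false with splits k (suc M) ds n in r′
      go (suc M) refl {+ n} refl | false | true = splits-sound k ds n (subst T (sym r′) tt)

    N-∤ : ¬ p ℕ.∣ N
    N-∤ d = nonRes⇒¬Z (+ N) N-nr (∣ᵤ⇒∣ d)

    -- Otherwise N would be a product of two smaller numbers, both residues.
    composite-impossible : ∀ d → ¬ T (properDivisor N d)
    composite-impossible d@(suc _) t with Equivalence.to (T-∧ {1 <ᵇ d}) t
    ... | 1<d , t′ with Equivalence.to (T-∧ {d <ᵇ N}) t′
    ...   | d<N , r = N-nr (proj₁ root) (subst (λ n → Z p (proj₁ root * proj₁ root - + n)) (sym N≡) (proj₂ root))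
      where
      N≡ : N ≡ (N ℕ./ d) ℕ.* d
      N≡ = exact N d r
      instance
        N≢0 : NonZero N
        N≢0 = ℕ.>-nonZero 0<N
      0<N/d : 0 ℕ.< N ℕ./ d
      0<N/d = ℕ.n≢0⇒n>0 (λ e → ℕ.n≮0 (subst (0 ℕ.<_) (trans N≡ (cong (ℕ._* d) e)) 0<N))
      root : Res (+ ((N ℕ./ d) ℕ.* d))
      root = proj₂ (residue (N ℕ./ d) 0<N/d (ℕ.m/n<m N d (ℕ.<ᵇ⇒< 1 d 1<d)) *ˢ residue d (ℕ.s≤s ℕ.z≤n) (ℕ.<ᵇ⇒< d N d<N))

    grouped : ∀ k → T (groupsOk N k) → ∃[ e ] All (Holds e) (wantedOf s∀)
    grouped k ok with group-sound (signBelow-sound 100 smallPrimes) (N ∷ smallPrimes) (List.take k (candidatesFor N)) (N-∤ ∷ smallPrimes-∤) ok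
    ... | c , c∈ , e , h = e , subst (All (Holds e)) (All.lookup wanted≡ c∈) h
      where
      wanted≡ : All (λ c → Candidate.wanted c ≡ wantedOf s∀) (List.take k (candidatesFor N))
      wanted≡ = All.take⁺ k (All.map⁺ (All.universal (λ _ → refl) _))

    tabulated : T (leastOk N) → ∃[ e ] All (Holds e) (wantedOf s∀)
    tabulated t = [ (λ t′ → let d , _ , t″ = find (Any.any⁻ (properDivisor N) smallPrimes t′) in ⊥-elim (composite-impossible d t″))
                  , (λ t′ → let k , _ , t″ = find (Any.any⁻ (groupsOk N) (9 ∷ 20 ∷ []) t′) in grouped k t″) ]′
                  (Equivalence.to (T-∨ {any (properDivisor N) smallPrimes} {any (groupsOk N) (9 ∷ 20 ∷ [])}) t)

    -- For e = (y - N) / y the four discriminants multiplied by y² are N times x, y, N + 8 y = x + 9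
    -- y and 9 N - 8 y = 9 x + y: each a residue times the nonresidue N.
    discs-at : ∀ x y e → x ≡ + N - y → Z p (y * e - (y - + N)) → Sg true x → Sg true y →
      Sg true (+ N + + 8 * y) → Sg true (+ 9 * + N - + 8 * y) → All (Holds e) (map nr (System.discs s∀))
    discs-at x y e x≡ ze sx sy s₁ s₂ =
        disc (0ℤ ∷ -1ℤ ∷ 1ℤ ∷ []) x tt sx (trans (cong (_* + N) x≡) (lem₁ (+ N) y))
      ∷ disc (1ℤ ∷ -1ℤ ∷ 0ℤ ∷ []) y tt sy (lem₂ (+ N) y)
      ∷ disc (+ 9 ∷ -[1+ 9 ] ∷ 1ℤ ∷ []) (+ N + + 8 * y) tt s₁ (lem₃ (+ N) y)
      ∷ disc (1ℤ ∷ -[1+ 9 ] ∷ + 9 ∷ []) (+ 9 * + N - + 8 * y) tt s₂ (lem₄ (+ N) y)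
      ∷ []
      where
      disc : ∀ f u → T (shortOdd f) → Sg true u → u * + N ≡ hev (y - + N) y f → NonRes (ev e f)
      disc f u so su eq = hev-nr (y - + N) y e f ze (proj₁ sy) so (subst NonRes eq (Sg-* true false u (+ N) su N-nr))
      lem₁ : ∀ N y → (N - y) * N ≡ + 0 * (y * (y * + 1)) + (y - N) * (-[1+ 0 ] * (y * + 1) + (y - N) * (+ 1 * + 1 + (y - N) * + 0))
      lem₁ = solve-∀
      lem₂ : ∀ N y → y * N ≡ + 1 * (y * (y * + 1)) + (y - N) * (-[1+ 0 ] * (y * + 1) + (y - N) * (+ 0 * + 1 + (y - N) * + 0))
      lem₂ = solve-∀
      lem₃ : ∀ N y → (N + + 8 * y) * N ≡ + 9 * (y * (y * + 1)) + (y - N) * (-[1+ 9 ] * (y * + 1) + (y - N) * (+ 1 * + 1 + (y - N) * + 0))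
      lem₃ = solve-∀
      lem₄ : ∀ N y → (+ 9 * N - + 8 * y) * N ≡ + 1 * (y * (y * + 1)) + (y - N) * (-[1+ 9 ] * (y * + 1) + (y - N) * (+ 9 * + 1 + (y - N) * + 0))
      lem₄ = solve-∀

    -- Here 5 ∣ N + 72 h, so x = N - 9 h, y = 9 h, x + 9 y = N + 72 h and
    -- 9 x + y = 9 (N - 8 h) are products of numbers below N: h ≤ 529, and
    -- N + 72 * 529 < 5 N. The 105 values of h outnumber the roots of all the
    -- polynomials that e = -x / y has to avoid.
    module _ (9600≤N : 9600 ℕ.≤ N) where

      abstract

        h : ℕ → ℕ
        h t = (2 ℕ.* N) ℕ.% 5 ℕ.+ suc t ℕ.* 5

        h≤529 : ∀ {t} → t ℕ.< 105 → h t ℕ.≤ 529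
        h≤529 t<105 = ℕ.+-mono-≤ (ℕ.≤-pred (ℕ.m%n<n (2 ℕ.* N) 5)) (ℕ.*-monoˡ-≤ 5 t<105)

        0<h : ∀ t → 0 ℕ.< h t
        0<h t = ℕ.≤-trans (ℕ.s≤s ℕ.z≤n) (ℕ.m≤n+m (suc t ℕ.* 5) ((2 ℕ.* N) ℕ.% 5))

        h-injective : ∀ s t → h s ≡ h t → s ≡ t
        h-injective s t eq = ℕ.suc-injective (ℕ.*-cancelʳ-≡ (suc s) (suc t) 5 (ℕ.+-cancelˡ-≡ ((2 ℕ.* N) ℕ.% 5) (suc s ℕ.* 5) (suc t ℕ.* 5) eq))

        -- As h ≡ 2 N modulo 5, the sum is ≡ 145 N = 5 · 29 N. The remaining terms of the witness
        -- account for 2 N = r + 5 d and for the multiple of 5 in h.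
        multiple-of-5 : ∀ t → ∃[ m ] N ℕ.+ 72 ℕ.* h t ≡ m ℕ.* 5
        multiple-of-5 t = 29 ℕ.* N ℕ.+ 72 ℕ.* suc t ℕ.∸ 72 ℕ.* d , sym (trans (ℕ.*-distribʳ-∸ 5 (29 ℕ.* N ℕ.+ 72 ℕ.* suc t) (72 ℕ.* d))
            (trans (cong (ℕ._∸ 72 ℕ.* d ℕ.* 5) step) (ℕ.m+n∸n≡m (N ℕ.+ 72 ℕ.* h t) (72 ℕ.* d ℕ.* 5))))
          where
          r d : ℕ
          r = (2 ℕ.* N) ℕ.% 5
          d = (2 ℕ.* N) ℕ./ 5
          lem₁ : ∀ N t → (29 ℕ.* N ℕ.+ 72 ℕ.* t) ℕ.* 5 ≡ N ℕ.+ 72 ℕ.* (2 ℕ.* N) ℕ.+ 360 ℕ.* t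
          lem₁ = ℕ.solve-∀
          lem₂ : ∀ N r d t → N ℕ.+ 72 ℕ.* (r ℕ.+ d ℕ.* 5) ℕ.+ 360 ℕ.* t ≡ (N ℕ.+ 72 ℕ.* (r ℕ.+ t ℕ.* 5)) ℕ.+ 72 ℕ.* d ℕ.* 5
          lem₂ = ℕ.solve-∀
          step : (29 ℕ.* N ℕ.+ 72 ℕ.* suc t) ℕ.* 5 ≡ (N ℕ.+ 72 ℕ.* h t) ℕ.+ 72 ℕ.* d ℕ.* 5
          step = trans (lem₁ N (suc t)) (trans (cong (λ u → N ℕ.+ 72 ℕ.* u ℕ.+ 360 ℕ.* suc t) (ℕ.m≡m%n+[m/n]*n (2 ℕ.* N) 5)) (lem₂ N r d (suc t)))

      e : ℕ → ℤ
      e t = 1ℤ - + N * J (+ (9 ℕ.* h t))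

      9h<N : ∀ {t} → t ℕ.< 105 → 9 ℕ.* h t ℕ.< N
      9h<N t<105 = ℕ.≤-trans (ℕ.s≤s (ℕ.*-monoʳ-≤ 9 (h≤529 t<105))) (ℕ.≤-trans (ℕ.m≤m+n 4762 4838) 9600≤N)

      discs-hold : ∀ {t} → t ℕ.< 105 → All (Holds (e t)) (map nr (System.discs s∀))
      discs-hold {t} t<105 = discs-at (+ (N ℕ.∸ 9 ℕ.* h t)) (+ (9 ℕ.* h t)) (e t) (monus (9 ℕ.* h t) (ℕ.<⇒≤ (9h<N t<105)))
          (by (lem (+ N) (+ (9 ℕ.* h t)) (J (+ (9 ℕ.* h t)))) (- + N *ᶻ J-inv (+ (9 ℕ.* h t)) (proj₁ sy))) sx sy s₅ₘ sw
        where
        lem : ∀ N y j → - N * (y * j - 1ℤ) ≡ y * (1ℤ - N * j) - (y - N)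
        lem = solve-∀
        monus : ∀ a → a ℕ.≤ N → + (N ℕ.∸ a) ≡ + N - + a
        monus a le = trans (sym (ℤ.⊖-≥ le)) (sym (ℤ.m-n≡m⊖n N a))
        8h<N : 8 ℕ.* h t ℕ.< N
        8h<N = ℕ.≤-<-trans (ℕ.*-monoˡ-≤ (h t) (ℕ.m≤m+n 8 1)) (9h<N t<105)
        sx : Sg true (+ (N ℕ.∸ 9 ℕ.* h t))
        sx = residue (N ℕ.∸ 9 ℕ.* h t) (ℕ.m<n⇒0<n∸m (9h<N t<105)) (ℕ.∸-monoʳ-< (ℕ.*-mono-< (ℕ.s≤s (ℕ.z≤n {8})) (0<h t)) (ℕ.<⇒≤ (9h<N t<105)))
        sy : Sg true (+ (9 ℕ.* h t))
        sy = residue (9 ℕ.* h t) (ℕ.*-mono-< (ℕ.s≤s (ℕ.z≤n {8})) (0<h t)) (9h<N t<105)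
        s₅ₘ : Sg true (+ N + + 8 * + (9 ℕ.* h t))
        s₅ₘ with multiple-of-5 t
        ... | m , eq = subst (Sg true) (trans (cong +_ (sym eq)) (trans (ℤ.pos-+ N (72 ℕ.* h t)) (cong (λ u → + N + u) 72h)))
              (residue m 0<m m<N *ˢ residue 5 (ℕ.s≤s ℕ.z≤n) (ℕ.≤-trans (ℕ.m≤m+n 6 9594) 9600≤N))
          where
          lem₇₂ : ∀ h → + 72 * h ≡ + 8 * (+ 9 * h)
          lem₇₂ = solve-∀
          72h : + (72 ℕ.* h t) ≡ + 8 * + (9 ℕ.* h t)
          72h = trans (ℤ.pos-* 72 (h t)) (trans (lem₇₂ (+ h t)) (cong (+ 8 *_) (sym (ℤ.pos-* 9 (h t)))))
          0<m : 0 ℕ.< m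
          0<m = ℕ.n≢0⇒n>0 (λ z → ℕ.n≮0 (ℕ.<-≤-trans 0<N (ℕ.≤-trans (ℕ.m≤m+n N (72 ℕ.* h t)) (ℕ.≤-reflexive (trans eq (cong (ℕ._* 5) z))))))
          m<N : m ℕ.< N
          m<N = ℕ.*-cancelʳ-< 5 m N (ℕ.≤-<-trans (ℕ.≤-reflexive (sym eq)) (ℕ.<-≤-trans
            (ℕ.+-monoʳ-< N (ℕ.<-≤-trans (ℕ.≤-<-trans (ℕ.*-monoʳ-≤ 72 (h≤529 t<105)) (ℕ.m≤m+n 38089 311)) (ℕ.*-monoʳ-≤ 4 9600≤N))) (ℕ.≤-reflexive (ℕ.*-comm 5 N))))
        sw : Sg true (+ 9 * + N - + 8 * + (9 ℕ.* h t))
        sw = subst (Sg true) (trans (ℤ.pos-* 9 (N ℕ.∸ 8 ℕ.* h t)) (trans (cong (+ 9 *_) (trans (monus (8 ℕ.* h t) (ℕ.<⇒≤ 8h<N)) (cong (λ u → + N - u) (ℤ.pos-* 8 (h t)))))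
              (trans (lem₉ (+ N) (+ h t)) (cong (λ u → + 9 * + N - + 8 * u) (sym (ℤ.pos-* 9 (h t)))))))
            (residue 9 (ℕ.s≤s ℕ.z≤n) (ℕ.≤-trans (ℕ.m≤m+n 10 9590) 9600≤N) *ˢ residue (N ℕ.∸ 8 ℕ.* h t) (ℕ.m<n⇒0<n∸m 8h<N)
              (ℕ.∸-monoʳ-< (ℕ.*-mono-< (ℕ.s≤s (ℕ.z≤n {7})) (0<h t)) (ℕ.<⇒≤ 8h<N)))
          where
          lem₉ : ∀ N h → + 9 * (N - + 8 * h) ≡ + 9 * N - + 8 * (+ 9 * h)
          lem₉ = solve-∀

      -- Inversion is injective and N is invertible, and the values 9 h are distinct integers below
      -- N, hence distinct modulo p.
      distinct : ∀ {s t} → s ℕ.< t → t ℕ.< 105 → ¬ Z p (e s - e t)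
      distinct {s} {t} s<t t<105 z = ℕ.<-irrefl (h-injective s t (ℕ.*-cancelˡ-≡ (h s) (h t) 9
          (<⇒Z⇒≡ (ℕ.<-trans (9h<N s<105) N<p) (ℕ.<-trans (9h<N t<105) N<p) same))) s<t
        where
        s<105 = ℕ.<-trans s<t t<105
        lem : ∀ N a b → (1ℤ - N * a) - (1ℤ - N * b) ≡ N * (b - a)
        lem = solve-∀
        same : Z p (+ (9 ℕ.* h s) - + (9 ℕ.* h t))
        same = Z-sym (+ (9 ℕ.* h t)) (+ (9 ℕ.* h s)) (J-inj (+ (9 ℕ.* h t)) (+ (9 ℕ.* h s)) (cancel (+ N) _ (nonRes⇒¬Z (+ N) N-nr)
          (by (lem (+ N) (J (+ (9 ℕ.* h s))) (J (+ (9 ℕ.* h t)))) z)))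

      units : All (λ f → ¬ All (Z p) f) (System.polys s∀)
      units = hasUnits⁻ 100 smallPrimes (System.polys s∀) smallPrimes-∤ obstructions-nonzero

      fewer : ℕ.sum (map degree (System.polys s∀)) ℕ.< length (applyUpTo e 105)
      fewer = subst (ℕ.sum (map degree (System.polys s∀)) ℕ.<_) (sym (List.length-applyUpTo e 105)) (ℕ.<ᵇ⇒< (ℕ.sum (map degree (System.polys s∀))) 105 (subst T (sym fewObstructions) tt))

      avoiding : ∃[ e′ ] e′ ∈ applyUpTo e 105 × All (λ f → ¬ Z p (ev e′ f)) (System.polys s∀)
      avoiding = sieve (System.polys s∀) (applyUpTo e 105) units (AllPairs.applyUpTo⁺₁ e 105 distinct) fewer

      large : ∃[ e ] All (Holds e) (wantedOf s∀)
      large = finish avoiding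
        where
        finish : ∃[ e′ ] e′ ∈ applyUpTo e 105 × All (λ f → ¬ Z p (ev e′ f)) (System.polys s∀) → ∃[ e ] All (Holds e) (wantedOf s∀)
        finish (e′ , e′∈ , h′) with ∈-applyUpTo⁻ e e′∈
        ... | t , t<105 , e′≡ = e′ , All.++⁺ (All.map⁺ {P = Holds e′} {f = nz} h′) (subst (λ e → All (Holds e) (map nr (System.discs s∀))) (sym e′≡) (discs-hold t<105))

  table⁻ : ∀ k n m → Table k n → n ℕ.≤ m → m ℕ.< n ℕ.+ k → leastOk m ≡ true
  table⁻ k n m (table eq) = allFrom⁻ leastOk k n m eq

  solution : Below 43 → ∃[ e ] All (Holds e) (wantedOf s∀)
  solution residues = finish leastNonResidue
    where
    finish : ∃[ N ] 0 ℕ.< N × N ℕ.< p × NonRes (+ N) × Below N → ∃[ e ] All (Holds e) (wantedOf s∀)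
    finish (N , 0<N , N<p , N-nr , below) with ℕ.<-≤-connex N 43 | ℕ.<-≤-connex N 9600
    ... | inj₁ N<43 | _ = let t , z = residues N 0<N N<43 in contradiction z (N-nr t)
    ... | inj₂ 43≤N | inj₁ N<9600 = tabulated N 0<N N<p N-nr below (subst T (sym (table⁻ 9557 43 N leastOk-all 43≤N N<9600)) tt)
    ... | inj₂ _ | inj₂ 9600≤N = large N 0<N N<p N-nr below 9600≤N

-- All five moduli for a prime above 112

record Solved (p : ℕ) : Set where
  constructor solved
  field
    one : Destroying (1 ℕ.* p)
    two : Destroying (2 ℕ.* p)
    three : Destroying (3 ℕ.* p)
    five : Destroying (5 ℕ.* p)
    seven : Destroying (7 ℕ.* p)

module Assemble (p : ℕ) (pr : Prime p) (10<p : 10 ℕ.< p) where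

  open Candidates p pr 10<p public

  build : ∀ q .{{_ : NonZero q}} → q ℕ.< p → ∀ C {e} → All (Holds e) (Requirements.reqs q C) → Destroying (q ℕ.* p)
  build q@(suc _) q<p C {e} h = Soundness.destroying p pr 2<p q (¬Z⇒coprime (+ q) (small q q<p)) (Cop.sym (¬Z⇒coprime (+ q) (small q q<p))) C e h

  fromSystem : ∀ q .{{_ : NonZero q}} → q ℕ.< p → ∀ C s {e} → all (covers s) (Requirements.reqs q C) ≡ true →
    All (λ d → ¬ p ℕ.∣ d) (System.units s) → All (Holds e) (wantedOf s) → Destroying (q ℕ.* p)
  fromSystem q q<p C s {e} cov units h = build q q<p C {e} (All.map (λ {r} → covers-sound s {e} units h r) (all⁻ (covers s) (Requirements.reqs q C) (subst T (sym cov) tt)))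

  1<p : 1 ℕ.< p
  1<p = ℕ.≤-trans (ℕ.m≤m+n 2 9) 10<p

  3<p : 3 ℕ.< p
  3<p = ℕ.≤-trans (ℕ.m≤m+n 4 7) 10<p

  5<p : 5 ℕ.< p
  5<p = ℕ.≤-trans (ℕ.m≤m+n 6 5) 10<p

  7<p : 7 ℕ.< p
  7<p = ℕ.≤-trans (ℕ.m≤m+n 8 3) 10<p

module Large (p : ℕ) (pr : Prime p) (112<p : 112 ℕ.< p) where

  open Regime p pr 112<p using (10<p; below113⁻; smallPrimes-∤; Below; solution)
  open Assemble p pr 10<p

  uniformly : ∃[ e ] All (Holds e) (wantedOf s∀) → Solved p
  uniformly (e , h) = solved
    (fromSystem 1 1<p C₁ s∀ covers∀₁ (below113⁻ _ tt) h)
    (fromSystem 2 2<p C₂ s∀ covers∀₂ (below113⁻ _ tt) h)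
    (fromSystem 3 3<p C₃ s∀ covers∀₃ (below113⁻ _ tt) h)
    (fromSystem 5 5<p C₅ s∀ covers∀₅ (below113⁻ _ tt) h)
    (fromSystem 7 7<p C₇ s∀ covers∀₇ (below113⁻ _ tt) h)

  fromGroup : ∀ w es → ∃[ c ] c ∈ fromPairs w es × ∃[ e ] All (Holds e) (Candidate.wanted c) → ∃[ e ] All (Holds e) w
  fromGroup w es (c , c∈ , e , h) = e , subst (All (Holds e)) (All.lookup same c∈) h
    where
    same : All (λ c → Candidate.wanted c ≡ w) (fromPairs w es)
    same = All.map⁺ (All.universal (λ _ → refl) es)

  fromConcrete : ∀ css → ∃[ c ] c ∈ map (λ cs → candidate (Requirements.reqs 1 (concrete cs)) 0ℤ 1ℤ) css × ∃[ e ] All (Holds e) (Candidate.wanted c) →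
    Destroying (1 ℕ.* p)
  fromConcrete css (c , c∈ , e , h) with ∈-map⁻ (λ cs → candidate (Requirements.reqs 1 (concrete cs)) 0ℤ 1ℤ) c∈
  ... | cs , _ , refl = build 1 1<p (concrete cs) h

  separately : ∀ css → (∃[ c ] c ∈ map (λ cs → candidate (Requirements.reqs 1 (concrete cs)) 0ℤ 1ℤ) css × ∃[ e ] All (Holds e) (Candidate.wanted c)) →
    ∃[ e ] All (Holds e) wanted₃₅₇ → ∃[ e ] All (Holds e) (wantedOf s₂) → Solved p
  separately css one (e , h) (e₂ , h₂) = solved
    (fromConcrete css one)
    (fromSystem 2 2<p C₂ s₂ covers₂ (below113⁻ _ tt) h₂)
    (fromSystem 3 3<p C₃ s₃ covers₃ (below113⁻ _ tt) (All.++⁻ˡ (wantedOf s₃) h))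
    (fromSystem 5 5<p C₅ s₅ covers₅ (below113⁻ _ tt) (All.++⁻ˡ (wantedOf s₅) (All.++⁻ʳ (wantedOf s₃) h)))
    (fromSystem 7 7<p C₇ s₇ covers₇ (below113⁻ _ tt) (All.++⁻ʳ (wantedOf s₅) (All.++⁻ʳ (wantedOf s₃) h)))

  isTrue⁻ : ∀ {m} → T (isTrue m) → m ≡ just true
  isTrue⁻ {just true} _ = refl

  check-sound : ∀ k t → Evidence k → T (check k t) → Solved p
  check-sound k@(known m ds) (split d t u) (hm , h) ok = go d ok
    where
    go : ∀ d → T ((0 <ᵇ d) ∧ ((d <ᵇ 113) ∧ (check (known m ((d , true) ∷ ds)) t ∧ check (known m ((d , false) ∷ ds)) u))) → Solved p
    go (suc d) ok = [ (λ r → check-sound (known m ((suc d , true) ∷ ds)) t (hm , (d≢0 , r) ∷ h) (proj₁ branches))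
                    , (λ n → check-sound (known m ((suc d , false) ∷ ds)) u (hm , n ∷ h) (proj₂ branches)) ]′ (res⊎nonRes (+ suc d))
      where
      bound = Equivalence.to (T-∧ {suc d <ᵇ 113} {check (known m ((suc d , true) ∷ ds)) t ∧ check (known m ((suc d , false) ∷ ds)) u}) ok
      branches = Equivalence.to (T-∧ {check (known m ((suc d , true) ∷ ds)) t} {check (known m ((suc d , false) ∷ ds)) u}) (proj₂ bound)
      d≢0 : ¬ Z p (+ suc d)
      d≢0 = small (suc d) (ℕ.<-≤-trans (ℕ.<ᵇ⇒< (suc d) 113 (proj₁ bound)) 112<p)
  check-sound (known m ds) (splitNeg t u) (hm , h) ok =
    [ (λ r → check-sound (known (just true) ds) t ((λ { refl → neg , r }) , h) (proj₁ branches))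
    , (λ n → check-sound (known (just false) ds) u ((λ { refl → n }) , h) (proj₂ branches)) ]′ (res⊎nonRes -1ℤ)
    where
    branches = Equivalence.to (T-∧ {check (known (just true) ds) t} {check (known (just false) ds) u}) ok
    neg : ¬ Z p -1ℤ
    neg z = ¬Z-1 (negᶻ z)
  check-sound k (uniform es) ev ok =
    uniformly (fromGroup (wantedOf s∀) es (group-sound (signℤ-sound k ev) smallPrimes (fromPairs (wantedOf s∀) es) smallPrimes-∤ ok))
  check-sound k (separate css es fs) ev ok = separately css
      (group-sound (signℤ-sound k ev) smallPrimes (map (λ cs → candidate (Requirements.reqs 1 (concrete cs)) 0ℤ 1ℤ) css) smallPrimes-∤ (proj₁ ok₁))
      (fromGroup wanted₃₅₇ es (group-sound (signℤ-sound k ev) smallPrimes (fromPairs wanted₃₅₇ es) smallPrimes-∤ (proj₁ ok₂)))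
      (fromGroup (wantedOf s₂) fs (group-sound (signℤ-sound k ev) smallPrimes (fromPairs (wantedOf s₂) fs) smallPrimes-∤ (proj₂ ok₂)))
    where
    ok₁ = Equivalence.to (T-∧ {groupOk (signℤ k) smallPrimes (map (λ cs → candidate (Requirements.reqs 1 (concrete cs)) 0ℤ 1ℤ) css)}
      {groupOk (signℤ k) smallPrimes (fromPairs wanted₃₅₇ es) ∧ groupOk (signℤ k) smallPrimes (fromPairs (wantedOf s₂) fs)}) ok
    ok₂ = Equivalence.to (T-∧ {groupOk (signℤ k) smallPrimes (fromPairs wanted₃₅₇ es)} {groupOk (signℤ k) smallPrimes (fromPairs (wantedOf s₂) fs)}) (proj₂ ok₁)
  check-sound (known m ds) smallResidues (hm , h) ok = uniformly (solution residues)
    where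
    oks : All (λ n → T (isTrue (signℕ 10000 ds (suc n)))) (upTo 42)
    oks = all⁻ (λ n → isTrue (signℕ 10000 ds (suc n))) (upTo 42) ok
    residues : Below 43
    residues (suc n) _ (ℕ.s≤s n<42) = proj₂ (signℕ-sound 10000 ds (suc n) h (isTrue⁻ (All.lookup oks (∈-upTo⁺ n<42))))

  checked : ∀ k t → Evidence k → check k t ≡ true → Solved p
  checked k t ev eq = check-sound k t ev (subst T (sym eq) tt)

  largeSolved : Solved p
  largeSolved = checked (known nothing []) tree ((λ ()) , []) tree-ok

-- Primes below 113

holdsᵇ : ∀ p .{{_ : NonZero p}} → ℕ → Req → Bool
holdsᵇ p e (nz f) = not (ev (+ e) f %ℕ p ≡ᵇ 0)
holdsᵇ p e (nr f) = all (λ t → not ((+ t * + t - ev (+ e) f) %ℕ p ≡ᵇ 0)) (upTo p)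

systemHolds : ∀ p .{{_ : NonZero p}} → System → ℕ → Bool
systemHolds p s e = all (λ d → not (d ℕ.% p ≡ᵇ 0)) (System.units s) ∧ all (holdsᵇ p e) (wantedOf s)

tabledIn : List (ℕ × List ℕ) → ℕ → Bool
tabledIn ts n = any (λ t → n ≡ᵇ proj₁ t) ts

tabled⇒destroying : ∀ ts n → all tableOk ts ≡ true → T (tabledIn ts n) → Destroying n
tabled⇒destroying ((m , l) ∷ ts) n eq t with tableOk (m , l) in r | n ≡ᵇ m in r′
... | true | true = subst Destroying (sym (ℕ.≡ᵇ⇒≡ n m (subst T (sym r′) tt))) (tableOk⇒destroying m l (subst T (sym r) tt))
... | true | false = tabled⇒destroying ts n eq t

-- For each p the parameters e for the moduli 2 p, 3 p, 5 p, 7 p. An entry 0 marks a modulus that is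
-- found in `tables`; as a parameter it is impossible, since e must not vanish.
smallSolutions : List (ℕ × (ℕ × ℕ × ℕ × ℕ))
smallSolutions =
  (11 , (0 , 3 , 3 , 0)) ∷
  (13 , (3 , 2 , 3 , 0)) ∷
  (17 , (4 , 3 , 3 , 0)) ∷
  (19 , (2 , 2 , 4 , 0)) ∷
  (23 , (5 , 5 , 5 , 0)) ∷
  (29 , (4 , 4 , 2 , 4)) ∷
  (31 , (3 , 14 , 3 , 14)) ∷
  (37 , (3 , 16 , 2 , 16)) ∷
  (41 , (4 , 3 , 3 , 3)) ∷
  (43 , (2 , 4 , 2 , 4)) ∷
  (47 , (5 , 5 , 5 , 5)) ∷
  (53 , (4 , 12 , 2 , 12)) ∷
  (59 , (2 , 2 , 2 , 2)) ∷
  (61 , (3 , 2 , 2 , 2)) ∷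
  (67 , (2 , 4 , 2 , 4)) ∷
  (71 , (7 , 7 , 7 , 7)) ∷
  (73 , (6 , 6 , 5 , 6)) ∷
  (79 , (3 , 12 , 3 , 12)) ∷
  (83 , (2 , 2 , 2 , 2)) ∷
  (89 , (4 , 3 , 3 , 3)) ∷
  (97 , (6 , 6 , 5 , 6)) ∷
  (101 , (4 , 2 , 4 , 2)) ∷
  (103 , (3 , 4 , 3 , 4)) ∷
  (107 , (2 , 3 , 2 , 3)) ∷
  (109 , (3 , 12 , 2 , 12)) ∷
  []

entryOk : ∀ q p .{{_ : NonZero p}} → System → ℕ → Bool
entryOk q p s e = tabledIn tables (q ℕ.* p) ∨ systemHolds p s e

smallOk : ℕ × (ℕ × ℕ × ℕ × ℕ) → Bool
smallOk (zero , _) = false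
smallOk (p@(suc _) , (e₂ , e₃ , e₅ , e₇)) =
  tabledIn tables (1 ℕ.* p) ∧ (entryOk 2 p s₂ e₂ ∧ (entryOk 3 p s₃ e₃ ∧ (entryOk 5 p s₅ e₅ ∧ entryOk 7 p s₇ e₇)))

smallSolutions-ok : all smallOk smallSolutions ≡ true
smallSolutions-ok = refl

-- A composite number below 113 has a prime factor at most 7, because 11² = 121.
inRange : ℕ → Bool
inRange n = any (λ t → n ≡ᵇ proj₁ t) smallSolutions ∨ any (properDivisor n) (2 ∷ 3 ∷ 5 ∷ 7 ∷ [])

inRange-ok : allFrom inRange 102 11 ≡ true
inRange-ok = refl

module Small (p : ℕ) (pr : Prime p) (10<p : 10 ℕ.< p) where

  open Assemble p pr 10<p

  private instance
    p≢0 : NonZero p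
    p≢0 = prime⇒nonZero pr

  nonzero : ∀ x → T (not (x %ℕ p ≡ᵇ 0)) → ¬ Z p x
  nonzero x t z = not⁻ t (ℕ.≡⇒≡ᵇ (x %ℕ p) 0 (trans (%ℕ-cong x 0ℤ (by (sym (ℤ.+-identityʳ x)) z)) (ℕ.m<n⇒m%n≡m (ℕ.<-trans (ℕ.s≤s ℕ.z≤n) 10<p))))

  holdsᵇ-sound : ∀ e r → T (holdsᵇ p e r) → Holds (+ e) r
  holdsᵇ-sound e (nz f) t = nonzero (ev (+ e) f) t
  holdsᵇ-sound e (nr f) t u z = nonzero (+ (u %ℕ p) * + (u %ℕ p) - ev (+ e) f)
    (All.lookup (all⁻ (λ t → not ((+ t * + t - ev (+ e) f) %ℕ p ≡ᵇ 0)) (upTo p) t) (∈-upTo⁺ (n%ℕd<d u p)))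
    (square-resp u (+ (u %ℕ p)) (ev (+ e) f) (%ℕ-Z p u) z)

  systemHolds-sound : ∀ s e → T (systemHolds p s e) → All (λ d → ¬ p ℕ.∣ d) (System.units s) × All (Holds (+ e)) (wantedOf s)
  systemHolds-sound s e t with Equivalence.to (T-∧ {all (λ d → not (d ℕ.% p ≡ᵇ 0)) (System.units s)}) t
  ... | us , hs = All.map (λ {d} u p∣d → not⁻ u (ℕ.≡⇒≡ᵇ (d ℕ.% p) 0 (ℕ.n∣m⇒m%n≡0 d p p∣d))) (all⁻ (λ d → not (d ℕ.% p ≡ᵇ 0)) (System.units s) us)
                , All.map (λ {r} → holdsᵇ-sound e r) (all⁻ (holdsᵇ p e) (wantedOf s) hs)

  fromEntry : ∀ q .{{_ : NonZero q}} → q ℕ.< p → ∀ C s e → all (covers s) (Requirements.reqs q C) ≡ true → T (entryOk q p s e) → Destroying (q ℕ.* p)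
  fromEntry q q<p C s e cov t = [ tabled⇒destroying tables (q ℕ.* p) tables-ok
      , (λ h → let us , hs = systemHolds-sound s e h in fromSystem q q<p C s cov us hs) ]′ (Equivalence.to (T-∨ {tabledIn tables (q ℕ.* p)}) t)

fromEntries : ∀ p → Prime p → 10 ℕ.< p → ∀ es → T (smallOk (p , es)) → Solved p
fromEntries p@(suc _) pr 10<p (e₂ , e₃ , e₅ , e₇) t = solved
    (tabled⇒destroying tables (1 ℕ.* p) tables-ok (proj₁ t₁))
    (fromEntry 2 2<p C₂ s₂ e₂ covers₂ (proj₁ t₂))
    (fromEntry 3 3<p C₃ s₃ e₃ covers₃ (proj₁ t₃))
    (fromEntry 5 5<p C₅ s₅ e₅ covers₅ (proj₁ t₅))
    (fromEntry 7 7<p C₇ s₇ e₇ covers₇ (proj₂ t₅))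
  where
  open Small p pr 10<p
  open Assemble p pr 10<p using (2<p; 3<p; 5<p; 7<p)
  t₁ = Equivalence.to (T-∧ {tabledIn tables (1 ℕ.* p)}) t
  t₂ = Equivalence.to (T-∧ {entryOk 2 p s₂ e₂}) (proj₂ t₁)
  t₃ = Equivalence.to (T-∧ {entryOk 3 p s₃ e₃}) (proj₂ t₂)
  t₅ = Equivalence.to (T-∧ {entryOk 5 p s₅ e₅}) (proj₂ t₃)

smallSolved : ∀ p → Prime p → 10 ℕ.< p → p ℕ.< 113 → Solved p
smallSolved p pr 10<p p<113 = [ listed , composite ]′ (Equivalence.to (T-∨ {any (λ t → p ≡ᵇ proj₁ t) smallSolutions}) range)
  where
  range : T (inRange p)
  range = subst T (sym (allFrom⁻ inRange 102 11 p inRange-ok 10<p p<113)) tt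
  listed : T (any (λ t → p ≡ᵇ proj₁ t) smallSolutions) → Solved p
  listed t = go (find (Any.any⁻ (λ t → p ≡ᵇ proj₁ t) smallSolutions t))
    where
    oks : All (T ∘ smallOk) smallSolutions
    oks = Candidates.all⁻ p pr 10<p smallOk smallSolutions (subst T (sym smallSolutions-ok) tt)
    go : ∃[ x ] x ∈ smallSolutions × T (p ≡ᵇ proj₁ x) → Solved p
    go ((p′ , es) , m , t) = fromEntries p pr 10<p es (subst (λ n → T (smallOk (n , es))) (sym (ℕ.≡ᵇ⇒≡ p p′ t)) (All.lookup oks m))
  composite : T (any (properDivisor p) (2 ∷ 3 ∷ 5 ∷ 7 ∷ [])) → Solved p
  composite t = go (find (Any.any⁻ (properDivisor p) (2 ∷ 3 ∷ 5 ∷ 7 ∷ []) t))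
    where
    impossible : ∀ d → ¬ T (properDivisor p d)
    impossible d@(suc _) t with Equivalence.to (T-∧ {1 <ᵇ d}) t
    ... | 1<d , t′ with Equivalence.to (T-∧ {d <ᵇ p}) t′
    ...   | d<p , r with prime⇒irreducible pr (ℕ.m%n≡0⇒n∣m p d (ℕ.≡ᵇ⇒≡ (p ℕ.% d) 0 r))
    ...     | inj₁ refl = 1<d
    ...     | inj₂ refl = ℕ.<-irrefl refl (ℕ.<ᵇ⇒< d d d<p)
    go : ∃[ d ] d ∈ (2 ∷ 3 ∷ 5 ∷ 7 ∷ []) × T (properDivisor p d) → Solved p
    go (d , _ , t) = ⊥-elim (impossible d t)

solve-prime : ∀ p → Prime p → 10 ℕ.< p → Solved p
solve-prime p pr 10<p = [ smallSolved p pr 10<p , Large.largeSolved p pr ]′ (ℕ.<-≤-connex p 113)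

-- Induction over the prime factorisation

exceptions : List ℕ
exceptions = 2 ∷ 3 ∷ 5 ∷ 7 ∷ []

productsTabled : all (λ q → all (λ r → tabledIn tables (q ℕ.* r) ∧ all (λ s → tabledIn tables (q ℕ.* (r ℕ.* s))) exceptions) exceptions) exceptions ≡ true
productsTabled = refl

all-∈ : {A : Set} (f : A → Bool) {xs : List A} {x : A} → T (all f xs) → x ∈ xs → T (f x)
all-∈ f {y ∷ ys} t (here refl) = proj₁ (Equivalence.to (T-∧ {f y}) t)
all-∈ f {y ∷ ys} t (there m) = all-∈ f (proj₂ (Equivalence.to (T-∧ {f y}) t)) m

tabled₂₃ : ∀ {q r} → q ∈ exceptions → r ∈ exceptions → T (tabledIn tables (q ℕ.* r) ∧ all (λ s → tabledIn tables (q ℕ.* (r ℕ.* s))) exceptions)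
tabled₂₃ {q} q∈ r∈ = all-∈ (λ r → tabledIn tables (q ℕ.* r) ∧ all (λ s → tabledIn tables (q ℕ.* (r ℕ.* s))) exceptions)
  (all-∈ (λ q → all (λ r → tabledIn tables (q ℕ.* r) ∧ all (λ s → tabledIn tables (q ℕ.* (r ℕ.* s))) exceptions) exceptions) (subst T (sym productsTabled) tt) q∈) r∈

pair : ∀ {q r} → q ∈ exceptions → r ∈ exceptions → Destroying (q ℕ.* r)
pair {q} {r} q∈ r∈ = tabled⇒destroying tables (q ℕ.* r) tables-ok (proj₁ (Equivalence.to (T-∧ {tabledIn tables (q ℕ.* r)}) (tabled₂₃ q∈ r∈)))

triple : ∀ {q r s} → q ∈ exceptions → r ∈ exceptions → s ∈ exceptions → Destroying (q ℕ.* (r ℕ.* s))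
triple {q} {r} {s} q∈ r∈ s∈ = tabled⇒destroying tables (q ℕ.* (r ℕ.* s)) tables-ok
  (all-∈ (λ s → tabledIn tables (q ℕ.* (r ℕ.* s))) (proj₂ (Equivalence.to (T-∧ {tabledIn tables (q ℕ.* r)}) (tabled₂₃ q∈ r∈))) s∈)

destroying-1 : Destroying 1
destroying-1 = record { image = λ x → x ; image-resp = λ _ _ z → z ; image-inj = λ _ _ z → z ; destroys = λ a b _ _ _ → divides (a - b) (sym (ℤ.*-identityʳ (a - b))) }

smallPrime : ∀ {r} → Prime r → r ℕ.≤ 10 → r ∈ exceptions
smallPrime {0} pr _ = contradiction pr (from-no (prime? 0))
smallPrime {1} pr _ = contradiction pr (from-no (prime? 1))
smallPrime {2} pr _ = here refl
smallPrime {3} pr _ = there (here refl)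
smallPrime {4} pr _ = contradiction pr (from-no (prime? 4))
smallPrime {5} pr _ = there (there (here refl))
smallPrime {6} pr _ = contradiction pr (from-no (prime? 6))
smallPrime {7} pr _ = there (there (there (here refl)))
smallPrime {8} pr _ = contradiction pr (from-no (prime? 8))
smallPrime {9} pr _ = contradiction pr (from-no (prime? 9))
smallPrime {10} pr _ = contradiction pr (from-no (prime? 10))
smallPrime {suc (suc (suc (suc (suc (suc (suc (suc (suc (suc (suc r))))))))))} pr le = contradiction le (ℕ.<⇒≱ (ℕ.m≤m+n 11 r))

-- The induction hypothesis. A factor q among 2, 3, 5, 7 cannot be split off by `destroying-*`,
-- since `Destroying q` is not at hand; so the products q m are carried along with m.
data Status (m : ℕ) : Set where
  one : m ≡ 1 → Status m
  exceptional : m ∈ exceptions → Status m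
  destroyable : Destroying m → (∀ {q} → q ∈ exceptions → Destroying (q ℕ.* m)) → Status m

times : ∀ {p q} → Solved p → q ∈ exceptions → Destroying (q ℕ.* p)
times s (here refl) = Solved.two s
times s (there (here refl)) = Solved.three s
times s (there (there (here refl))) = Solved.five s
times s (there (there (there (here refl)))) = Solved.seven s

-- Three exceptional primes cannot be grouped into pairs, which is what `triple` is for. For a
-- destroyable m the new factors q and r form a tabulated pair.
extend-small : ∀ {r m} .{{_ : NonZero m}} → r ∈ exceptions → Status m → Status (r ℕ.* m)
extend-small {r} r∈ (one refl) = exceptional (subst (_∈ exceptions) (sym (ℕ.*-identityʳ r)) r∈)
extend-small r∈ (exceptional m∈) = destroyable (pair r∈ m∈) (λ q∈ → triple q∈ r∈ m∈)
extend-small {r} {m} r∈ (destroyable d ds) = destroyable (ds r∈) (λ {q} q∈ → subst Destroying (ℕ.*-assoc q r m) (destroying-* (pair q∈ r∈) d))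

-- An exceptional m is absorbed by r, as m r is one of the solved moduli; with a further q, the
-- tabulated pair q m is split off from r instead.
extend-large : ∀ {r m} .{{_ : NonZero r}} .{{_ : NonZero m}} → Solved r → Status m → Status (r ℕ.* m)
extend-large {r} s (one refl) = destroyable (subst Destroying (ℕ.*-comm 1 r) (Solved.one s))
  (λ {q} q∈ → subst Destroying (cong (q ℕ.*_) (sym (ℕ.*-identityʳ r))) (times s q∈))
extend-large {r} {m} s (exceptional m∈) = destroyable (subst Destroying (ℕ.*-comm m r) (times s m∈))
  (λ {q} q∈ → subst Destroying (lem q m r) (destroying-* (pair q∈ m∈) prime-r))
  where
  prime-r : Destroying r
  prime-r = subst Destroying (ℕ.*-identityˡ r) (Solved.one s)
  lem : ∀ q m r → q ℕ.* m ℕ.* r ≡ q ℕ.* (r ℕ.* m)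
  lem = ℕ.solve-∀
extend-large {r} {m} s (destroyable d ds) = destroyable (destroying-* (subst Destroying (ℕ.*-identityˡ r) (Solved.one s)) d)
  (λ {q} q∈ → subst Destroying (ℕ.*-assoc q r m) (destroying-* (times s q∈) d))

status : ∀ ps → All Prime ps → Status (ℕ.product ps)
status [] [] = one refl
status (r ∷ ps) (pr ∷ prs) with ℕ.≤-<-connex r 10
... | inj₁ le = extend-small {{productOfPrimes≢0 prs}} (smallPrime pr le) (status ps prs)
... | inj₂ lt = extend-large {{prime⇒nonZero pr}} {{productOfPrimes≢0 prs}} (solve-prime r pr lt) (status ps prs)

theorem5 : (n : ℕ) .{{_ : NonZero n}} → n ∉ (2 ∷ 3 ∷ 5 ∷ 7 ∷ []) →
    Σ[ π ∈ Permutation′ n ] AP-Destroying π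
theorem5 n n∉ = destroying⇒permutation n (finish (subst Status (sym (isFactorisation F)) (status (factors F) (factorsPrime F))))
  where
  open PrimeFactorisation
  F : PrimeFactorisation n
  F = factorise n
  finish : Status n → Destroying n
  finish (one n≡1) = subst Destroying (sym n≡1) destroying-1
  finish (exceptional n∈) = contradiction n∈ n∉
  finish (destroyable d _) = d
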